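{- Let $q=3^m$ with $m\ge 2$, let $n\ge 2$ be an integer written as $n=3^h s$ with $h\ge0$ and $\gcd(s,3)=1$, and let $a\in\mathbb{F}_q^*$. Then $H_n(a)=H(a)+h$.
   Context: $\mathbb{F}_q\subset\mathbb{F}_{q^n}$. $\mathrm{Tr}$ is the absolute trace $\mathbb{F}_q\to\mathbb{F}_3$, $\mathrm{Tr}(x)=\sum_{j=0}^{m-1}x^{3^j}$, and $\mathrm{Tr}_{q^n\to q}(x)=x+x^q+\dots+x^{q^{n-1}}$. With $\omega=e^{2\pi i/3}$, $e(c)=\omega^{\mathrm{Tr}(c)}$ for $c\in\mathbb{F}_q$ and $e_n(b)=\omega^{\mathrm{Tr}(\mathrm{Tr}_{q^n\to q}(b))}$ for $b\in\mathbb{F}_{q^n}$. Define $K(a)=\sum_{x\in\mathbb{F}_q}e(x+a/x)$ and $K_n(a)=\sum_{x\in\mathbb{F}_{q^n}}e_n(x+a/x)$, where $a/x=a\,x^{Q-2}$ in a field of order $Q$ (so the term $x=0$ contributes $1$). $H(a)$ is the largest $k$ with $3^k\mid K(a)$ and $H_n(a)$ the largest $k$ with $3^k\mid K_n(a)$, with the convention that if $K(a)=0$ then $H(a)=m$, and if $K_n(a)=0$ then $H_n(a)=mn$. -}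

module Defs where

open import Level using (Level; _⊔_; 0ℓ) renaming (suc to lsuc)
open import Algebra.Bundles using (CommutativeRing; Semiring)
open import Algebra.Apartness.Bundles using (HeytingField)
open import Algebra.Morphism.Structures using (IsRingMonomorphism)
import Algebra.Definitions.RawMagma as RawMagmaDefinitions
import Algebra.Definitions.RawSemiring as RawSemiringDefinitions
open import Data.Bool.Base using (if_then_else_)
open import Data.Fin.Base using (Fin; toℕ)
import Data.Fin.Properties as Fin
open import Data.Integer.Base as ℤ using (ℤ; +_; 0ℤ; 1ℤ; ∣_∣)
open import Data.Integer.Divisibility.Signed as ℤ∣ using (divides)
import Data.Integer.Properties as ℤ
open import Data.Integer.Tactic.RingSolver using (solve-∀)
open import Data.Nat.Base as ℕ using (ℕ; zero; suc; _∸_; _≤_; _<_; z≤n; z<s)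
import Data.Nat.Properties as ℕ
open import Data.Product.Base using (∃; _,_; proj₁; _×_)
open import Function.Bundles using (Inverse)
open import Function.Properties.Inverse using (Inverse⇒Injection)
import Function.Construct.Symmetry as Symmetry
open import Relation.Binary.Definitions using (Decidable; DecidableEquality)
open import Relation.Binary.PropositionalEquality
  using (_≡_; _≢_; refl; sym; trans; cong; cong₂; isEquivalence; setoid)
open import Relation.Nullary using (yes; no; does; contradiction; _×-dec_)
open import Relation.Nullary.Decidable using (map′; via-injection)
import Relation.Unary as Unary

private
  variable
    c ℓ₁ ℓ₂ c′ ℓ₁′ ℓ₂′ p : Level

-- ℤ[ω] for a primitive cube root of unity ω: x +ω y stands for x + yω, and
-- ω² = -1 - ω.

infix 5 _+ω_

record ℤ[ω] : Set where
  constructor _+ω_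
  field
    re : ℤ
    im : ℤ

open ℤ[ω] public

module Eisenstein where

  infixl 6 _+_
  infixl 7 _*_
  infix  8 -_
  infix  4 _≟_

  _+_ : ℤ[ω] → ℤ[ω] → ℤ[ω]
  (a +ω b) + (c +ω d) = (a ℤ.+ c) +ω (b ℤ.+ d)

  _*_ : ℤ[ω] → ℤ[ω] → ℤ[ω]
  (a +ω b) * (c +ω d) =
    (a ℤ.* c ℤ.- b ℤ.* d) +ω (a ℤ.* d ℤ.+ b ℤ.* c ℤ.- b ℤ.* d)

  -_ : ℤ[ω] → ℤ[ω]
  - (a +ω b) = (ℤ.- a) +ω (ℤ.- b)

  fromℤ : ℤ → ℤ[ω]
  fromℤ a = a +ω 0ℤ

  0# 1# ω : ℤ[ω]
  0# = fromℤ 0ℤ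
  1# = fromℤ 1ℤ
  ω  = 0ℤ +ω 1ℤ

  _≟_ : DecidableEquality ℤ[ω]
  (a +ω b) ≟ (c +ω d) =
    map′ (λ (p , q) → cong₂ _+ω_ p q) (λ p → cong re p , cong im p)
         ((a ℤ.≟ c) ×-dec (b ℤ.≟ d))

  private
    assoc-re : ∀ a b c d e f →
      (a ℤ.* c ℤ.- b ℤ.* d) ℤ.* e ℤ.- (a ℤ.* d ℤ.+ b ℤ.* c ℤ.- b ℤ.* d) ℤ.* f ≡
      a ℤ.* (c ℤ.* e ℤ.- d ℤ.* f) ℤ.- b ℤ.* (c ℤ.* f ℤ.+ d ℤ.* e ℤ.- d ℤ.* f)
    assoc-re = solve-∀

    assoc-im : ∀ a b c d e f →
      (a ℤ.* c ℤ.- b ℤ.* d) ℤ.* f ℤ.+ (a ℤ.* d ℤ.+ b ℤ.* c ℤ.- b ℤ.* d) ℤ.* e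
        ℤ.- (a ℤ.* d ℤ.+ b ℤ.* c ℤ.- b ℤ.* d) ℤ.* f ≡
      a ℤ.* (c ℤ.* f ℤ.+ d ℤ.* e ℤ.- d ℤ.* f) ℤ.+ b ℤ.* (c ℤ.* e ℤ.- d ℤ.* f)
        ℤ.- b ℤ.* (c ℤ.* f ℤ.+ d ℤ.* e ℤ.- d ℤ.* f)
    assoc-im = solve-∀

    comm-re : ∀ a b c d → a ℤ.* c ℤ.- b ℤ.* d ≡ c ℤ.* a ℤ.- d ℤ.* b
    comm-re = solve-∀

    comm-im : ∀ a b c d →
      a ℤ.* d ℤ.+ b ℤ.* c ℤ.- b ℤ.* d ≡ c ℤ.* b ℤ.+ d ℤ.* a ℤ.- d ℤ.* b
    comm-im = solve-∀

    identityˡ-re : ∀ a b → 1ℤ ℤ.* a ℤ.- 0ℤ ℤ.* b ≡ a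
    identityˡ-re = solve-∀

    identityˡ-im : ∀ a b → 1ℤ ℤ.* b ℤ.+ 0ℤ ℤ.* a ℤ.- 0ℤ ℤ.* b ≡ b
    identityˡ-im = solve-∀

    distribˡ-re : ∀ a b c d e f →
      a ℤ.* (c ℤ.+ e) ℤ.- b ℤ.* (d ℤ.+ f) ≡
      (a ℤ.* c ℤ.- b ℤ.* d) ℤ.+ (a ℤ.* e ℤ.- b ℤ.* f)
    distribˡ-re = solve-∀

    distribˡ-im : ∀ a b c d e f →
      a ℤ.* (d ℤ.+ f) ℤ.+ b ℤ.* (c ℤ.+ e) ℤ.- b ℤ.* (d ℤ.+ f) ≡
      (a ℤ.* d ℤ.+ b ℤ.* c ℤ.- b ℤ.* d) ℤ.+ (a ℤ.* f ℤ.+ b ℤ.* e ℤ.- b ℤ.* f)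
    distribˡ-im = solve-∀

  +-comm : ∀ x y → x + y ≡ y + x
  +-comm (a +ω b) (c +ω d) = cong₂ _+ω_ (ℤ.+-comm a c) (ℤ.+-comm b d)

  +-assoc : ∀ x y z → (x + y) + z ≡ x + (y + z)
  +-assoc (a +ω b) (c +ω d) (e +ω f) =
    cong₂ _+ω_ (ℤ.+-assoc a c e) (ℤ.+-assoc b d f)

  +-identityˡ : ∀ x → 0# + x ≡ x
  +-identityˡ (a +ω b) = cong₂ _+ω_ (ℤ.+-identityˡ a) (ℤ.+-identityˡ b)

  -‿inverseˡ : ∀ x → (- x) + x ≡ 0#
  -‿inverseˡ (a +ω b) = cong₂ _+ω_ (ℤ.+-inverseˡ a) (ℤ.+-inverseˡ b)

  *-comm : ∀ x y → x * y ≡ y * x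
  *-comm (a +ω b) (c +ω d) = cong₂ _+ω_ (comm-re a b c d) (comm-im a b c d)

  *-assoc : ∀ x y z → (x * y) * z ≡ x * (y * z)
  *-assoc (a +ω b) (c +ω d) (e +ω f) =
    cong₂ _+ω_ (assoc-re a b c d e f) (assoc-im a b c d e f)

  *-identityˡ : ∀ x → 1# * x ≡ x
  *-identityˡ (a +ω b) = cong₂ _+ω_ (identityˡ-re a b) (identityˡ-im a b)

  *-distribˡ-+ : ∀ x y z → x * (y + z) ≡ x * y + x * z
  *-distribˡ-+ (a +ω b) (c +ω d) (e +ω f) =
    cong₂ _+ω_ (distribˡ-re a b c d e f) (distribˡ-im a b c d e f)

  commutativeRing : CommutativeRing 0ℓ 0ℓ
  commutativeRing = record
    { Carrier = ℤ[ω] ; _≈_ = _≡_ ; _+_ = _+_ ; _*_ = _*_ ; -_ = -_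
    ; 0# = 0# ; 1# = 1#
    ; isCommutativeRing = record
      { isRing = record
        { +-isAbelianGroup = record
          { isGroup = record
            { isMonoid = record
              { isSemigroup = record
                { isMagma = record { isEquivalence = isEquivalence ; ∙-cong = cong₂ _+_ }
                ; assoc = +-assoc }
              ; identity = +-identityˡ , λ x → trans (+-comm x 0#) (+-identityˡ x) }
            ; inverse = -‿inverseˡ , λ x → trans (+-comm x (- x)) (-‿inverseˡ x)
            ; ⁻¹-cong = cong -_ }
          ; comm = +-comm }
        ; *-cong = cong₂ _*_
        ; *-assoc = *-assoc
        ; *-identity = *-identityˡ , λ x → trans (*-comm x 1#) (*-identityˡ x)
        ; distrib = *-distribˡ-+ , λ x y z →
            trans (*-comm (y + z) x)
              (trans (*-distribˡ-+ x y z) (cong₂ _+_ (*-comm x y) (*-comm x z))) }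
      ; *-comm = *-comm } }

  open Semiring (CommutativeRing.semiring commutativeRing) public using (rawSemiring)
  open RawSemiringDefinitions rawSemiring public
    using (sum; _^_)
  open RawMagmaDefinitions
    (Semiring.*-rawMagma (CommutativeRing.semiring commutativeRing)) public
    using (_∣_; _,_)

record IsLargest (P : ℕ → Set p) (k : ℕ) : Set p where
  field
    holds    : P k
    greatest : ∀ j → P j → j ≤ k

largest : {P : ℕ → Set p} → Unary.Decidable P → P 0 →
          ∀ N → (∀ k → P k → k ≤ N) → ∃ (IsLargest P)
largest P? P0 zero    P≤N = 0 , record { holds = P0 ; greatest = P≤N }
largest P? P0 (suc N) P≤N with P? (suc N)
... | yes PN = suc N , record { holds = PN ; greatest = P≤N }
... | no ¬PN = largest P? P0 N λ k Pk →
  ℕ.s≤s⁻¹ (ℕ.≤∧≢⇒< (P≤N k Pk) λ { refl → ¬PN Pk })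

-- Divisibility in ℤ[ω]; on rational integers it agrees with that of ℤ.
3^_∣_ : ℕ → ℤ[ω] → Set
3^ k ∣ z = Eisenstein.fromℤ (+ (3 ℕ.^ k)) Eisenstein.∣ z

private
  module ℤω = Eisenstein

  scale-re : ∀ x y n → x ℤ.* n ℤ.- y ℤ.* 0ℤ ≡ x ℤ.* n
  scale-re = solve-∀

  scale-im : ∀ x y n → x ℤ.* 0ℤ ℤ.+ y ℤ.* n ℤ.- y ℤ.* 0ℤ ≡ y ℤ.* n
  scale-im = solve-∀

  toParts : ∀ {n z} → ℤω.fromℤ n ℤω.∣ z → (n ℤ∣.∣ re z) × (n ℤ∣.∣ im z)
  toParts {n} ((x +ω y) ℤω., refl) =
    divides x (scale-re x y n) , divides y (scale-im x y n)

  fromParts : ∀ {n z} → (n ℤ∣.∣ re z) × (n ℤ∣.∣ im z) → ℤω.fromℤ n ℤω.∣ z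
  fromParts {n} {a +ω b} (divides x p , divides y q) =
    (x +ω y) ℤω., cong₂ _+ω_ (trans (scale-re x y n) (sym p))
                            (trans (scale-im x y n) (sym q))

  k<3^k : ∀ k → k < 3 ℕ.^ k
  k<3^k zero    = z<s
  k<3^k (suc k) = ℕ.≤-trans (ℕ.+-mono-≤ (ℕ.≤-trans (ℕ.s≤s z≤n) (k<3^k k)) (k<3^k k))
    (ℕ.+-monoʳ-≤ (3 ℕ.^ k) (ℕ.m≤m+n (3 ℕ.^ k) (3 ℕ.^ k ℕ.+ 0)))

  bound : ∀ k i → i ≢ 0ℤ → (+ (3 ℕ.^ k)) ℤ∣.∣ i → k ≤ ∣ i ∣
  bound k i i≢0 d = ℕ.≤-trans (ℕ.<⇒≤ (k<3^k k))
    (∣⇒≤ ⦃ ℕ.≢-nonZero (λ eq → i≢0 (ℤ.∣i∣≡0⇒i≡0 eq)) ⦄ (ℤ∣.∣⇒∣ᵤ d))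
    where open import Data.Nat.Divisibility using (∣⇒≤)

3^_∣?_ : Decidable 3^_∣_
3^ k ∣? z = map′ fromParts toParts
  ((+ (3 ℕ.^ k) ℤ∣.∣? re z) ×-dec (+ (3 ℕ.^ k) ℤ∣.∣? im z))

3^k∣z⇒k≤ : ∀ k z → z ≢ Eisenstein.0# → 3^ k ∣ z → k ≤ ∣ re z ∣ ℕ.+ ∣ im z ∣
3^k∣z⇒k≤ k (a +ω b) z≢0 d with a ℤ.≟ 0ℤ | b ℤ.≟ 0ℤ | toParts d
... | no a≢0   | _        | p , _ = ℕ.m≤n⇒m≤n+o ∣ b ∣ (bound k a a≢0 p)
... | yes _    | no b≢0   | _ , q = ℕ.m≤n⇒m≤o+n ∣ a ∣ (bound k b b≢0 q)
... | yes refl | yes refl | _     = contradiction refl z≢0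

largestPower : ∀ z → z ≢ Eisenstein.0# → ∃ (IsLargest (3^_∣ z))
largestPower z z≢0 = largest (3^_∣? z) (z ℤω., R.*-identityʳ z)
  (∣ re z ∣ ℕ.+ ∣ im z ∣) (λ k → 3^k∣z⇒k≤ k z z≢0)
  where module R = CommutativeRing ℤω.commutativeRing

-- The largest k with 3^k ∣ z, or d if z is zero.
exponentOr : ℕ → ℤ[ω] → ℕ
exponentOr d z with z Eisenstein.≟ Eisenstein.0#
... | yes _  = d
... | no z≢0 = proj₁ (largestPower z z≢0)

-- Equality is decidable, so by tightness the apartness is just _≉_.
record FiniteField c ℓ₁ ℓ₂ (order : ℕ) : Set (lsuc (c ⊔ ℓ₁ ⊔ ℓ₂)) where
  field
    heytingField : HeytingField c ℓ₁ ℓ₂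

  commutativeRing : CommutativeRing c ℓ₁
  commutativeRing = record
    { isCommutativeRing = HeytingField.isCommutativeRing heytingField }

  open CommutativeRing commutativeRing public
    renaming (setoid to ≈-setoid)
  open Semiring semiring public using (rawSemiring)
  open RawSemiringDefinitions rawSemiring public using (sum; _^_)

  field
    enumeration : Inverse (setoid (Fin order)) ≈-setoid

  element : Fin order → Carrier
  element = Inverse.to enumeration

  infix 4 _≟_
  _≟_ : Decidable _≈_
  _≟_ = via-injection (Inverse⇒Injection (Symmetry.inverse enumeration)) Fin._≟_

record Extension {Q Q′} (F : FiniteField c ℓ₁ ℓ₂ Q)
                 (E : FiniteField c′ ℓ₁′ ℓ₂′ Q′) : Set (c ⊔ ℓ₁ ⊔ c′ ⊔ ℓ₁′) where
  private
    module F = FiniteField F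
    module E = FiniteField E
  field
    embed              : F.Carrier → E.Carrier
    isRingMonomorphism : IsRingMonomorphism F.rawRing E.rawRing embed

module _ {Q : ℕ} (E : FiniteField c ℓ₁ ℓ₂ Q) where
  open FiniteField E

  absoluteTrace : (m : ℕ) → Carrier → Carrier
  absoluteTrace m x = sum {m} λ j → x ^ (3 ℕ.^ toℕ j)

  relativeTrace : (q n : ℕ) → Carrier → Carrier
  relativeTrace q n x = sum {n} λ j → x ^ (q ℕ.^ toℕ j)

  -- ω^ t for t in the prime field {0, 1, 2} of a field of characteristic 3;
  -- the last branch is the case t ≈ 2.
  ω^_ : Carrier → ℤ[ω]
  ω^ t = if does (t ≟ 0#) then Eisenstein.1#
         else if does (t ≟ 1#) then Eisenstein.ω
         else Eisenstein.ω Eisenstein.^ 2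

  -- a * x ^ (Q ∸ 2) is a / x, with the value 0 at x = 0.
  kloostermanSum : (Carrier → ℤ[ω]) → Carrier → ℤ[ω]
  kloostermanSum ψ a = Eisenstein.sum λ i →
    let x = element i in ψ (x + a * x ^ (Q ∸ 2))

module _ (m : ℕ) (F : FiniteField c ℓ₁ ℓ₂ (3 ℕ.^ m)) where
  open FiniteField F using (Carrier)

  e : Carrier → ℤ[ω]
  e x = ω^_ F (absoluteTrace F m x)

  K : Carrier → ℤ[ω]
  K = kloostermanSum F e

  H : Carrier → ℕ
  H a = exponentOr m (K a)

module _ (m n : ℕ) (E : FiniteField c ℓ₁ ℓ₂ ((3 ℕ.^ m) ℕ.^ n)) where
  open FiniteField E using (Carrier)

  -- The relative trace lies in the subfield of order 3^m, whose absolute trace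
  -- is given by the same power sum evaluated in E.
  eₙ : Carrier → ℤ[ω]
  eₙ b = ω^_ E (absoluteTrace E m (relativeTrace E (3 ℕ.^ m) n b))

  Kₙ : Carrier → ℤ[ω]
  Kₙ = kloostermanSum E eₙ

  Hₙ : Carrier → ℕ
  Hₙ a = exponentOr (m ℕ.* n) (Kₙ a)

module Submission where

-- For a completely multiplicative χ on monic polynomials over F_q that sums
-- the additive character at x + a/x over the roots x, orthogonality makes the
-- sum of χ over the polynomials of degree d vanish for d ≥ 3, so that
-- ∑ χ(f) T^deg f = 1 - tT + qT² with t = 1 - K(a). Unique factorization turns
-- its logarithmic derivative into Newton's identities for the sums of
-- deg P · χ(P)^k over irreducible P with k · deg P = n. Such a sum is K_n(a) - 1:
-- grouping the elements of F_{q^n} by their minimal polynomials, every P of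
-- degree dividing n must occur deg P times, since the same identities for
-- χ = 1 give the total q^n. Hence K_n(a) = 1 - αⁿ - βⁿ with α + β = t, αβ = q.
--
-- Put N_n = q^n + K_n(a) = (1 - αⁿ)(1 - βⁿ). K(a) is an integer, and |K(a)| < q
-- because its q terms are cube roots of unity, the one at 0 is 1, and not all
-- are 1 when m ≥ 2. So H(a) and H_n(a) are the exponents of 3 in N_1 and N_n,
-- even for vanishing sums. As 3 ∣ K(a) and 9 ∣ q, N_n / N_1 ≡ n modulo 3 and
-- N_{3j} / N_j ≡ 3 modulo 9.

open import Defs
open import Level using (Level; 0ℓ)
open import Algebra.Apartness.Bundles using (HeytingField)
open import Algebra.Bundles using (CommutativeRing; CommutativeSemiring; RawRing)
import Algebra.Definitions.RawSemiring
open import Algebra.Morphism.Structures using (IsRingMonomorphism)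
import Algebra.Morphism.RingMonomorphism
import Algebra.Properties.AbelianGroup
import Algebra.Properties.CommutativeSemigroup
import Algebra.Properties.CommutativeSemiring.Exp
import Algebra.Properties.Ring
import Algebra.Properties.Semiring.Exp
import Algebra.Properties.Semiring.Mult
import Algebra.Properties.Semiring.Mult.TCOptimised
import Algebra.Solver.Ring
import Algebra.Solver.Ring.AlmostCommutativeRing as ACR
open import Algebra.Structures using (IsCommutativeRing)
open import Data.Bool.Base using (if_then_else_)
open import Data.Empty using (⊥; ⊥-elim)
open import Data.Fin.Base as Fin using (Fin; toℕ)
import Data.Fin.Properties as Fin
open import Data.Integer.Base as ℤ using (ℤ; 0ℤ; 1ℤ; ∣_∣)
open import Data.Integer.Divisibility.Signed as ℤ∣ using (divides)
import Data.Integer.Properties as ℤ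
open import Data.Integer.Tactic.RingSolver using (solve-∀)
open import Data.List.Base
  using (List; []; _∷_; _++_; allFin; applyUpTo; cartesianProductWith; filter; foldr; length; map; tabulate; upTo)
open import Data.List.Membership.Propositional using (_∈_; find; lose)
import Data.List.Membership.Propositional.Properties as ∈
open import Data.List.Membership.Propositional.Properties.WithK using (unique∧set⇒bag)
open import Data.List.Properties
  using (length-applyUpTo; length-map; length-tabulate; map-cong; map-∘; ∷-injectiveˡ; ∷-injectiveʳ; ≡-dec)
open import Data.List.Relation.Binary.BagAndSetEquality using (∼bag⇒↭)
open import Data.List.Relation.Binary.Permutation.Propositional using (_↭_; ↭⇒↭ₛ)
open import Data.List.Relation.Binary.Permutation.Propositional.Properties using (↭-length)
import Data.List.Relation.Binary.Permutation.Setoid.Properties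
open import Data.List.Relation.Unary.All as All using (All; []; _∷_)
open import Data.List.Relation.Unary.AllPairs using ([]; _∷_)
open import Data.List.Relation.Unary.Any using (any?; here; there)
open import Data.List.Relation.Unary.Unique.Propositional using (Unique)
import Data.List.Relation.Unary.Unique.Propositional.Properties as Unique
import Data.Maybe.Base as Maybe
open import Data.Nat.Base as ℕ using (ℕ; zero; suc; pred; _≤_; _<_; _∸_; z≤n; s≤s)
import Data.Nat.Divisibility as ℕ∣
import Data.Nat.DivMod as ℕ
open import Data.Nat.GCD using (gcd; gcd-greatest)
open import Data.Nat.Primality using (euclidsLemma; prime?)
import Data.Nat.Properties as ℕ
open import Data.Product.Base using (∃; ∃₂; _,_; proj₁; proj₂; _×_)
open import Data.Sum.Base as Sum using (_⊎_; inj₁; inj₂)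
open import Function.Base using (_∘_; id)
open import Function.Bundles using (Injection; Inverse; mk⇔; _⇔_)
open import Function.Properties.Inverse using (Inverse⇒Injection)
open import Relation.Binary.Consequences using (dec⇒weaklyDec)
open import Relation.Binary.Definitions using (DecidableEquality; WeaklyDecidable)
open import Relation.Binary.PropositionalEquality as ≡
  using (_≡_; _≢_; refl; sym; trans; cong; cong₂; subst; subst₂)
import Relation.Binary.Reasoning.Setoid
open import Relation.Nullary using (¬_; Dec; yes; no; contradiction; does; ¬?; _×-dec_)
open import Relation.Nullary.Decidable using (decidable-stable; from-yes)
import Relation.Unary as Unary

-- The numbers N_n = q^n + K_n(a) are the right object because N_1 divides N_n with an explicit
-- integer quotient, as for point counts of an elliptic curve; K_n(a) itself has no such
-- multiplicative structure. The numbers α and β are never constructed: α^n + β^n and (1 - α^n)(1 -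
-- β^n) are given by integer recurrences. There are no power series and no Galois theory either.
-- Newton's identities are a double count of deg f = ∑ v_P(f) deg P over the monic f of degree n,
-- which makes sense in every commutative semiring. The semiring is ℤ[ω] for the Kloosterman
-- character and ℕ for χ = 1. In ℕ the bound deg P on the number of roots of P can be compared with
-- the exact total, and this replaces a proof that P splits in F_{q^n}. Weil's bound is avoided,
-- since |K(a)| < q is enough. The latter fails for m = 1: with q = 3 and a = -1 all three terms are
-- 1.

-- Ring identities with integer coefficients

module IntegerCoefficientSolver {c ℓ} (R : CommutativeRing c ℓ) where
  open CommutativeRing R hiding (zero)
    renaming (refl to ≈-refl; sym to ≈-sym; trans to ≈-trans; reflexive to ≈-reflexive)
  open Algebra.Properties.Ring ring
  open Algebra.Properties.AbelianGroup +-abelianGroup using (⁻¹-∙-comm)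
  open Algebra.Properties.Semiring.Mult.TCOptimised semiring
    renaming (_×_ to infixl 8 _⋆_)
  open Relation.Binary.Reasoning.Setoid setoid

  ⟪_⟫ : ℤ → Carrier
  ⟪ ℤ.+ n ⟫      = n ⋆ 1#
  ⟪ ℤ.-[1+ n ] ⟫ = - (suc n ⋆ 1#)

  ⟪⟫-⊖ : ∀ m n → ⟪ m ℤ.⊖ n ⟫ ≈ m ⋆ 1# - n ⋆ 1#
  ⟪⟫-⊖ m zero = begin
    m ⋆ 1#          ≈⟨ +-identityʳ _ ⟨
    m ⋆ 1# + 0#     ≈⟨ +-congˡ -0#≈0# ⟨
    m ⋆ 1# - 0#     ∎
  ⟪⟫-⊖ zero (suc n) = ≈-sym (+-identityˡ _)
  ⟪⟫-⊖ (suc m) (suc n) = begin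
    ⟪ suc m ℤ.⊖ suc n ⟫                    ≡⟨ ≡.cong ⟪_⟫ (ℤ.[1+m]⊖[1+n]≡m⊖n m n) ⟩
    ⟪ m ℤ.⊖ n ⟫                            ≈⟨ ⟪⟫-⊖ m n ⟩
    m ⋆ 1# - n ⋆ 1#                      ≈⟨ +-congʳ (+-identityˡ _) ⟨
    0# + m ⋆ 1# - n ⋆ 1#                 ≈⟨ +-congʳ (+-congʳ (-‿inverseʳ 1#)) ⟨
    1# - 1# + m ⋆ 1# - n ⋆ 1#            ≈⟨ +-congʳ (+-assoc _ _ _) ⟩
    1# + (- 1# + m ⋆ 1#) - n ⋆ 1#        ≈⟨ +-congʳ (+-congˡ (+-comm _ _)) ⟩
    1# + (m ⋆ 1# - 1#) - n ⋆ 1#          ≈⟨ +-congʳ (+-assoc _ _ _) ⟨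
    1# + m ⋆ 1# - 1# - n ⋆ 1#            ≈⟨ +-assoc _ _ _ ⟩
    1# + m ⋆ 1# + (- 1# - n ⋆ 1#)        ≈⟨ +-congˡ (⁻¹-∙-comm _ _) ⟩
    1# + m ⋆ 1# - (1# + n ⋆ 1#)          ≈⟨ +-cong (1+× m 1#) (-‿cong (1+× n 1#)) ⟨
    suc m ⋆ 1# - suc n ⋆ 1#              ∎

  ⟪⟫-neg : ∀ i → ⟪ ℤ.- i ⟫ ≈ - ⟪ i ⟫
  ⟪⟫-neg ℤ.+0        = ≈-sym -0#≈0#
  ⟪⟫-neg ℤ.+[1+ n ]  = ≈-refl
  ⟪⟫-neg ℤ.-[1+ n ]  = ≈-sym (-‿involutive _)

  ⟪⟫-+ : ∀ i j → ⟪ i ℤ.+ j ⟫ ≈ ⟪ i ⟫ + ⟪ j ⟫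
  ⟪⟫-+ (ℤ.+ m)    (ℤ.+ n)    = ×-homo-+ 1# m n
  ⟪⟫-+ (ℤ.+ m)    ℤ.-[1+ n ] = ⟪⟫-⊖ m (suc n)
  ⟪⟫-+ ℤ.-[1+ m ] (ℤ.+ n)    = ≈-trans (⟪⟫-⊖ n (suc m)) (+-comm _ _)
  ⟪⟫-+ ℤ.-[1+ m ] ℤ.-[1+ n ] = begin
    - (suc (suc (m ℕ.+ n)) ⋆ 1#)      ≡⟨ ≡.cong (λ k → - (suc k ⋆ 1#)) (ℕ.+-suc m n) ⟨
    - ((suc m ℕ.+ suc n) ⋆ 1#)        ≈⟨ -‿cong (×-homo-+ 1# (suc m) (suc n)) ⟩
    - (suc m ⋆ 1# + suc n ⋆ 1#)       ≈⟨ ⁻¹-∙-comm _ _ ⟨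
    - (suc m ⋆ 1#) - (suc n ⋆ 1#)     ∎

  ⟪⟫-*⁺ : ∀ m j → ⟪ ℤ.+ m ℤ.* j ⟫ ≈ ⟪ ℤ.+ m ⟫ * ⟪ j ⟫
  ⟪⟫-*⁺ zero j = begin
    ⟪ ℤ.+ 0 ℤ.* j ⟫   ≡⟨ ≡.cong ⟪_⟫ (ℤ.*-zeroˡ j) ⟩
    0#              ≈⟨ zeroˡ _ ⟨
    0# * ⟪ j ⟫      ∎
  ⟪⟫-*⁺ (suc m) j = begin
    ⟪ ℤ.+ suc m ℤ.* j ⟫             ≡⟨ ≡.cong ⟪_⟫ (ℤ.suc-* (ℤ.+ m) j) ⟩
    ⟪ j ℤ.+ ℤ.+ m ℤ.* j ⟫           ≈⟨ ⟪⟫-+ j _ ⟩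
    ⟪ j ⟫ + ⟪ ℤ.+ m ℤ.* j ⟫         ≈⟨ +-cong (≈-sym (*-identityˡ _)) (⟪⟫-*⁺ m j) ⟩
    1# * ⟪ j ⟫ + ⟪ ℤ.+ m ⟫ * ⟪ j ⟫  ≈⟨ distribʳ _ _ _ ⟨
    (1# + ⟪ ℤ.+ m ⟫) * ⟪ j ⟫        ≈⟨ *-congʳ (1+× m 1#) ⟨
    ⟪ ℤ.+ suc m ⟫ * ⟪ j ⟫           ∎

  ⟪⟫-* : ∀ i j → ⟪ i ℤ.* j ⟫ ≈ ⟪ i ⟫ * ⟪ j ⟫
  ⟪⟫-* (ℤ.+ m)    j = ⟪⟫-*⁺ m j
  ⟪⟫-* ℤ.-[1+ m ] j = begin
    ⟪ ℤ.-[1+ m ] ℤ.* j ⟫           ≡⟨ ≡.cong ⟪_⟫ (ℤ.neg-distribˡ-* (ℤ.+ suc m) j) ⟨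
    ⟪ ℤ.- (ℤ.+ suc m ℤ.* j) ⟫      ≈⟨ ⟪⟫-neg (ℤ.+ suc m ℤ.* j) ⟩
    - ⟪ ℤ.+ suc m ℤ.* j ⟫          ≈⟨ -‿cong (⟪⟫-*⁺ (suc m) j) ⟩
    - (⟪ ℤ.+ suc m ⟫ * ⟪ j ⟫)      ≈⟨ -‿distribˡ-* _ _ ⟩
    - ⟪ ℤ.+ suc m ⟫ * ⟪ j ⟫        ∎

  morphism : ℤ.+-*-rawRing ACR.-Raw-AlmostCommutative⟶ ACR.fromCommutativeRing R
  morphism = record
    { ⟦_⟧ = ⟪_⟫ ; +-homo = ⟪⟫-+ ; *-homo = ⟪⟫-* ; -‿homo = ⟪⟫-neg
    ; 0-homo = ≈-refl ; 1-homo = ≈-refl }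

  -- Comparing the integers is sound but incomplete, as R may have positive characteristic. This is
  -- why 3 = 0 enters the later computations as an explicit rewriting step.
  weaklyDecidable : WeaklyDecidable (ACR.Induced-equivalence morphism)
  weaklyDecidable i j =
    Maybe.map (λ p → ≈-reflexive (≡.cong ⟪_⟫ p)) (dec⇒weaklyDec ℤ._≟_ i j)

  open Algebra.Solver.Ring ℤ.+-*-rawRing (ACR.fromCommutativeRing R)
    morphism weaklyDecidable public
    using (solve; con; _:+_; _:*_; _:-_; :-_; _:=_)

-- Fields with decidable propositional equality

record DiscreteField (A : Set) : Set where
  infixl 6 _+_
  infixl 7 _*_
  infix  8 -_
  infix  4 _≟_
  field
    _+_ _*_ : A → A → A
    -_ : A → A
    0# 1# : A
    isCommutativeRing : IsCommutativeRing _≡_ _+_ _*_ -_ 0# 1#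
    1≢0 : 1# ≢ 0#
    inverse : ∀ x → x ≢ 0# → ∃ λ y → x * y ≡ 1#
    _≟_ : DecidableEquality A

  commutativeRing : CommutativeRing 0ℓ 0ℓ
  commutativeRing = record { isCommutativeRing = isCommutativeRing }

-- Polynomials over a discrete field

module Polynomials {A : Set} (K : DiscreteField A) where
  open DiscreteField K
  open CommutativeRing commutativeRing
    using (+-congˡ; +-congʳ; *-congʳ; +-assoc; +-comm; +-identityˡ; +-identityʳ; *-identityˡ; *-identityʳ; zeroˡ; zeroʳ; *-comm; *-assoc; _-_)
  open Algebra.Properties.Ring (CommutativeRing.ring commutativeRing) using (+-cancelˡ)
  private module S = IntegerCoefficientSolver commutativeRing
  open S using (solve; con; _:+_; _:*_; _:=_; :-_; _:-_)
  open ≡.≡-Reasoning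

  infixl 6 _⊕_
  infixl 7 _⊗_
  infix 4 _≋_

  _⊕_ : List A → List A → List A
  []      ⊕ q       = q
  (a ∷ p) ⊕ []      = a ∷ p
  (a ∷ p) ⊕ (b ∷ q) = (a + b) ∷ (p ⊕ q)

  scale : A → List A → List A
  scale c = map (c *_)

  _⊗_ : List A → List A → List A
  []      ⊗ q = []
  (a ∷ p) ⊗ q = scale a q ⊕ (0# ∷ p ⊗ q)

  ⊝_ : List A → List A
  ⊝_ = scale (- 1#)

  -- A polynomial acts on sequences with X acting as the shift. The action is
  -- faithful, so polynomials are compared through it: the multiplication of
  -- polynomials then is the composition of operators.
  ⟦_⟧ : List A → (ℕ → A) → ℕ → A
  ⟦ [] ⟧    s i = 0#
  ⟦ a ∷ p ⟧ s i = a * s i + ⟦ p ⟧ s (suc i)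

  record _≋_ (p q : List A) : Set where
    constructor mk≋
    field act≡ : ∀ s i → ⟦ p ⟧ s i ≡ ⟦ q ⟧ s i
  open _≋_ public

  act-cong : ∀ p {s t} → (∀ i → s i ≡ t i) → ∀ i → ⟦ p ⟧ s i ≡ ⟦ p ⟧ t i
  act-cong []      e i = refl
  act-cong (a ∷ p) e i = cong₂ (λ x y → a * x + y) (e i) (act-cong p e (suc i))

  act-suc : ∀ p s i → ⟦ p ⟧ (λ j → s (suc j)) i ≡ ⟦ p ⟧ s (suc i)
  act-suc []      s i = refl
  act-suc (a ∷ p) s i = +-congˡ (act-suc p s (suc i))

  act-zero : ∀ p i → ⟦ p ⟧ (λ _ → 0#) i ≡ 0#
  act-zero []      i = refl
  act-zero (a ∷ p) i = trans (cong₂ _+_ (zeroʳ a) (act-zero p (suc i))) (+-identityˡ 0#)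

  act-linear : ∀ p c s t i → ⟦ p ⟧ (λ j → c * s j + t j) i ≡ c * ⟦ p ⟧ s i + ⟦ p ⟧ t i
  act-linear []      c s t i = solve 1 (λ c → con (ℤ.+ 0) := c :* con (ℤ.+ 0) :+ con (ℤ.+ 0)) refl c
  act-linear (a ∷ p) c s t i = trans (+-congˡ (act-linear p c s t (suc i)))
    (solve 6 (λ a c x y u v → a :* (c :* x :+ y) :+ (c :* u :+ v) := c :* (a :* x :+ u) :+ (a :* y :+ v))
      refl a c (s i) (t i) (⟦ p ⟧ s (suc i)) (⟦ p ⟧ t (suc i)))

  act-⊕ : ∀ p q s i → ⟦ p ⊕ q ⟧ s i ≡ ⟦ p ⟧ s i + ⟦ q ⟧ s i
  act-⊕ []      q       s i = sym (+-identityˡ _)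
  act-⊕ (a ∷ p) []      s i = sym (+-identityʳ _)
  act-⊕ (a ∷ p) (b ∷ q) s i = trans (+-congˡ (act-⊕ p q s (suc i)))
    (solve 5 (λ a b x u v → (a :+ b) :* x :+ (u :+ v) := a :* x :+ u :+ (b :* x :+ v))
      refl a b (s i) (⟦ p ⟧ s (suc i)) (⟦ q ⟧ s (suc i)))

  act-scale : ∀ c p s i → ⟦ scale c p ⟧ s i ≡ c * ⟦ p ⟧ s i
  act-scale c []      s i = sym (zeroʳ c)
  act-scale c (a ∷ p) s i = trans (+-congˡ (act-scale c p s (suc i)))
    (solve 4 (λ c a x u → c :* a :* x :+ c :* u := c :* (a :* x :+ u)) refl c a (s i) (⟦ p ⟧ s (suc i)))

  act-⊗ : ∀ p q s i → ⟦ p ⊗ q ⟧ s i ≡ ⟦ p ⟧ (⟦ q ⟧ s) i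
  act-⊗ []      q s i = refl
  act-⊗ (a ∷ p) q s i = begin
    ⟦ scale a q ⊕ (0# ∷ p ⊗ q) ⟧ s i                   ≡⟨ act-⊕ (scale a q) _ s i ⟩
    ⟦ scale a q ⟧ s i + (0# * s i + ⟦ p ⊗ q ⟧ s (suc i))
      ≡⟨ cong₂ _+_ (act-scale a q s i) (trans (+-congʳ (zeroˡ (s i))) (+-identityˡ _)) ⟩
    a * ⟦ q ⟧ s i + ⟦ p ⊗ q ⟧ s (suc i)                ≡⟨ +-congˡ (act-⊗ p q s (suc i)) ⟩
    a * ⟦ q ⟧ s i + ⟦ p ⟧ (⟦ q ⟧ s) (suc i)            ∎

  -- The operator `⟦ q ⟧` is linear and commutes with the shift, and `⟦ p ⟧` is composed of shifts
  -- and scalings. So the product of polynomials commutes without any formula for its coefficients.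
  act-comm : ∀ p q s i → ⟦ p ⟧ (⟦ q ⟧ s) i ≡ ⟦ q ⟧ (⟦ p ⟧ s) i
  act-comm []      q s i = sym (act-zero q i)
  act-comm (a ∷ p) q s i = begin
    a * ⟦ q ⟧ s i + ⟦ p ⟧ (⟦ q ⟧ s) (suc i)              ≡⟨ +-congˡ (act-comm p q s (suc i)) ⟩
    a * ⟦ q ⟧ s i + ⟦ q ⟧ (⟦ p ⟧ s) (suc i)              ≡⟨ +-congˡ (act-suc q _ i) ⟨
    a * ⟦ q ⟧ s i + ⟦ q ⟧ (λ j → ⟦ p ⟧ s (suc j)) i      ≡⟨ act-linear q a s _ i ⟨
    ⟦ q ⟧ (λ j → a * s j + ⟦ p ⟧ s (suc j)) i            ∎

  ≋-refl : ∀ {p} → p ≋ p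
  ≋-refl = mk≋ λ _ _ → refl

  ≋-sym : ∀ {p q} → p ≋ q → q ≋ p
  ≋-sym e = mk≋ λ s i → sym (act≡ e s i)

  ≋-trans : ∀ {p q r} → p ≋ q → q ≋ r → p ≋ r
  ≋-trans e f = mk≋ λ s i → trans (act≡ e s i) (act≡ f s i)

  ⊕-cong : ∀ {p p′ q q′} → p ≋ p′ → q ≋ q′ → p ⊕ q ≋ p′ ⊕ q′
  ⊕-cong {p} {p′} {q} {q′} e f = mk≋ λ s i →
    trans (act-⊕ p q s i) (trans (cong₂ _+_ (act≡ e s i) (act≡ f s i)) (sym (act-⊕ p′ q′ s i)))

  ⊗-cong : ∀ {p p′ q q′} → p ≋ p′ → q ≋ q′ → p ⊗ q ≋ p′ ⊗ q′
  ⊗-cong {p} {p′} {q} {q′} e f = mk≋ λ s i → trans (act-⊗ p q s i)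
    (trans (trans (act-cong p (act≡ f s) i) (act≡ e _ i)) (sym (act-⊗ p′ q′ s i)))

  scale-cong : ∀ c {p q} → p ≋ q → scale c p ≋ scale c q
  scale-cong c {p} {q} e = mk≋ λ s i →
    trans (act-scale c p s i) (trans (cong (c *_) (act≡ e s i)) (sym (act-scale c q s i)))

  [_]ₚ : A → List A
  [ c ]ₚ = c ∷ []

  act-const : ∀ c s i → ⟦ [ c ]ₚ ⟧ s i ≡ c * s i
  act-const c s i = +-identityʳ _

  ⊗-comm : ∀ p q → p ⊗ q ≋ q ⊗ p
  ⊗-comm p q = mk≋ λ s i → trans (act-⊗ p q s i) (trans (act-comm p q s i) (sym (act-⊗ q p s i)))

  ⊕-comm : ∀ p q → p ⊕ q ≋ q ⊕ p
  ⊕-comm p q = mk≋ λ s i → trans (act-⊕ p q s i) (trans (+-comm _ _) (sym (act-⊕ q p s i)))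

  ⊗-identityˡ : ∀ p → [ 1# ]ₚ ⊗ p ≋ p
  ⊗-identityˡ p = mk≋ λ s i → trans (act-⊗ [ 1# ]ₚ p s i) (trans (act-const 1# (⟦ p ⟧ s) i) (*-identityˡ (⟦ p ⟧ s i)))

  ⊗-distribˡ : ∀ p q r → p ⊗ (q ⊕ r) ≋ p ⊗ q ⊕ p ⊗ r
  ⊗-distribˡ p q r = mk≋ λ s i → begin
    ⟦ p ⊗ (q ⊕ r) ⟧ s i                       ≡⟨ act-⊗ p (q ⊕ r) s i ⟩
    ⟦ p ⟧ (⟦ q ⊕ r ⟧ s) i
      ≡⟨ act-cong p (λ j → trans (act-⊕ q r s j) (+-congʳ (sym (*-identityˡ _)))) i ⟩
    ⟦ p ⟧ (λ j → 1# * ⟦ q ⟧ s j + ⟦ r ⟧ s j) i  ≡⟨ act-linear p 1# _ _ i ⟩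
    1# * ⟦ p ⟧ (⟦ q ⟧ s) i + ⟦ p ⟧ (⟦ r ⟧ s) i
      ≡⟨ cong₂ _+_ (trans (*-identityˡ _) (sym (act-⊗ p q s i))) (sym (act-⊗ p r s i)) ⟩
    ⟦ p ⊗ q ⟧ s i + ⟦ p ⊗ r ⟧ s i               ≡⟨ act-⊕ (p ⊗ q) _ s i ⟨
    ⟦ p ⊗ q ⊕ p ⊗ r ⟧ s i                     ∎

  ⊕-assoc : ∀ p q r → p ⊕ q ⊕ r ≋ p ⊕ (q ⊕ r)
  ⊕-assoc p q r = mk≋ λ s i → begin
    ⟦ p ⊕ q ⊕ r ⟧ s i                        ≡⟨ trans (act-⊕ (p ⊕ q) r s i) (+-congʳ (act-⊕ p q s i)) ⟩
    ⟦ p ⟧ s i + ⟦ q ⟧ s i + ⟦ r ⟧ s i        ≡⟨ +-assoc _ _ _ ⟩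
    ⟦ p ⟧ s i + (⟦ q ⟧ s i + ⟦ r ⟧ s i)      ≡⟨ trans (act-⊕ p (q ⊕ r) s i) (+-congˡ (act-⊕ q r s i)) ⟨
    ⟦ p ⊕ (q ⊕ r) ⟧ s i                      ∎

  ⊗-assoc : ∀ p q r → p ⊗ q ⊗ r ≋ p ⊗ (q ⊗ r)
  ⊗-assoc p q r = mk≋ λ s i → begin
    ⟦ p ⊗ q ⊗ r ⟧ s i              ≡⟨ trans (act-⊗ (p ⊗ q) r s i) (act-⊗ p q _ i) ⟩
    ⟦ p ⟧ (⟦ q ⟧ (⟦ r ⟧ s)) i      ≡⟨ trans (act-⊗ p (q ⊗ r) s i) (act-cong p (act-⊗ q r s) i) ⟨
    ⟦ p ⊗ (q ⊗ r) ⟧ s i            ∎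

  ⊝-inverseˡ : ∀ p → ⊝ p ⊕ p ≋ []
  ⊝-inverseˡ p = mk≋ λ s i → trans (act-⊕ (⊝ p) p s i) (trans (+-congʳ (act-scale (- 1#) p s i))
    (solve 1 (λ x → :- con (ℤ.+ 1) :* x :+ x := con (ℤ.+ 0)) refl (⟦ p ⟧ s i)))

  polynomialRing : CommutativeRing 0ℓ 0ℓ
  polynomialRing = record
    { Carrier = List A ; _≈_ = _≋_ ; _+_ = _⊕_ ; _*_ = _⊗_ ; -_ = ⊝_ ; 0# = [] ; 1# = [ 1# ]ₚ
    ; isCommutativeRing = record
      { isRing = record
        { +-isAbelianGroup = record
          { isGroup = record
            { isMonoid = record
              { isSemigroup = record
                { isMagma = record
                  { isEquivalence = record { refl = ≋-refl ; sym = ≋-sym ; trans = ≋-trans }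
                  ; ∙-cong = ⊕-cong }
                ; assoc = ⊕-assoc }
              ; identity = (λ p → ≋-refl) , λ p → ⊕-comm p [] }
            ; inverse = ⊝-inverseˡ , λ p → ≋-trans (⊕-comm p (⊝ p)) (⊝-inverseˡ p)
            ; ⁻¹-cong = scale-cong (- 1#) }
          ; comm = ⊕-comm }
        ; *-cong = ⊗-cong
        ; *-assoc = ⊗-assoc
        ; *-identity = ⊗-identityˡ , λ p → ≋-trans (⊗-comm p _) (⊗-identityˡ p)
        ; distrib = ⊗-distribˡ , λ p q r → ≋-trans (⊗-comm (q ⊕ r) p)
            (≋-trans (⊗-distribˡ p q r) (⊕-cong (⊗-comm p q) (⊗-comm p r))) }
      ; *-comm = ⊗-comm } }

  private
    module P = IntegerCoefficientSolver polynomialRing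

  scale≋⊗ : ∀ c p → scale c p ≋ [ c ]ₚ ⊗ p
  scale≋⊗ c p = mk≋ λ s i → trans (act-scale c p s i) (sym (trans (act-⊗ [ c ]ₚ p s i) (act-const c (⟦ p ⟧ s) i)))

  ∷≋⊕ : ∀ a p → a ∷ p ≋ [ a ]ₚ ⊕ (0# ∷ p)
  ∷≋⊕ a p = mk≋ λ s i → cong (λ z → z * s i + ⟦ p ⟧ s (suc i)) (sym (+-identityʳ a))

  0∷≋[] : [ 0# ]ₚ ≋ []
  0∷≋[] = mk≋ λ s i → trans (act-const 0# s i) (zeroˡ _)

  ∷-cong : ∀ {a b p q} → a ≡ b → p ≋ q → a ∷ p ≋ b ∷ q
  ∷-cong refl e = mk≋ λ s i → +-congˡ (act≡ e s (suc i))

  -- Acting on the sequence 1, 0, 0, ... isolates the constant coefficient; with `tail≋` this is the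
  -- faithfulness of the action.
  head≡ : ∀ {a b p q} → a ∷ p ≋ b ∷ q → a ≡ b
  head≡ {a} {b} {p} {q} e = trans (sym (at-δ a p)) (trans (act≡ e δ 0) (at-δ b q))
    where
    δ : ℕ → A
    δ zero    = 1#
    δ (suc _) = 0#
    at-δ : ∀ a p → ⟦ a ∷ p ⟧ δ 0 ≡ a
    at-δ a p = trans (cong₂ _+_ (*-identityʳ a) (trans (sym (act-suc p δ 0)) (act-zero p 0))) (+-identityʳ a)

  -- The test sequence is `s` delayed by one place: its shift is `s` again, so once the equal heads
  -- are cancelled the tails are left acting on `s`.
  tail≋ : ∀ {a b p q} → a ∷ p ≋ b ∷ q → p ≋ q
  tail≋ {a} {b} {p} {q} e = mk≋ λ s i → let t = λ j → s (pred j) in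
    trans (act-suc p t i) (trans (+-cancelˡ _ _ _ (trans (act≡ e t i)
      (cong (λ z → z * t i + ⟦ q ⟧ t (suc i)) (sym (head≡ e))))) (sym (act-suc q t i)))

  tail≋[] : ∀ {a p} → a ∷ p ≋ [] → p ≋ []
  tail≋[] e = tail≋ (≋-trans e (≋-sym 0∷≋[]))

  -- Monic polynomials are represented by their lower coefficients, constant
  -- coefficient first: [] is 1 and c ∷ f is c + X f. So the degree is the length.
  monic : List A → List A
  monic f = f ++ [ 1# ]ₚ

  -- The lower coefficients of h + c g for monic g and h with deg g < deg h. Where the list g ends,
  -- its implicit leading coefficient 1 contributes c. The first clause is a default outside this
  -- range.
  addMultiple : A → List A → List A → List A
  addMultiple c g       []      = []
  addMultiple c []      (b ∷ h) = (b + c) ∷ h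
  addMultiple c (a ∷ g) (b ∷ h) = (b + c * a) ∷ addMultiple c g h

  infixl 7 _·_
  _·_ : List A → List A → List A
  []      · g = g
  (c ∷ f) · g = addMultiple c g (0# ∷ f · g)

  length-addMultiple : ∀ c g h → length (addMultiple c g h) ≡ length h
  length-addMultiple c g       []      = refl
  length-addMultiple c []      (b ∷ h) = refl
  length-addMultiple c (a ∷ g) (b ∷ h) = cong suc (length-addMultiple c g h)

  length-· : ∀ f g → length (f · g) ≡ length f ℕ.+ length g
  length-· []      g = refl
  length-· (c ∷ f) g = trans (length-addMultiple c g _) (cong suc (length-· f g))

  length-≤-· : ∀ f g → length g ≤ length (f · g)
  length-≤-· f g = subst (length g ≤_) (sym (length-· f g)) (ℕ.m≤n+m (length g) (length f))

  -- The hypothesis keeps addMultiple away from the leading coefficient.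
  monic-addMultiple : ∀ c g h → length g < length h →
                      monic (addMultiple c g h) ≋ scale c (monic g) ⊕ monic h
  monic-addMultiple c []      (b ∷ h) _ = ∷-cong (trans (+-comm b c) (cong (_+ b) (sym (*-identityʳ c)))) ≋-refl
  monic-addMultiple c (a ∷ g) (b ∷ h) (s≤s lt) = ∷-cong (+-comm b _) (monic-addMultiple c g h lt)

  monic-· : ∀ f g → monic (f · g) ≋ monic f ⊗ monic g
  monic-· []      g = ≋-sym (⊗-identityˡ (monic g))
  monic-· (c ∷ f) g = ≋-trans (monic-addMultiple c g (0# ∷ f · g) (s≤s (length-≤-· f g)))
    (⊕-cong (≋-refl {scale c (monic g)}) (∷-cong refl (monic-· f g)))

  monic≉[] : ∀ f → ¬ monic f ≋ []
  monic≉[] []      e = 1≢0 (head≡ (≋-trans e (≋-sym 0∷≋[])))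
  monic≉[] (c ∷ f) e = monic≉[] f (tail≋[] e)

  monic-injective : ∀ f g → monic f ≋ monic g → f ≡ g
  monic-injective []      []      e = refl
  monic-injective []      (c ∷ g) e = contradiction (≋-sym (tail≋ e)) (monic≉[] g)
  monic-injective (c ∷ f) []      e = contradiction (tail≋ e) (monic≉[] f)
  monic-injective (c ∷ f) (d ∷ g) e = cong₂ _∷_ (head≡ e) (monic-injective f g (tail≋ e))

  ·-assoc : ∀ f g h → (f · g) · h ≡ f · (g · h)
  ·-assoc f g h = monic-injective _ _ (≋-trans (monic-· (f · g) h)
    (≋-trans (⊗-cong (monic-· f g) ≋-refl) (≋-trans (⊗-assoc (monic f) (monic g) (monic h))
      (≋-trans (⊗-cong (≋-refl {monic f}) (≋-sym (monic-· g h))) (≋-sym (monic-· f (g · h)))))))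

  ·-comm : ∀ f g → f · g ≡ g · f
  ·-comm f g = monic-injective _ _ (≋-trans (monic-· f g)
    (≋-trans (⊗-comm (monic f) (monic g)) (≋-sym (monic-· g f))))

  ·-identityʳ : ∀ f → f · [] ≡ f
  ·-identityʳ f = ·-comm f []

  -- Lists may end in zeros, so the leading coefficient has to be searched for. The strict bound on
  -- `length f` is what lets `descent` recurse on the length.
  data Normal (p : List A) : Set where
    null : p ≋ [] → Normal p
    unit*monic : ∀ c f → c ≢ 0# → p ≋ scale c (monic f) → length f < length p → Normal p

  normal : ∀ p → Normal p
  normal [] = null ≋-refl
  normal (a ∷ p) with normal p
  ... | null e with a ≟ 0#
  ...   | yes refl = null (≋-trans (∷-cong refl e) 0∷≋[])
  ...   | no a≢0   = unit*monic a [] a≢0 (∷-cong (sym (*-identityʳ a)) e) (s≤s z≤n)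
  normal (a ∷ p) | unit*monic c f c≢0 e lt =
    unit*monic c (c⁻¹ * a ∷ f) c≢0 (∷-cong lemma e) (s≤s lt)
    where
    c⁻¹ = proj₁ (inverse c c≢0)
    lemma : a ≡ c * (c⁻¹ * a)
    lemma = sym (trans (sym (*-assoc c c⁻¹ a)) (trans (cong (_* a) (proj₂ (inverse c c≢0))) (*-identityˡ a)))

  scaled-monic≉small : ∀ c g r → c ≢ 0# → length r ≤ length g → ¬ scale c (monic g) ≋ r
  scaled-monic≉small c []      []      c≢0 _ e =
    c≢0 (trans (sym (*-identityʳ c)) (head≡ (≋-trans e (≋-sym 0∷≋[]))))
  scaled-monic≉small c (b ∷ g) []      c≢0 _ e = scaled-monic≉small c g [] c≢0 z≤n (tail≋[] e)
  scaled-monic≉small c (b ∷ g) (a ∷ r) c≢0 (s≤s le) e = scaled-monic≉small c g r c≢0 le (tail≋ e)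

  reduce : ∀ d r → length r ≡ suc (length d) →
           ∃₂ λ t r′ → r ≋ scale t (monic d) ⊕ r′ × length r′ ≤ length d
  reduce []      (t ∷ []) _ = t , [] , ∷-cong (sym (*-identityʳ t)) ≋-refl , z≤n
  reduce (b ∷ d) (c ∷ r)  e with reduce d r (ℕ.suc-injective e)
  ... | t , r′ , eq , le = t , (c - t * b) ∷ r′ ,
    ∷-cong (solve 3 (λ c t b → c := t :* b :+ (c :- t :* b)) refl c t b) eq , s≤s le

  -- Long division in Horner form: p = d h + r gives c + X p = d (X h) + (c + X r), and the new
  -- remainder is at most one coefficient too long, which a single `reduce` repairs.
  divide : ∀ d p → ∃₂ λ h r → p ≋ monic d ⊗ h ⊕ r × length r ≤ length d
  divide d [] = [] , [] , mk≋ (λ s i → sym (trans (act-⊕ (monic d ⊗ []) [] s i)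
    (trans (+-identityʳ _) (trans (act-⊗ (monic d) [] s i) (act-zero (monic d) i))))) , z≤n
  divide d (c ∷ p) with divide d p
  ... | h , r , e , le = step (length (c ∷ r) ℕ.≤? length d)
    where
    X : List A
    X = 0# ∷ 1# ∷ []
    X⊗ : ∀ p → 0# ∷ p ≋ X ⊗ p
    X⊗ p = mk≋ λ s i → sym (trans (act-⊗ X p s i)
      (trans (+-congˡ (trans (+-identityʳ _) (*-identityˡ _)))
        (trans (+-congʳ (trans (zeroˡ _) (sym (zeroˡ (s i))))) refl)))
    c∷p : c ∷ p ≋ monic d ⊗ (0# ∷ h) ⊕ (c ∷ r)
    c∷p = ≋-trans (∷≋⊕ c p) (≋-trans (⊕-cong (≋-refl {[ c ]ₚ}) (≋-trans (X⊗ p) (⊗-cong (≋-refl {X}) e)))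
      (≋-trans (P.solve 5 (λ c x d h r → c P.:+ x P.:* (d P.:* h P.:+ r) P.:= d P.:* (x P.:* h) P.:+ (c P.:+ x P.:* r))
                 ≋-refl [ c ]ₚ X (monic d) h r)
        (⊕-cong (⊗-cong (≋-refl {monic d}) (≋-sym (X⊗ h)))
          (≋-sym (≋-trans (∷≋⊕ c r) (⊕-cong (≋-refl {[ c ]ₚ}) (X⊗ r)))))))
    step : Dec (length (c ∷ r) ≤ length d) → ∃₂ λ h r → c ∷ p ≋ monic d ⊗ h ⊕ r × length r ≤ length d
    step (yes le′) = 0# ∷ h , c ∷ r , c∷p , le′
    step (no nle) with reduce d (c ∷ r) (ℕ.≤-antisym (s≤s le) (ℕ.≰⇒> nle))
    ... | t , r′ , e′ , le′ = (0# ∷ h) ⊕ [ t ]ₚ , r′ , ≋-trans c∷p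
      (≋-trans (⊕-cong (≋-refl {monic d ⊗ (0# ∷ h)}) (≋-trans e′ (⊕-cong (scale≋⊗ t (monic d)) ≋-refl)))
        (P.solve 4 (λ d h t r → d P.:* h P.:+ (t P.:* d P.:+ r) P.:= d P.:* (h P.:+ t) P.:+ r)
          ≋-refl (monic d) (0# ∷ h) [ t ]ₚ r′)) , le′

  infix 4 _∣ₚ_ _∣ₘ_

  _∣ₚ_ : List A → List A → Set
  d ∣ₚ p = ∃ λ h → p ≋ monic d ⊗ h

  _∣ₘ_ : List A → List A → Set
  d ∣ₘ f = ∃ λ g → f ≡ d · g

  -- A nonzero h would be a unit times a monic polynomial, and so would be its product with d, of
  -- degree at least deg d and hence too long for r.
  ⊗-small : ∀ d h r → length r ≤ length d → monic d ⊗ h ≋ r → h ≋ []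
  ⊗-small d h r le e with normal h
  ... | null h≋[] = h≋[]
  ... | unit*monic c f c≢0 h≋ _ = contradiction
    (≋-trans (scale-cong c (monic-· d f)) (≋-trans (scale≋⊗ c _)
      (≋-trans (P.solve 3 (λ c d f → c P.:* (d P.:* f) P.:= d P.:* (c P.:* f)) ≋-refl [ c ]ₚ (monic d) (monic f))
        (≋-trans (⊗-cong (≋-refl {monic d}) (≋-trans (≋-sym (scale≋⊗ c _)) (≋-sym h≋))) e))))
    (scaled-monic≉small c (d · f) r c≢0
      (ℕ.≤-trans le (subst (length d ≤_) (sym (length-· d f)) (ℕ.m≤m+n _ _))))

  monic≋scaled : ∀ c f g → c ≢ 0# → monic f ≋ scale c (monic g) → c ≡ 1#
  monic≋scaled c []      []      c≢0 e = sym (trans (head≡ e) (*-identityʳ c))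
  monic≋scaled c []      (b ∷ g) c≢0 e =
    contradiction (≋-sym (tail≋ e)) (scaled-monic≉small c g [] c≢0 z≤n)
  monic≋scaled c (a ∷ f) []      c≢0 e = contradiction (tail≋ e) (monic≉[] f)
  monic≋scaled c (a ∷ f) (b ∷ g) c≢0 e = monic≋scaled c f g c≢0 (tail≋ e)

  -- The cofactor is a unit times a monic polynomial, and comparing leading coefficients shows that
  -- the unit is 1.
  ∣ₚ⇒∣ₘ : ∀ d f → d ∣ₚ monic f → d ∣ₘ f
  ∣ₚ⇒∣ₘ d f (h , e) with normal h
  ... | null h≋[] = contradiction
    (≋-trans e (≋-trans (⊗-cong (≋-refl {monic d}) h≋[]) (⊗-comm (monic d) []))) (monic≉[] f)
  ... | unit*monic c g c≢0 h≋ _ = g , monic-injective f (d · g) (≋-trans f≋ (≋-trans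
          (mk≋ λ s i → trans (act-scale c (monic (d · g)) s i)
            (trans (*-congʳ (monic≋scaled c f (d · g) c≢0 f≋)) (*-identityˡ _))) ≋-refl))
    where
    f≋ : monic f ≋ scale c (monic (d · g))
    f≋ = ≋-trans e (≋-trans (⊗-cong (≋-refl {monic d}) (≋-trans h≋ (scale≋⊗ c (monic g))))
      (≋-trans (P.solve 3 (λ c d f → d P.:* (c P.:* f) P.:= c P.:* (d P.:* f)) ≋-refl [ c ]ₚ (monic d) (monic g))
        (≋-trans (⊗-cong (≋-refl {[ c ]ₚ}) (≋-sym (monic-· d g))) (≋-sym (scale≋⊗ c _)))))

  ∣ₘ⇒∣ₚ : ∀ d f → d ∣ₘ f → d ∣ₚ monic f
  ∣ₘ⇒∣ₚ d f (g , refl) = monic g , monic-· d g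

  ·-cancelˡ : ∀ d f g → d · f ≡ d · g → f ≡ g
  ·-cancelˡ d f g e = monic-injective f g (≋-trans
    (P.solve 2 (λ f g → f P.:= f P.:- g P.:+ g) ≋-refl (monic f) (monic g))
    (⊕-cong f-g ≋-refl))
    where
    f-g : monic f ⊕ ⊝ monic g ≋ []
    f-g = ⊗-small d (monic f ⊕ ⊝ monic g) [] z≤n
      (≋-trans (P.solve 3 (λ d f g → d P.:* (f P.:- g) P.:= d P.:* f P.:- d P.:* g) ≋-refl
                 (monic d) (monic f) (monic g))
        (≋-trans (⊕-cong (≋-trans (≋-sym (monic-· d f)) (subst (λ z → monic (d · f) ≋ monic z) e ≋-refl))
                   (scale-cong (- 1#) (≋-sym (monic-· d g))))
          (≋-trans (⊕-comm (monic (d · g)) _) (⊝-inverseˡ (monic (d · g))))))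

  infix 4 _∣?_

  -- Divisibility is read off the remainder. If d divided f, a nonzero remainder r would be a
  -- multiple d (k - h), and `⊗-small` makes k - h vanish because r is short.
  _∣?_ : ∀ d f → Dec (d ∣ₘ f)
  d ∣? f with divide d (monic f)
  ... | h , r , e , le with normal r
  ...   | null r≋[] = yes (∣ₚ⇒∣ₘ d f (h , ≋-trans e (≋-trans (⊕-cong ≋-refl r≋[]) (⊕-comm _ []))))
  ...   | unit*monic c g c≢0 r≋ _ = no λ d∣f → let k , e′ = ∣ₘ⇒∣ₚ d f d∣f in
    scaled-monic≉small c g [] c≢0 z≤n (≋-trans (≋-sym r≋) (≋-trans (≋-sym (r≋d⊗ k e′))
      (≋-trans (⊗-cong (≋-refl {monic d}) (⊗-small d (k ⊕ ⊝ h) r le (r≋d⊗ k e′))) (⊗-comm (monic d) []))))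
    where
    r≋d⊗ : ∀ k → monic f ≋ monic d ⊗ k → monic d ⊗ (k ⊕ ⊝ h) ≋ r
    r≋d⊗ k e′ = ≋-trans (P.solve 3 (λ d k h → d P.:* (k P.:- h) P.:= d P.:* k P.:- d P.:* h) ≋-refl (monic d) k h)
      (≋-trans (⊕-cong (≋-trans (≋-sym e′) e) (≋-refl {⊝ (monic d ⊗ h)}))
        (P.solve 2 (λ x r → x P.:+ r P.:- x P.:= r) ≋-refl (monic d ⊗ h) r))

-- Finite sums

module ListSum (R : CommutativeSemiring 0ℓ 0ℓ) where
  open CommutativeSemiring R
    renaming (refl to ≈-refl; sym to ≈-sym; trans to ≈-trans; reflexive to ≈-reflexive)
  open Algebra.Properties.CommutativeSemigroup +-commutativeSemigroup using (interchange)
  open Algebra.Properties.Semiring.Mult semiring using () renaming (_×_ to _⋆_)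
  open Relation.Binary.Reasoning.Setoid setoid

  private variable
    A B : Set
    P Q : Set

  ∑ : List A → (A → Carrier) → Carrier
  ∑ []       f = 0#
  ∑ (x ∷ xs) f = f x + ∑ xs f

  syntax ∑ xs (λ x → t) = ∑[ x ← xs ] t

  -- The Iverson bracket. Conditions on summation indices are written as factors so that sums over
  -- dependent ranges can be exchanged.
  [_] : Dec P → Carrier
  [ d ] = if does d then 1# else 0#

  []-yes : (d : Dec P) → P → [ d ] ≡ 1#
  []-yes (yes _) p = refl
  []-yes (no ¬p) p = contradiction p ¬p

  []-no : (d : Dec P) → ¬ P → [ d ] ≡ 0#
  []-no (yes p) ¬p = contradiction p ¬p
  []-no (no _)  ¬p = refl

  []-⇔ : (d : Dec P) (e : Dec Q) → (P → Q) → (Q → P) → [ d ] ≡ [ e ]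
  []-⇔ (yes p) e f g = sym ([]-yes e (f p))
  []-⇔ (no ¬p) e f g = sym ([]-no e (¬p ∘ g))

  ∑-cong∈ : ∀ (xs : List A) {f g} → (∀ {x} → x ∈ xs → f x ≈ g x) → ∑ xs f ≈ ∑ xs g
  ∑-cong∈ []       e = ≈-refl
  ∑-cong∈ (x ∷ xs) e = +-cong (e (here refl)) (∑-cong∈ xs (e ∘ there))

  ∑-cong : ∀ (xs : List A) {f g} → (∀ x → f x ≈ g x) → ∑ xs f ≈ ∑ xs g
  ∑-cong xs e = ∑-cong∈ xs (λ {x} _ → e x)

  ∑-0 : ∀ (xs : List A) → ∑[ x ← xs ] 0# ≈ 0#
  ∑-0 []       = ≈-refl
  ∑-0 (x ∷ xs) = ≈-trans (+-identityˡ _) (∑-0 xs)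

  ∑-+ : ∀ (xs : List A) f g → ∑[ x ← xs ] (f x + g x) ≈ ∑ xs f + ∑ xs g
  ∑-+ []       f g = ≈-sym (+-identityˡ 0#)
  ∑-+ (x ∷ xs) f g = ≈-trans (+-congˡ (∑-+ xs f g)) (interchange (f x) (g x) (∑ xs f) (∑ xs g))

  ∑-*ˡ : ∀ (xs : List A) c f → ∑[ x ← xs ] (c * f x) ≈ c * ∑ xs f
  ∑-*ˡ []       c f = ≈-sym (zeroʳ c)
  ∑-*ˡ (x ∷ xs) c f = ≈-trans (+-congˡ (∑-*ˡ xs c f)) (≈-sym (distribˡ c (f x) (∑ xs f)))

  ∑-*ʳ : ∀ (xs : List A) c f → ∑[ x ← xs ] (f x * c) ≈ ∑ xs f * c
  ∑-*ʳ xs c f = ≈-trans (∑-cong xs (λ x → *-comm (f x) c)) (≈-trans (∑-*ˡ xs c f) (*-comm c _))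

  ∑-++ : ∀ (xs ys : List A) f → ∑ (xs ++ ys) f ≈ ∑ xs f + ∑ ys f
  ∑-++ []       ys f = ≈-sym (+-identityˡ _)
  ∑-++ (x ∷ xs) ys f = ≈-trans (+-congˡ (∑-++ xs ys f)) (≈-sym (+-assoc _ _ _))

  ∑-map : ∀ (g : A → B) xs f → ∑ (map g xs) f ≡ ∑[ x ← xs ] f (g x)
  ∑-map g []       f = refl
  ∑-map g (x ∷ xs) f = cong (f (g x) +_) (∑-map g xs f)

  ∑-swap : ∀ (xs : List A) (ys : List B) (f : A → B → Carrier) → ∑[ x ← xs ] ∑[ y ← ys ] f x y ≈ ∑[ y ← ys ] ∑[ x ← xs ] f x y
  ∑-swap []       ys f = ≈-sym (∑-0 ys)
  ∑-swap (x ∷ xs) ys f = ≈-trans (+-congˡ (∑-swap xs ys f)) (≈-sym (∑-+ ys (f x) _))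

  ∑-product : ∀ {C : Set} (c : A → B → C) xs ys f →
              ∑ (cartesianProductWith c xs ys) f ≈ ∑[ x ← xs ] ∑[ y ← ys ] f (c x y)
  ∑-product c []       ys f = ≈-refl
  ∑-product c (x ∷ xs) ys f = ≈-trans (∑-++ (map (c x) ys) _ f)
    (+-cong (≈-reflexive (∑-map (c x) ys f)) (∑-product c xs ys f))

  module _ (_≟_ : DecidableEquality A) where

    ∑-δ∉ : ∀ {xs} y (f : A → Carrier) → All (y ≢_) xs → ∑[ x ← xs ] ([ x ≟ y ] * f x) ≈ 0#
    ∑-δ∉ y f []         = ≈-refl
    ∑-δ∉ {x ∷ xs} y f (y≢x ∷ ps) = begin
      [ x ≟ y ] * f x + ∑[ x ← xs ] ([ x ≟ y ] * f x)
        ≈⟨ +-cong (≈-trans (*-congʳ (≈-reflexive ([]-no (x ≟ y) (y≢x ∘ sym)))) (zeroˡ _)) (∑-δ∉ y f ps) ⟩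
      0# + 0#  ≈⟨ +-identityˡ 0# ⟩
      0#       ∎

    ∑-δ : ∀ {xs y} (f : A → Carrier) → Unique xs → y ∈ xs → ∑[ x ← xs ] ([ x ≟ y ] * f x) ≈ f y
    ∑-δ {x ∷ xs} {y} f (x∉ ∷ _) (here refl) = begin
      [ x ≟ y ] * f x + ∑[ x ← xs ] ([ x ≟ y ] * f x)
        ≈⟨ +-cong (≈-trans (*-congʳ (≈-reflexive ([]-yes (x ≟ y) refl))) (*-identityˡ _)) (∑-δ∉ y f x∉) ⟩
      f y + 0#  ≈⟨ +-identityʳ _ ⟩
      f y       ∎
    ∑-δ {x ∷ xs} {y} f (x∉ ∷ uniq) (there y∈) = begin
      [ x ≟ y ] * f x + ∑[ x ← xs ] ([ x ≟ y ] * f x)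
        ≈⟨ +-cong (≈-trans (*-congʳ (≈-reflexive ([]-no (x ≟ y) (All.lookup x∉ y∈)))) (zeroˡ _)) (∑-δ f uniq y∈) ⟩
      0# + f y  ≈⟨ +-identityˡ _ ⟩
      f y       ∎

    ∑-δ1 : ∀ {xs y} → Unique xs → y ∈ xs → ∑[ x ← xs ] [ x ≟ y ] ≈ 1#
    ∑-δ1 {xs} uniq y∈ = ≈-trans (∑-cong xs (λ x → ≈-sym (*-identityʳ _))) (∑-δ (λ _ → 1#) uniq y∈)

  module _ (_≟₁_ : DecidableEquality A) (_≟₂_ : DecidableEquality B) where

    -- Each term is expanded as a sum over y of `[ y ≟₂ to x ]`. After the exchange, the sum over x
    -- picks out the single preimage `from y`.
    ∑-reindex : ∀ {xs : List A} {ys : List B} → Unique xs → Unique ys →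
      (to : A → B) (from : B → A) →
      (∀ {x} → x ∈ xs → to x ∈ ys) → (∀ {y} → y ∈ ys → from y ∈ xs) →
      (∀ {x} → x ∈ xs → from (to x) ≡ x) → (∀ {y} → y ∈ ys → to (from y) ≡ y) →
      ∀ f → ∑[ x ← xs ] f (to x) ≈ ∑ ys f
    ∑-reindex {xs} {ys} uxs uys to from to∈ from∈ from-to to-from f = begin
      ∑[ x ← xs ] f (to x)
        ≈⟨ ∑-cong∈ xs (λ x∈ → ≈-sym (∑-δ _≟₂_ f uys (to∈ x∈))) ⟩
      ∑[ x ← xs ] ∑[ y ← ys ] ([ y ≟₂ to x ] * f y)
        ≈⟨ ∑-swap xs ys _ ⟩
      ∑[ y ← ys ] ∑[ x ← xs ] ([ y ≟₂ to x ] * f y)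
        ≈⟨ ∑-cong∈ ys (λ {y} y∈ → ≈-trans (∑-cong∈ xs λ {x} x∈ →
             *-congʳ (≈-reflexive ([]-⇔ (y ≟₂ to x) (x ≟₁ from y)
               (λ { refl → sym (from-to x∈) }) (λ { refl → sym (to-from y∈) }))))
             (∑-δ _≟₁_ (λ _ → f y) uxs (from∈ y∈))) ⟩
      ∑ ys f ∎

  ∑-applyUpTo : ∀ (g : ℕ → A) n f → ∑ (applyUpTo g n) f ≡ ∑[ i ← upTo n ] f (g i)
  ∑-applyUpTo g zero    f = refl
  ∑-applyUpTo g (suc n) f = cong (_ +_) (trans (∑-applyUpTo (g ∘ suc) n f) (sym (∑-applyUpTo suc n (f ∘ g))))

  ∑-upTo-suc : ∀ n f → ∑ (upTo (suc n)) f ≡ f 0 + ∑[ i ← upTo n ] f (suc i)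
  ∑-upTo-suc n f = cong (f 0 +_) (∑-applyUpTo suc n f)

  ∑-upTo-last : ∀ n f → ∑ (upTo (suc n)) f ≈ ∑ (upTo n) f + f n
  ∑-upTo-last zero    f = +-comm _ _
  ∑-upTo-last (suc n) f = begin
    ∑ (upTo (suc (suc n))) f                       ≡⟨ ∑-upTo-suc (suc n) f ⟩
    f 0 + ∑ (upTo (suc n)) (f ∘ suc)               ≈⟨ +-congˡ (∑-upTo-last n (f ∘ suc)) ⟩
    f 0 + (∑ (upTo n) (f ∘ suc) + f (suc n))       ≈⟨ +-assoc _ _ _ ⟨
    f 0 + ∑ (upTo n) (f ∘ suc) + f (suc n)         ≡⟨ cong (_+ f (suc n)) (∑-upTo-suc n f) ⟨
    ∑ (upTo (suc n)) f + f (suc n)                 ∎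

  ∑-upTo-+ : ∀ a b f → ∑ (upTo (a ℕ.+ b)) f ≈ ∑ (upTo a) f + ∑[ i ← upTo b ] f (a ℕ.+ i)
  ∑-upTo-+ zero    b f = ≈-sym (+-identityˡ _)
  ∑-upTo-+ (suc a) b f = begin
    ∑ (upTo (suc a ℕ.+ b)) f                                       ≡⟨ ∑-upTo-suc (a ℕ.+ b) f ⟩
    f 0 + ∑ (upTo (a ℕ.+ b)) (f ∘ suc)                             ≈⟨ +-congˡ (∑-upTo-+ a b (f ∘ suc)) ⟩
    f 0 + (∑ (upTo a) (f ∘ suc) + ∑[ i ← upTo b ] f (suc a ℕ.+ i)) ≈⟨ +-assoc _ _ _ ⟨
    f 0 + ∑ (upTo a) (f ∘ suc) + ∑[ i ← upTo b ] f (suc a ℕ.+ i)   ≡⟨ cong (_+ ∑[ i ← upTo b ] f (suc a ℕ.+ i)) (∑-upTo-suc a f) ⟨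
    ∑ (upTo (suc a)) f + ∑[ i ← upTo b ] f (suc a ℕ.+ i)           ∎

  ∑-[]-⋆ : ∀ (xs : List A) {P : A → Set} (P? : Unary.Decidable P) → ∑[ x ← xs ] [ P? x ] ≈ length (filter P? xs) ⋆ 1#
  ∑-[]-⋆ []       P? = ≈-refl
  ∑-[]-⋆ (x ∷ xs) P? with P? x
  ... | yes _ = +-congˡ (∑-[]-⋆ xs P?)
  ... | no _  = ≈-trans (+-identityˡ _) (∑-[]-⋆ xs P?)

-- Unique factorization and the Euler product

record Enumeration (A : Set) : Set where
  field
    elements : List A
    unique   : Unique elements
    complete : ∀ x → x ∈ elements

module Factorization {A : Set} (K : DiscreteField A) (enum : Enumeration A) where
  open DiscreteField K using (_≟_; inverse; commutativeRing)
  open CommutativeRing commutativeRing using (*-comm)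
  open Polynomials K
  open Enumeration enum
  open ≡.≡-Reasoning
  private module P = IntegerCoefficientSolver polynomialRing

  infix 4 _≟ₗ_
  _≟ₗ_ : DecidableEquality (List A)
  _≟ₗ_ = ≡-dec _≟_

  monics : ℕ → List (List A)
  monics zero    = [] ∷ []
  monics (suc d) = cartesianProductWith _∷_ elements (monics d)

  ∈-monics : ∀ f → f ∈ monics (length f)
  ∈-monics []      = here refl
  ∈-monics (c ∷ f) = ∈.∈-cartesianProductWith⁺ _∷_ (complete c) (∈-monics f)

  ∈-monics⁻ : ∀ d {f} → f ∈ monics d → length f ≡ d
  ∈-monics⁻ zero    (here refl) = refl
  ∈-monics⁻ (suc d) f∈ with ∈.∈-cartesianProductWith⁻ _∷_ elements (monics d) f∈
  ... | c , f , _ , f∈′ , refl = cong suc (∈-monics⁻ d f∈′)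

  monics-unique : ∀ d → Unique (monics d)
  monics-unique zero    = [] ∷ []
  monics-unique (suc d) = Unique.cartesianProductWith⁺ _∷_ (λ { refl → refl , refl }) unique (monics-unique d)

  monics≤ : ℕ → List (List A)
  monics≤ zero    = monics 0
  monics≤ (suc d) = monics≤ d ++ monics (suc d)

  ∈-monics≤ : ∀ d f → length f ≤ d → f ∈ monics≤ d
  ∈-monics≤ zero    [] z≤n = here refl
  ∈-monics≤ (suc d) f le with length f ℕ.≟ suc d
  ... | yes e    = ∈.∈-++⁺ʳ (monics≤ d) (subst (λ k → f ∈ monics k) e (∈-monics f))
  ... | no ne    = ∈.∈-++⁺ˡ (∈-monics≤ d f (ℕ.s≤s⁻¹ (ℕ.≤∧≢⇒< le ne)))

  ∈-monics≤⁻ : ∀ d {f} → f ∈ monics≤ d → length f ≤ d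
  ∈-monics≤⁻ zero    f∈ = ℕ.≤-reflexive (∈-monics⁻ 0 f∈)
  ∈-monics≤⁻ (suc d) f∈ with ∈.∈-++⁻ (monics≤ d) f∈
  ... | inj₁ f∈′ = ℕ.m≤n⇒m≤1+n (∈-monics≤⁻ d f∈′)
  ... | inj₂ f∈′ = ℕ.≤-reflexive (∈-monics⁻ (suc d) f∈′)

  monics≤-unique : ∀ d → Unique (monics≤ d)
  monics≤-unique zero    = monics-unique 0
  monics≤-unique (suc d) = Unique.++⁺ (monics≤-unique d) (monics-unique (suc d))
    λ (f∈ , f∈′) → ℕ.<⇒≢ (s≤s (∈-monics≤⁻ d f∈)) (∈-monics⁻ (suc d) f∈′)

  record Irreducible (P : List A) : Set where
    field
      nontrivial : P ≢ []
      atomic     : ∀ g h → P ≡ g · h → g ≡ [] ⊎ h ≡ []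
  open Irreducible public

  length≡0 : ∀ (f : List A) → length f ≡ 0 → f ≡ []
  length≡0 [] _ = refl

  ≢[]⇒0< : ∀ {f : List A} → f ≢ [] → 0 < length f
  ≢[]⇒0< {[]}    ne = contradiction refl ne
  ≢[]⇒0< {_ ∷ _} ne = s≤s z≤n

  -- A nontrivial factorization has a factor of degree at most deg P - 1 = `length P′`, so a search
  -- in a finite list decides the alternative.
  analyse : ∀ P → P ≢ [] → Irreducible P ⊎ ∃₂ λ g h → P ≡ g · h × g ≢ [] × h ≢ []
  analyse []      ne = contradiction refl ne
  analyse P@(_ ∷ P′) ne with any? (λ g → ¬? (g ≟ₗ []) ×-dec (g ∣? P)) (monics≤ (length P′))
  ... | yes p = let g , g∈ , g≢[] , h , e = find p in
    inj₂ (g , h , e , g≢[] , λ h≡[] → ℕ.<⇒≢ (s≤s (∈-monics≤⁻ _ g∈))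
      (sym (cong length (trans e (trans (cong (g ·_) h≡[]) (·-identityʳ g))))))
  ... | no ¬p = inj₁ (record { nontrivial = ne ; atomic = atomic′ })
    where
    atomic′ : ∀ g h → P ≡ g · h → g ≡ [] ⊎ h ≡ []
    atomic′ g h e with g ≟ₗ [] | h ≟ₗ []
    ... | yes g≡[] | _        = inj₁ g≡[]
    ... | no _     | yes h≡[] = inj₂ h≡[]
    ... | no g≢[]  | no h≢[]  = contradiction
      (lose (∈-monics≤ _ g (ℕ.s≤s⁻¹ (subst (suc (length g) ≤_) (sym (trans (cong length e) (length-· g h)))
        (ℕ.m<m+n (length g) (≢[]⇒0< h≢[]))))) (g≢[] , h , e)) ¬p

  irreducible? : ∀ P → Dec (Irreducible P)
  irreducible? P with P ≟ₗ []
  ... | yes refl = no λ irr → nontrivial irr refl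
  ... | no ne with analyse P ne
  ...   | inj₁ irr = yes irr
  ...   | inj₂ (g , h , e , g≢[] , h≢[]) = no λ irr → case-⊎ (atomic irr g h e)
    where
    case-⊎ : ¬ (g ≡ [] ⊎ h ≡ [])
    case-⊎ (inj₁ e) = g≢[] e
    case-⊎ (inj₂ e) = h≢[] e

  factor : ∀ n f → length f ≤ n → f ≢ [] → ∃ λ P → Irreducible P × P ∣ₘ f
  factor zero    [] _ ne = contradiction refl ne
  factor (suc n) f le ne with analyse f ne
  ... | inj₁ irr = f , irr , [] , sym (·-identityʳ f)
  ... | inj₂ (g , h , refl , g≢[] , h≢[]) =
    let P , irr , k , e = factor n g (ℕ.s≤s⁻¹ (ℕ.≤-trans (subst (length g <_) (sym (length-· g h))
                            (ℕ.m<m+n (length g) (≢[]⇒0< h≢[]))) le)) g≢[]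
    in P , irr , k · h , trans (cong (_· h) e) (·-assoc P k h)

  ⊗-swap : ∀ c p k → c ⊗ (p ⊗ k) ≋ p ⊗ (c ⊗ k)
  ⊗-swap = P.solve 3 (λ c p k → c P.:* (p P.:* k) P.:= p P.:* (c P.:* k)) ≋-refl

  remainder-multiple : ∀ p f h r g k → p ≋ f ⊗ h ⊕ r → f ⊗ g ≋ p ⊗ k → r ⊗ g ≋ p ⊗ (g ⊕ ⊝ (k ⊗ h))
  remainder-multiple p f h r g k e e′ =
    ≋-trans (P.solve 4 (λ f h r g → r P.:* g P.:= (f P.:* h P.:+ r) P.:* g P.:- (f P.:* g) P.:* h) ≋-refl f h r g)
      (≋-trans (⊕-cong (⊗-cong (≋-sym e) ≋-refl) (scale-cong _ (⊗-cong e′ ≋-refl)))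
        (P.solve 4 (λ p g k h → p P.:* g P.:- (p P.:* k) P.:* h P.:= p P.:* (g P.:- k P.:* h)) ≋-refl p g k h))

  remainder-∣ : ∀ p f h r g k → f ≋ p ⊗ h ⊕ r → f ⊗ g ≋ p ⊗ k → r ⊗ g ≋ p ⊗ (k ⊕ ⊝ (h ⊗ g))
  remainder-∣ p f h r g k e e′ =
    ≋-trans (P.solve 4 (λ p h r g → r P.:* g P.:= (p P.:* h P.:+ r) P.:* g P.:- p P.:* (h P.:* g)) ≋-refl p h r g)
      (≋-trans (⊕-cong (≋-trans (⊗-cong (≋-sym e) ≋-refl) e′) ≋-refl)
        (P.solve 3 (λ p k h → p P.:* k P.:- p P.:* h P.:= p P.:* (k P.:- h)) ≋-refl p k (h ⊗ g)))

  -- Gauss's descent: replacing r by the remainder of P modulo r keeps P ∣ r g.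
  descent : ∀ {P} → Irreducible P → ∀ g n r → length r ≤ n → n ≤ length P →
            P ∣ₚ r ⊗ g → P ∣ₚ g ⊎ r ≋ []
  descent irr g zero    []  _ _ _ = inj₂ ≋-refl
  descent {P} irr g (suc n) r le le′ (k , e) with normal r
  ... | null r≋[] = inj₂ r≋[]
  ... | unit*monic c f c≢0 r≋ lt = step f refl
    where
    c⁻¹ = proj₁ (inverse c c≢0)
    c⁻¹r≋f : [ c⁻¹ ]ₚ ⊗ r ≋ monic f
    c⁻¹r≋f = ≋-trans (⊗-cong (≋-refl {[ c⁻¹ ]ₚ}) (≋-trans r≋ (scale≋⊗ c _)))
      (≋-trans (≋-sym (⊗-assoc [ c⁻¹ ]ₚ [ c ]ₚ (monic f)))
        (≋-trans (⊗-cong (≋-trans (≋-sym (scale≋⊗ c⁻¹ [ c ]ₚ)) (∷-cong (trans (*-comm c⁻¹ c) (proj₂ (inverse c c≢0))) ≋-refl)) ≋-refl)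
          (⊗-identityˡ (monic f))))
    P∣fg : monic f ⊗ g ≋ monic P ⊗ ([ c⁻¹ ]ₚ ⊗ k)
    P∣fg = ≋-trans (⊗-cong (≋-sym c⁻¹r≋f) ≋-refl) (≋-trans (⊗-assoc [ c⁻¹ ]ₚ r g)
      (≋-trans (⊗-cong (≋-refl {[ c⁻¹ ]ₚ}) e) (⊗-swap [ c⁻¹ ]ₚ (monic P) k)))
    step : ∀ f′ → f ≡ f′ → P ∣ₚ g ⊎ r ≋ []
    step [] refl = inj₁ (_ , ≋-trans (≋-sym (⊗-identityˡ g)) P∣fg)
    step f′@(_ ∷ _) refl with divide f (monic P)
    ... | h , r′ , e′ , le″ =
      Sum.[ inj₁ , (λ r′≋[] → ⊥-elim (f≢P (∣ₚ⇒∣ₘ f P (h , ≋-trans e′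
        (≋-trans (⊕-cong ≋-refl r′≋[]) (⊕-comm _ [])))))) ]′
        (descent irr g n r′ (ℕ.≤-trans le″ |f|≤n) (ℕ.<⇒≤ le′) (g ⊕ ⊝ (([ c⁻¹ ]ₚ ⊗ k) ⊗ h) , P∣r′g))
      where
      |f|≤n : length f ≤ n
      |f|≤n = ℕ.s≤s⁻¹ (ℕ.≤-trans lt le)
      f≢P : f ∣ₘ P → ⊥
      -- The alternative f = 1 is excluded by the shape `_ ∷ _` of f; a trivial cofactor would give
      -- f = P, though f is shorter than P.
      f≢P (q , P≡f·q) with atomic irr f q P≡f·q
      ... | inj₂ refl = ℕ.<-irrefl (sym (trans (cong length P≡f·q) (cong length (·-identityʳ f))))
                          (ℕ.≤-trans (ℕ.≤-trans lt le) le′)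
      P∣r′g : r′ ⊗ g ≋ monic P ⊗ (g ⊕ ⊝ (([ c⁻¹ ]ₚ ⊗ k) ⊗ h))
      P∣r′g = remainder-multiple (monic P) (monic f) h r′ g ([ c⁻¹ ]ₚ ⊗ k) e′ P∣fg

  -- The remainder of f modulo P is short enough for `descent` to start, and P divides f exactly
  -- when it vanishes.
  euclid : ∀ {P} → Irreducible P → ∀ f g → P ∣ₘ f · g → P ∣ₘ f ⊎ P ∣ₘ g
  euclid {P} irr f g P∣fg =
    let h , r , e , le = divide P (monic f)
        k , e′ = ∣ₘ⇒∣ₚ P (f · g) P∣fg
    in Sum.[ (λ P∣g → inj₂ (∣ₚ⇒∣ₘ P g P∣g))
           , (λ r≋[] → inj₁ (∣ₚ⇒∣ₘ P f (h , ≋-trans e (≋-trans (⊕-cong ≋-refl r≋[]) (⊕-comm _ []))))) ]′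
         (descent irr (monic g) (length P) r le ℕ.≤-refl
           (k ⊕ ⊝ (h ⊗ monic g) , remainder-∣ (monic P) (monic f) h r (monic g) k e (≋-trans (≋-sym (monic-· f g)) e′)))

  irreducible-∣ : ∀ {P Q} → Irreducible P → Irreducible Q → P ∣ₘ Q → P ≡ Q
  irreducible-∣ {P} irrP irrQ (h , e) with atomic irrQ P h e
  ... | inj₁ P≡[] = contradiction P≡[] (nontrivial irrP)
  ... | inj₂ refl = sym (trans e (·-identityʳ P))

  infixr 8 _^ₘ_
  _^ₘ_ : List A → ℕ → List A
  P ^ₘ zero  = []
  P ^ₘ suc k = P · P ^ₘ k

  length-^ₘ : ∀ P k → length (P ^ₘ k) ≡ k ℕ.* length P
  length-^ₘ P zero    = refl
  length-^ₘ P (suc k) = trans (length-· P (P ^ₘ k)) (cong (length P ℕ.+_) (length-^ₘ P k))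

  ∣-·ˡ : ∀ d f g → d ∣ₘ f → d ∣ₘ g · f
  ∣-·ˡ d f g (k , refl) = g · k , trans (sym (·-assoc g d k)) (trans (cong (_· k) (·-comm g d)) (·-assoc d g k))

  ∣-·-cancelˡ : ∀ {d f} g → g · d ∣ₘ g · f → d ∣ₘ f
  ∣-·-cancelˡ {d} {f} g (k , e) = k , ·-cancelˡ g f (d · k) (trans e (·-assoc g d k))

  -- One factor P is peeled off at a time: P divides Q g but not Q, so it divides g by `euclid`, and
  -- cancelling it leaves a smaller power.
  ^ₘ-∣-· : ∀ {P Q} → Irreducible P → Irreducible Q → P ≢ Q → ∀ k g → P ^ₘ k ∣ₘ Q · g → P ^ₘ k ∣ₘ g
  ^ₘ-∣-· irrP irrQ P≢Q zero    g _ = g , refl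
  ^ₘ-∣-· {P} {Q} irrP irrQ P≢Q (suc k) g (h , e) =
    Sum.[ (λ P∣Q → contradiction (irreducible-∣ irrP irrQ P∣Q) P≢Q) , P∣g⇒ ]′
      (euclid irrP Q g (P ^ₘ k · h , trans e (·-assoc P (P ^ₘ k) h)))
    where
    P∣g⇒ : P ∣ₘ g → P ^ₘ suc k ∣ₘ g
    P∣g⇒ (g′ , g≡) =
      let h′ , g′≡ = ^ₘ-∣-· irrP irrQ P≢Q k g′ (∣-·-cancelˡ P (h , PQg′≡))
      in h′ , trans g≡ (trans (cong (P ·_) g′≡) (sym (·-assoc P (P ^ₘ k) h′)))
      where
      PQg′≡ : P · (Q · g′) ≡ P ^ₘ suc k · h
      PQg′≡ = begin
        P · (Q · g′)    ≡⟨ ·-assoc P Q g′ ⟨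
        P · Q · g′      ≡⟨ cong (_· g′) (·-comm P Q) ⟩
        Q · P · g′      ≡⟨ ·-assoc Q P g′ ⟩
        Q · (P · g′)    ≡⟨ cong (Q ·_) g≡ ⟨
        Q · g           ≡⟨ e ⟩
        P ^ₘ suc k · h  ∎

  primes : ℕ → List (List A)
  primes N = filter irreducible? (monics≤ N)

  ∈-primes : ∀ {N P} → length P ≤ N → Irreducible P → P ∈ primes N
  ∈-primes le irr = ∈.∈-filter⁺ irreducible? (∈-monics≤ _ _ le) irr

  ∈-primes⁻ : ∀ N {P} → P ∈ primes N → length P ≤ N × Irreducible P
  ∈-primes⁻ N P∈ with ∈.∈-filter⁻ irreducible? {xs = monics≤ N} P∈
  ... | P∈′ , irr = ∈-monics≤⁻ N P∈′ , irr

  primes-unique : ∀ N → Unique (primes N)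
  primes-unique N = Unique.filter⁺ irreducible? (monics≤-unique N)

-- Logarithmic derivatives of Euler products

module EulerProduct {A : Set} (K : DiscreteField A) (enum : Enumeration A) (R : CommutativeSemiring 0ℓ 0ℓ) where
  open Polynomials K using (_·_; _∣ₘ_; _∣?_; length-·; ·-cancelˡ)
  open Factorization K enum
  open CommutativeSemiring R
    renaming (refl to ≈-refl; sym to ≈-sym; trans to ≈-trans; reflexive to ≈-reflexive)
  open ListSum R
  open Algebra.Properties.Semiring.Mult semiring using (×-homo-+) renaming (_×_ to _⋆_)
  open Algebra.Definitions.RawSemiring rawSemiring using (_^_)
  open Algebra.Properties.CommutativeSemigroup *-commutativeSemigroup using (x∙yz≈y∙xz)
  open Relation.Binary.Reasoning.Setoid setoid

  #_ : ℕ → Carrier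
  # n = n ⋆ 1#

  -- The exponent of P in f as the number of powers of P that divide f. A sum of brackets, unlike a
  -- recursive count, can be exchanged with the sum over f. It is exact for irreducible P and deg f
  -- ≤ N.
  multiplicity : ℕ → List A → List A → Carrier
  multiplicity N P f = ∑[ k ← upTo N ] [ P ^ₘ suc k ∣? f ]

  ∣-length : ∀ d f → d ∣ₘ f → length d ≤ length f
  ∣-length d f (g , e) = subst (length d ≤_) (sym (trans (cong length e) (length-· d g))) (ℕ.m≤m+n _ _)

  ^ₘ-∤ : ∀ {P} → Irreducible P → ∀ k f → length f < k → ¬ P ^ₘ k ∣ₘ f
  ^ₘ-∤ {P} irr k f lt P^k∣f = ℕ.<-irrefl refl (ℕ.<-≤-trans lt (ℕ.≤-trans
    (ℕ.m≤m*n k (length P) ⦃ ℕ.>-nonZero (≢[]⇒0< (nontrivial irr)) ⦄)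
    (subst (_≤ length f) (length-^ₘ P k) (∣-length (P ^ₘ k) f P^k∣f))))

  multiplicity-[] : ∀ N {P} → Irreducible P → multiplicity N P [] ≈ 0#
  multiplicity-[] N {P} irr = ≈-trans
    (∑-cong (upTo N) λ k → ≈-reflexive ([]-no (P ^ₘ suc k ∣? []) (^ₘ-∤ irr (suc k) [] (s≤s z≤n))))
    (∑-0 (upTo N))

  -- Cancelling P shifts the range of exponents by one. The term gained, for exponent 0, is 1; the
  -- term lost at the far end is 0 because the power there has degree above that of g.
  multiplicity-·-self : ∀ N {P} g → Irreducible P → length g < N →
                        multiplicity N P (P · g) ≈ multiplicity N P g + 1#
  multiplicity-·-self (suc N) {P} g irr lt = begin
    multiplicity (suc N) P (P · g)
      ≈⟨ ∑-cong (upTo (suc N)) (λ k → ≈-reflexive ([]-⇔ (P ^ₘ suc k ∣? (P · g)) (P ^ₘ k ∣? g)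
           (∣-·-cancelˡ P) (λ (h , e) → h , trans (cong (P ·_) e) (sym (Polynomials.·-assoc K P (P ^ₘ k) h))))) ⟩
    ∑[ k ← upTo (suc N) ] [ P ^ₘ k ∣? g ]
      ≡⟨ ∑-upTo-suc N (λ k → [ P ^ₘ k ∣? g ]) ⟩
    [ [] ∣? g ] + multiplicity N P g
      ≈⟨ +-congʳ (≈-reflexive ([]-yes ([] ∣? g) (g , refl))) ⟩
    1# + multiplicity N P g
      ≈⟨ +-comm _ _ ⟩
    multiplicity N P g + 1#
      ≈⟨ +-congʳ (≈-trans (+-congˡ (≈-reflexive ([]-no (P ^ₘ suc N ∣? g) (^ₘ-∤ irr (suc N) g lt)))) (+-identityʳ _)) ⟨
    multiplicity N P g + [ P ^ₘ suc N ∣? g ] + 1#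
      ≈⟨ +-congʳ (∑-upTo-last N (λ k → [ P ^ₘ suc k ∣? g ])) ⟨
    multiplicity (suc N) P g + 1# ∎

  multiplicity-· : ∀ N {P Q} g → Irreducible P → Irreducible Q → length g < N →
                   multiplicity N P (Q · g) ≈ multiplicity N P g + [ P ≟ₗ Q ]
  multiplicity-· N {P} {Q} g irrP irrQ lt with P ≟ₗ Q
  ... | yes refl = multiplicity-·-self N g irrP lt
  ... | no P≢Q   = ≈-trans
    (∑-cong (upTo N) (λ k → ≈-reflexive ([]-⇔ (P ^ₘ suc k ∣? (Q · g)) (P ^ₘ suc k ∣? g)
       (^ₘ-∣-· irrP irrQ P≢Q (suc k) g) (∣-·ˡ (P ^ₘ suc k) g Q))))
    (≈-sym (+-identityʳ _))

  -- Removing one prime factor Q changes only the multiplicity at Q. This independence, which rests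
  -- on `euclid`, is all of unique factorization that is used.
  degree-sum : ∀ N f → length f ≤ N → ∑[ P ← primes N ] (# length P * multiplicity N P f) ≈ # length f
  degree-sum N f le = go (length f) f ℕ.≤-refl le
    where
    go : ∀ n f → length f ≤ n → length f ≤ N → ∑[ P ← primes N ] (# length P * multiplicity N P f) ≈ # length f
    go n [] _ _ = ≈-trans (∑-cong∈ (primes N) (λ P∈ →
      ≈-trans (*-congˡ (multiplicity-[] N (proj₂ (∈-primes⁻ N P∈)))) (zeroʳ _))) (∑-0 (primes N))
    go (suc n) f@(_ ∷ _) le le′ = step (factor _ f ℕ.≤-refl (λ ()))
      where
      step : (∃ λ P → Irreducible P × P ∣ₘ f) → _
      step (Q , irr , g , e) = begin
        ∑[ P ← primes N ] (# length P * multiplicity N P f)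
          ≡⟨ cong (λ f → ∑[ P ← primes N ] (# length P * multiplicity N P f)) e ⟩
        ∑[ P ← primes N ] (# length P * multiplicity N P (Q · g))
          ≈⟨ ∑-cong∈ (primes N) (λ P∈ → ≈-trans
               (*-congˡ (multiplicity-· N g (proj₂ (∈-primes⁻ N P∈)) irr (ℕ.≤-trans |g|<|f| le′)))
               (≈-trans (distribˡ _ _ _) (+-congˡ (*-comm _ _)))) ⟩
        ∑[ P ← primes N ] (# length P * multiplicity N P g + [ P ≟ₗ Q ] * # length P)
          ≈⟨ ∑-+ (primes N) _ _ ⟩
        ∑[ P ← primes N ] (# length P * multiplicity N P g) + ∑[ P ← primes N ] ([ P ≟ₗ Q ] * # length P)
          ≈⟨ +-cong (go n g (ℕ.s≤s⁻¹ (ℕ.≤-trans |g|<|f| le)) (ℕ.<⇒≤ (ℕ.≤-trans |g|<|f| le′)))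
                    (∑-δ _≟ₗ_ (λ P → # length P) (primes-unique N) (∈-primes (ℕ.≤-trans |Q|≤|f| le′) irr)) ⟩
        # length g + # length Q          ≈⟨ +-comm _ _ ⟩
        # length Q + # length g          ≈⟨ ×-homo-+ 1# (length Q) (length g) ⟨
        # (length Q ℕ.+ length g)        ≡⟨ cong #_ |f| ⟨
        # length f                       ∎
        where
        |f| : length f ≡ length Q ℕ.+ length g
        |f| = trans (cong length e) (length-· Q g)
        |g|<|f| : length g < length f
        |g|<|f| = subst (length g <_) (sym |f|) (ℕ.m<n+m (length g) (≢[]⇒0< (nontrivial irr)))
        |Q|≤|f| : length Q ≤ length f
        |Q|≤|f| = subst (length Q ≤_) (sym |f|) (ℕ.m≤m+n _ _)

  module _ (χ : List A → Carrier) (χ-[] : χ [] ≈ 1#) (χ-· : ∀ f g → χ (f · g) ≈ χ f * χ g) where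

    coefficient : ℕ → Carrier
    coefficient n = ∑ (monics n) χ

    -- The coefficient of T^i in T L′/L for the Euler product L of χ, with exponents k + 1. The
    -- truncation to degrees and exponents up to N loses nothing for i ≤ N.
    powerSum : ℕ → ℕ → Carrier
    powerSum N i = ∑[ P ← primes N ] ∑[ k ← upTo N ] ([ i ℕ.≟ suc k ℕ.* length P ] * (# length P * χ P ^ suc k))

    χ-^ₘ : ∀ P k → χ (P ^ₘ k) ≈ χ P ^ k
    χ-^ₘ P zero    = χ-[]
    χ-^ₘ P (suc k) = ≈-trans (χ-· P (P ^ₘ k)) (*-congˡ (χ-^ₘ P k))

    -- A multiple of Q of degree n is Q g for a unique g. At most the index i = deg Q contributes on
    -- the right, and none if deg Q > n, so `newton` can treat all prime powers alike.
    multiples : ∀ n Q → ∑[ f ← monics n ] (χ f * [ Q ∣? f ]) ≈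
                ∑[ i ← upTo (suc n) ] ([ i ℕ.≟ length Q ] * (χ Q * coefficient (n ∸ i)))
    multiples n Q with length Q ℕ.≤? n
    ... | no |Q|≰n = ≈-trans
      (≈-trans (∑-cong∈ (monics n) λ {f} f∈ → ≈-trans (*-congˡ (≈-reflexive ([]-no (Q ∣? f)
         λ Q∣f → |Q|≰n (subst (length Q ≤_) (∈-monics⁻ n f∈) (∣-length Q f Q∣f))))) (zeroʳ _)) (∑-0 (monics n)))
      (≈-sym (≈-trans (∑-cong∈ (upTo (suc n)) λ {i} i∈ → ≈-trans (*-congʳ (≈-reflexive ([]-no (i ℕ.≟ length Q)
         λ { refl → |Q|≰n (ℕ.s≤s⁻¹ (∈.∈-upTo⁻ i∈)) }))) (zeroˡ _)) (∑-0 (upTo (suc n)))))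
    ... | yes |Q|≤n = begin
      ∑[ f ← monics n ] (χ f * [ Q ∣? f ])
        ≈⟨ ∑-cong∈ (monics n) (λ f∈ → ≈-trans (*-congˡ (count f∈)) (≈-sym (∑-*ˡ (monics n′) _ _))) ⟩
      ∑[ f ← monics n ] ∑[ g ← monics n′ ] (χ f * [ f ≟ₗ Q · g ])
        ≈⟨ ∑-swap (monics n) (monics n′) (λ f g → χ f * [ f ≟ₗ Q · g ]) ⟩
      ∑[ g ← monics n′ ] ∑[ f ← monics n ] (χ f * [ f ≟ₗ Q · g ])
        ≈⟨ ∑-cong∈ (monics n′) (λ g∈ → ≈-trans (∑-cong (monics n) (λ f → *-comm _ _))
             (≈-trans (∑-δ _≟ₗ_ χ (monics-unique n) (Qg∈ g∈)) (χ-· Q _))) ⟩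
      ∑[ g ← monics n′ ] (χ Q * χ g)
        ≈⟨ ∑-*ˡ (monics n′) (χ Q) χ ⟩
      χ Q * coefficient n′
        ≈⟨ ∑-δ ℕ._≟_ (λ i → χ Q * coefficient (n ∸ i)) (Unique.upTo⁺ (suc n)) (∈.∈-upTo⁺ (s≤s |Q|≤n)) ⟨
      ∑[ i ← upTo (suc n) ] ([ i ℕ.≟ length Q ] * (χ Q * coefficient (n ∸ i))) ∎
      where
      n′ = n ∸ length Q
      Qg∈ : ∀ {g} → g ∈ monics n′ → Q · g ∈ monics n
      Qg∈ {g} g∈ = subst (λ k → Q · g ∈ monics k)
        (trans (length-· Q g) (trans (cong (length Q ℕ.+_) (∈-monics⁻ n′ g∈)) (ℕ.m+[n∸m]≡n |Q|≤n)))
        (∈-monics (Q · g))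
      count : ∀ {f} → f ∈ monics n → [ Q ∣? f ] ≈ ∑[ g ← monics n′ ] [ f ≟ₗ Q · g ]
      count {f} f∈ = split (Q ∣? f)
        where
        split : (d : Dec (Q ∣ₘ f)) → [ d ] ≈ ∑[ g ← monics n′ ] [ f ≟ₗ Q · g ]
        split (no ¬p)       = ≈-sym (≈-trans (∑-cong (monics n′) λ g →
          ≈-reflexive ([]-no (f ≟ₗ Q · g) λ e → ¬p (g , e))) (∑-0 (monics n′)))
        split (yes (h , e)) = ≈-sym (≈-trans
          (∑-cong (monics n′) λ g → ≈-reflexive ([]-⇔ (f ≟ₗ Q · g) (g ≟ₗ h)
            (λ e′ → ·-cancelˡ Q g h (trans (sym e′) e)) (λ g≡h → trans e (cong (Q ·_) (sym g≡h)))))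
          (∑-δ1 _≟ₗ_ (monics-unique n′) (subst (λ k → h ∈ monics k) |h| (∈-monics h))))
          where
          |h| : length h ≡ n′
          |h| = trans (sym (ℕ.m+n∸m≡n (length Q) (length h)))
            (cong (_∸ length Q) (trans (sym (length-· Q h)) (trans (cong length (sym e)) (∈-monics⁻ n f∈))))

    -- The logarithmic derivative of the Euler product of ∑ χ(f) T^deg f.
    newton : ∀ N n → n ≤ N →
             # n * coefficient n ≈ ∑[ i ← upTo (suc n) ] (powerSum N i * coefficient (n ∸ i))
    newton N n n≤N = begin
      # n * coefficient n
        ≈⟨ ∑-*ˡ (monics n) (# n) χ ⟨
      ∑[ f ← monics n ] (# n * χ f)
        ≈⟨ ∑-cong∈ (monics n) (λ f∈ → expand f∈) ⟩
      ∑[ f ← monics n ] ∑[ P ← primes N ] ∑[ k ← upTo N ] (# length P * (χ f * [ P ^ₘ suc k ∣? f ]))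
        ≈⟨ ∑-swap (monics n) (primes N) (λ f P → ∑[ k ← upTo N ] (# length P * (χ f * [ P ^ₘ suc k ∣? f ]))) ⟩
      ∑[ P ← primes N ] ∑[ f ← monics n ] ∑[ k ← upTo N ] (# length P * (χ f * [ P ^ₘ suc k ∣? f ]))
        ≈⟨ ∑-cong (primes N) (λ P → ≈-trans (∑-swap (monics n) (upTo N) (λ f k → # length P * (χ f * [ P ^ₘ suc k ∣? f ])))
             (∑-cong (upTo N) (collect P))) ⟩
      ∑[ P ← primes N ] ∑[ k ← upTo N ] ∑[ i ← upTo (suc n) ] (term i P k * coefficient (n ∸ i))
        ≈⟨ ∑-cong (primes N) (λ P → ∑-swap (upTo N) (upTo (suc n)) (λ k i → term i P k * coefficient (n ∸ i))) ⟩
      ∑[ P ← primes N ] ∑[ i ← upTo (suc n) ] ∑[ k ← upTo N ] (term i P k * coefficient (n ∸ i))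
        ≈⟨ ∑-swap (primes N) (upTo (suc n)) (λ P i → ∑[ k ← upTo N ] (term i P k * coefficient (n ∸ i))) ⟩
      ∑[ i ← upTo (suc n) ] ∑[ P ← primes N ] ∑[ k ← upTo N ] (term i P k * coefficient (n ∸ i))
        ≈⟨ ∑-cong (upTo (suc n)) (λ i → ≈-trans
             (∑-cong (primes N) (λ P → ∑-*ʳ (upTo N) (coefficient (n ∸ i)) (term i P)))
             (∑-*ʳ (primes N) (coefficient (n ∸ i)) (λ P → ∑ (upTo N) (term i P)))) ⟩
      ∑[ i ← upTo (suc n) ] (powerSum N i * coefficient (n ∸ i)) ∎
      where
      term : ℕ → List A → ℕ → Carrier
      term i P k = [ i ℕ.≟ suc k ℕ.* length P ] * (# length P * χ P ^ suc k)

      expand : ∀ {f} → f ∈ monics n →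
        # n * χ f ≈ ∑[ P ← primes N ] ∑[ k ← upTo N ] (# length P * (χ f * [ P ^ₘ suc k ∣? f ]))
      expand {f} f∈ = begin
        # n * χ f         ≡⟨ cong (λ d → # d * χ f) (∈-monics⁻ n f∈) ⟨
        # length f * χ f  ≈⟨ *-comm _ _ ⟩
        χ f * # length f
          ≈⟨ *-congˡ (degree-sum N f (subst (_≤ N) (sym (∈-monics⁻ n f∈)) n≤N)) ⟨
        χ f * ∑[ P ← primes N ] (# length P * multiplicity N P f)
          ≈⟨ ∑-*ˡ (primes N) (χ f) _ ⟨
        ∑[ P ← primes N ] (χ f * (# length P * multiplicity N P f))
          ≈⟨ ∑-cong (primes N) (λ P → begin
               χ f * (# length P * multiplicity N P f)                         ≈⟨ x∙yz≈y∙xz _ _ _ ⟩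
               # length P * (χ f * multiplicity N P f)                         ≈⟨ *-congˡ (∑-*ˡ (upTo N) (χ f) _) ⟨
               # length P * ∑[ k ← upTo N ] (χ f * [ P ^ₘ suc k ∣? f ])        ≈⟨ ∑-*ˡ (upTo N) (# length P) _ ⟨
               ∑[ k ← upTo N ] (# length P * (χ f * [ P ^ₘ suc k ∣? f ]))      ∎) ⟩
        ∑[ P ← primes N ] ∑[ k ← upTo N ] (# length P * (χ f * [ P ^ₘ suc k ∣? f ])) ∎

      collect : ∀ P k → ∑[ f ← monics n ] (# length P * (χ f * [ P ^ₘ suc k ∣? f ])) ≈
                ∑[ i ← upTo (suc n) ] (term i P k * coefficient (n ∸ i))
      collect P k = begin
        ∑[ f ← monics n ] (# length P * (χ f * [ P ^ₘ suc k ∣? f ]))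
          ≈⟨ ∑-*ˡ (monics n) (# length P) _ ⟩
        # length P * ∑[ f ← monics n ] (χ f * [ P ^ₘ suc k ∣? f ])
          ≈⟨ *-congˡ (multiples n (P ^ₘ suc k)) ⟩
        # length P * ∑[ i ← upTo (suc n) ] ([ i ℕ.≟ length (P ^ₘ suc k) ] * (χ (P ^ₘ suc k) * coefficient (n ∸ i)))
          ≈⟨ ∑-*ˡ (upTo (suc n)) (# length P) _ ⟨
        ∑[ i ← upTo (suc n) ] (# length P * ([ i ℕ.≟ length (P ^ₘ suc k) ] * (χ (P ^ₘ suc k) * coefficient (n ∸ i))))
          ≈⟨ ∑-cong (upTo (suc n)) (λ i → begin
               # length P * ([ i ℕ.≟ length (P ^ₘ suc k) ] * (χ (P ^ₘ suc k) * coefficient (n ∸ i)))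
                 ≡⟨ cong (λ d → # length P * ([ i ℕ.≟ d ] * (χ (P ^ₘ suc k) * coefficient (n ∸ i)))) (length-^ₘ P (suc k)) ⟩
               # length P * ([ i ℕ.≟ suc k ℕ.* length P ] * (χ (P ^ₘ suc k) * coefficient (n ∸ i)))
                 ≈⟨ *-congˡ (*-congˡ (*-congʳ (χ-^ₘ P (suc k)))) ⟩
               # length P * ([ i ℕ.≟ suc k ℕ.* length P ] * (χ P ^ suc k * coefficient (n ∸ i)))
                 ≈⟨ x∙yz≈y∙xz _ _ _ ⟩
               [ i ℕ.≟ suc k ℕ.* length P ] * (# length P * (χ P ^ suc k * coefficient (n ∸ i)))
                 ≈⟨ *-congˡ (*-assoc _ _ _) ⟨
               [ i ℕ.≟ suc k ℕ.* length P ] * (# length P * χ P ^ suc k * coefficient (n ∸ i))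
                 ≈⟨ *-assoc _ _ _ ⟨
               term i P k * coefficient (n ∸ i) ∎) ⟩
        ∑[ i ← upTo (suc n) ] (term i P k * coefficient (n ∸ i)) ∎

    powerSum-0 : ∀ N → powerSum N 0 ≈ 0#
    powerSum-0 N = ≈-trans (∑-cong∈ (primes N) λ {P} P∈ → ≈-trans
      (∑-cong (upTo N) λ k → ≈-trans (*-congʳ (≈-reflexive ([]-no (0 ℕ.≟ suc k ℕ.* length P)
        (λ e → ℕ.<⇒≢ (≢[]⇒0< (nontrivial (proj₂ (∈-primes⁻ N P∈)))) (sym (ℕ.m+n≡0⇒m≡0 (length P) (sym e))))))) (zeroˡ _))
      (∑-0 (upTo N))) (∑-0 (primes N))

-- Finite fields and characteristic 3

unique-↭ : ∀ {A : Set} {xs ys : List A} → Unique xs → Unique ys → (∀ {x} → x ∈ xs ⇔ x ∈ ys) → xs ↭ ys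
unique-↭ uxs uys e = ∼bag⇒↭ (unique∧set⇒bag uxs uys e)

module FieldProperties {A : Set} (K : DiscreteField A) where
  open DiscreteField K public
  open CommutativeRing commutativeRing public
    using (_-_; +-congˡ; +-congʳ; *-congˡ; *-congʳ; +-comm; +-assoc; +-identityˡ; +-identityʳ; *-comm; *-assoc
          ; *-identityˡ; *-identityʳ; zeroˡ; zeroʳ; -‿inverseˡ; -‿inverseʳ; semiring; commutativeSemiring)
  open Algebra.Properties.Ring (CommutativeRing.ring commutativeRing) public using (+-cancelˡ; x∙y⁻¹≈ε⇒x≈y; -‿involutive)
  open Algebra.Properties.Semiring.Mult semiring public using () renaming (_×_ to _⋆_)
  open Algebra.Properties.Semiring.Exp semiring public using (_^_; ^-homo-*; ^-assocʳ)
  open Algebra.Properties.CommutativeSemiring.Exp commutativeSemiring public using (^-distrib-*)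
  open Polynomials K using (addMultiple; length-addMultiple; _⊕_)
  private module S = IntegerCoefficientSolver commutativeRing
  open S using (solve; con; _:+_; _:*_; _:=_; :-_; _:-_)
  open ≡.≡-Reasoning

  x*y≡0 : ∀ {x y} → x * y ≡ 0# → x ≡ 0# ⊎ y ≡ 0#
  x*y≡0 {x} {y} e with x ≟ 0#
  ... | yes x≡0 = inj₁ x≡0
  ... | no x≢0  = let x⁻¹ , xx⁻¹ = inverse x x≢0 in inj₂ (begin
    y               ≡⟨ *-identityˡ y ⟨
    1# * y          ≡⟨ cong (_* y) (trans (*-comm x⁻¹ x) xx⁻¹) ⟨
    x⁻¹ * x * y     ≡⟨ *-assoc x⁻¹ x y ⟩
    x⁻¹ * (x * y)   ≡⟨ cong (x⁻¹ *_) e ⟩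
    x⁻¹ * 0#        ≡⟨ zeroʳ x⁻¹ ⟩
    0#              ∎)

  *-cancelˡ : ∀ {x y z} → x ≢ 0# → x * y ≡ x * z → y ≡ z
  *-cancelˡ {x} {y} {z} x≢0 e = Sum.[ (λ x≡0 → contradiction x≡0 x≢0) , x∙y⁻¹≈ε⇒x≈y y z ]′
    (x*y≡0 {x} {y - z} (trans (solve 3 (λ x y z → x :* (y :- z) := x :* y :- x :* z) refl x y z)
      (trans (cong (_- x * z) e) (-‿inverseʳ (x * z)))))

  x*y≢0 : ∀ {x y} → x ≢ 0# → y ≢ 0# → x * y ≢ 0#
  x*y≢0 x≢0 y≢0 e = Sum.[ x≢0 , y≢0 ]′ (x*y≡0 e)

  x^n≡0 : ∀ {x} n → x ^ n ≡ 0# → x ≡ 0#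
  x^n≡0 zero    e = contradiction e 1≢0
  x^n≡0 (suc n) e = Sum.[ id , x^n≡0 n ]′ (x*y≡0 e)

  0^n : ∀ {n} → 0 < n → 0# ^ n ≡ 0#
  0^n {suc n} _ = zeroˡ _

  1^n : ∀ n → 1# ^ n ≡ 1#
  1^n zero    = refl
  1^n (suc n) = trans (*-identityˡ _) (1^n n)

  evalₚ : List A → A → A
  evalₚ []      x = 0#
  evalₚ (c ∷ p) x = c + x * evalₚ p x

  -- Here the list stands for a monic polynomial with implicit leading coefficient 1, whereas
  -- `evalₚ` takes it as all the coefficients.
  eval : List A → A → A
  eval []      x = 1#
  eval (c ∷ f) x = c + x * eval f x

  eval≡evalₚ : ∀ f x → eval f x ≡ evalₚ f x + x ^ length f
  eval≡evalₚ []      x = sym (+-identityˡ 1#)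
  eval≡evalₚ (c ∷ f) x = trans (cong (λ z → c + x * z) (eval≡evalₚ f x))
    (solve 4 (λ c x u v → c :+ x :* (u :+ v) := c :+ x :* u :+ x :* v) refl c x (evalₚ f x) (x ^ length f))

  eval-addMultiple : ∀ c g h x → length g < length h → eval (addMultiple c g h) x ≡ eval h x + c * eval g x
  eval-addMultiple c []      (b ∷ h) x _ =
    solve 4 (λ b c x u → b :+ c :+ x :* u := b :+ x :* u :+ c :* con (ℤ.+ 1)) refl b c x (eval h x)
  eval-addMultiple c (a ∷ g) (b ∷ h) x (s≤s lt) = trans (cong (λ z → b + c * a + x * z) (eval-addMultiple c g h x lt))
    (solve 6 (λ a b c x u v → b :+ c :* a :+ x :* (u :+ c :* v) := b :+ x :* u :+ c :* (a :+ x :* v))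
      refl a b c x (eval h x) (eval g x))

  -- Synthetic division, by recursion on x f(x) - r f(r) = (x - r) f(x) + r (f(x) - f(r)). The
  -- quotient stays monic.
  deflate : ∀ r c f → ∃ λ g → length g ≡ length f × ∀ x → eval (c ∷ f) x - eval (c ∷ f) r ≡ (x - r) * eval g x
  deflate r c [] = [] , refl , λ x →
    solve 3 (λ c x r → c :+ x :* con (ℤ.+ 1) :- (c :+ r :* con (ℤ.+ 1)) := (x :- r) :* con (ℤ.+ 1)) refl c x r
  deflate r c f@(b ∷ f′) = let g , |g| , e = deflate r b f′ in
    addMultiple r g f , length-addMultiple r g f , λ x → begin
      c + x * eval f x - (c + r * eval f r)
        ≡⟨ solve 5 (λ c x r u v → c :+ x :* u :- (c :+ r :* v) := (x :- r) :* u :+ r :* (u :- v))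
             refl c x r (eval f x) (eval f r) ⟩
      (x - r) * eval f x + r * (eval f x - eval f r)
        ≡⟨ cong (λ z → (x - r) * eval f x + r * z) (e x) ⟩
      (x - r) * eval f x + r * ((x - r) * eval g x)
        ≡⟨ solve 4 (λ d u r v → d :* u :+ r :* (d :* v) := d :* (u :+ r :* v)) refl (x - r) (eval f x) r (eval g x) ⟩
      (x - r) * (eval f x + r * eval g x)
        ≡⟨ cong ((x - r) *_) (eval-addMultiple r g f x (s≤s (ℕ.≤-reflexive |g|))) ⟨
      (x - r) * eval (addMultiple r g f) x ∎

  roots≤degree : ∀ f rs → Unique rs → (∀ {r} → r ∈ rs → eval f r ≡ 0#) → length rs ≤ length f
  roots≤degree f       []       _ _ = z≤n
  roots≤degree []      (r ∷ rs) _ z = contradiction (z (here refl)) 1≢0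
  roots≤degree (c ∷ f) (r ∷ rs) (r∉ ∷ uniq) z = let g , |g| , e = deflate r c f in
    s≤s (subst (length rs ≤_) |g| (roots≤degree g rs uniq λ {s} s∈ →
      Sum.[ (λ s-r≡0 → contradiction (sym (x∙y⁻¹≈ε⇒x≈y s r s-r≡0)) (All.lookup r∉ s∈)) , id ]′
        (x*y≡0 (trans (sym (e s)) (trans (cong₂ _-_ (z (there s∈)) (z (here refl))) (-‿inverseʳ 0#))))))

  -- Exactly d coefficients, with zeros allowed at the top, so that adding X^d always gives a monic
  -- polynomial of degree d, to which `nonroot` applies the bound on roots.
  LowDegree : ℕ → (A → A) → Set
  LowDegree d f = ∃ λ p → length p ≡ d × ∀ x → evalₚ p x ≡ f x

  low-0 : ∀ d → LowDegree d (λ _ → 0#)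
  low-0 zero    = [] , refl , λ _ → refl
  low-0 (suc d) = let p , |p| , e = low-0 d in 0# ∷ p , cong suc |p| , λ x →
    trans (cong (λ z → 0# + x * z) (e x)) (trans (+-identityˡ _) (zeroʳ x))

  low-+ : ∀ {d f g} → LowDegree d f → LowDegree d g → LowDegree d (λ x → f x + g x)
  low-+ (p , |p| , e) (q , |q| , e′) =
    p ⊕ q , trans (length-⊕ p q (trans |p| (sym |q|))) |p| , λ x → trans (evalₚ-⊕ p q x) (cong₂ _+_ (e x) (e′ x))
    where
    length-⊕ : ∀ p q → length p ≡ length q → length (p ⊕ q) ≡ length p
    length-⊕ []      []      _ = refl
    length-⊕ (_ ∷ p) (_ ∷ q) e = cong suc (length-⊕ p q (ℕ.suc-injective e))
    evalₚ-⊕ : ∀ p q x → evalₚ (p ⊕ q) x ≡ evalₚ p x + evalₚ q x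
    evalₚ-⊕ []      q       x = sym (+-identityˡ _)
    evalₚ-⊕ (a ∷ p) []      x = sym (+-identityʳ _)
    evalₚ-⊕ (a ∷ p) (b ∷ q) x = trans (cong (λ z → a + b + x * z) (evalₚ-⊕ p q x))
      (solve 5 (λ a b x u v → a :+ b :+ x :* (u :+ v) := a :+ x :* u :+ (b :+ x :* v)) refl a b x (evalₚ p x) (evalₚ q x))

  low-monomial : ∀ c {i d} → i < d → LowDegree d (λ x → c * x ^ i)
  low-monomial c {zero} {suc d} _ = let p , |p| , e = low-0 d in c ∷ p , cong suc |p| , λ x →
    trans (cong (λ z → c + x * z) (e x)) (solve 2 (λ c x → c :+ x :* con (ℤ.+ 0) := c :* con (ℤ.+ 1)) refl c x)
  low-monomial c {suc i} {suc d} (s≤s lt) = let p , |p| , e = low-monomial c lt in 0# ∷ p , cong suc |p| , λ x →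
    trans (cong (λ z → 0# + x * z) (e x))
      (solve 3 (λ c x u → con (ℤ.+ 0) :+ x :* (c :* u) := c :* (x :* u)) refl c x (x ^ i))

  open ListSum commutativeSemiring public

  low-∑ : ∀ {B : Set} {d} (is : List B) (f : B → A → A) → (∀ {i} → i ∈ is → LowDegree d (f i)) →
          LowDegree d (λ x → ∑[ i ← is ] f i x)
  low-∑ {d = d} []       f low = low-0 d
  low-∑         (i ∷ is) f low = low-+ (low (here refl)) (low-∑ is f (low ∘ there))

module FiniteFieldProperties {A : Set} (K : DiscreteField A) (enum : Enumeration A) where
  open FieldProperties K public
  open Enumeration enum public
  open ≡.≡-Reasoning
  private module S = IntegerCoefficientSolver commutativeRing
  open S using (solve; con; _:+_; _:*_; _:=_; :-_; _:-_)

  q : ℕ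
  q = length elements

  nonzero : List A
  nonzero = filter (λ x → ¬? (x ≟ 0#)) elements

  ∈-nonzero : ∀ {x} → x ≢ 0# → x ∈ nonzero
  ∈-nonzero {x} x≢0 = ∈.∈-filter⁺ (λ x → ¬? (x ≟ 0#)) (complete x) x≢0

  ∈-nonzero⁻ : ∀ {x} → x ∈ nonzero → x ≢ 0#
  ∈-nonzero⁻ x∈ = proj₂ (∈.∈-filter⁻ (λ x → ¬? (x ≟ 0#)) {xs = elements} x∈)

  nonzero-unique : Unique nonzero
  nonzero-unique = Unique.filter⁺ (λ x → ¬? (x ≟ 0#)) unique

  elements↭ : elements ↭ 0# ∷ nonzero
  elements↭ = unique-↭ unique (All.tabulate (λ x∈ → ∈-nonzero⁻ x∈ ∘ sym) ∷ nonzero-unique)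
    (λ {x} → mk⇔ (λ _ → split x (x ≟ 0#)) (λ _ → complete x))
    where
    split : ∀ x → Dec (x ≡ 0#) → x ∈ 0# ∷ nonzero
    split x (yes refl) = here refl
    split x (no x≢0)   = there (∈-nonzero x≢0)

  ∏ : List A → A
  ∏ = foldr _*_ 1#

  ∏-↭ : ∀ {xs ys} → xs ↭ ys → ∏ xs ≡ ∏ ys
  ∏-↭ xs↭ys = Data.List.Relation.Binary.Permutation.Setoid.Properties.foldr-commMonoid (≡.setoid A)
    (CommutativeRing.*-isCommutativeMonoid commutativeRing) (↭⇒↭ₛ xs↭ys)

  ∏-scale : ∀ c xs → ∏ (map (c *_) xs) ≡ c ^ length xs * ∏ xs
  ∏-scale c []       = sym (*-identityˡ 1#)
  ∏-scale c (x ∷ xs) = trans (cong (c * x *_) (∏-scale c xs))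
    (solve 4 (λ c x u v → c :* x :* (u :* v) := c :* u :* (x :* v)) refl c x (c ^ length xs) (∏ xs))

  ∏≢0 : ∀ xs → (∀ {x} → x ∈ xs → x ≢ 0#) → ∏ xs ≢ 0#
  ∏≢0 []       _ = 1≢0
  ∏≢0 (x ∷ xs) z = x*y≢0 (z (here refl)) (∏≢0 xs (z ∘ there))

  scale-nonzero : ∀ {c} → c ≢ 0# → map (c *_) nonzero ↭ nonzero
  scale-nonzero {c} c≢0 = unique-↭ (Unique.map⁺ (*-cancelˡ c≢0) nonzero-unique) nonzero-unique (mk⇔ to from)
    where
    c⁻¹ = proj₁ (inverse c c≢0)
    to : ∀ {x} → x ∈ map (c *_) nonzero → x ∈ nonzero
    to x∈ = let y , y∈ , e = ∈.∈-map⁻ (c *_) x∈ in ∈-nonzero (subst (_≢ 0#) (sym e) (x*y≢0 c≢0 (∈-nonzero⁻ y∈)))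
    from : ∀ {x} → x ∈ nonzero → x ∈ map (c *_) nonzero
    from {x} x∈ = subst (_∈ map (c *_) nonzero) cc⁻¹x≡x (∈.∈-map⁺ (c *_) (∈-nonzero λ z →
      ∈-nonzero⁻ x∈ (trans (sym cc⁻¹x≡x) (trans (cong (c *_) z) (zeroʳ c)))))
      where
      cc⁻¹x≡x : c * (c⁻¹ * x) ≡ x
      cc⁻¹x≡x = trans (sym (*-assoc c c⁻¹ x)) (trans (cong (_* x) (proj₂ (inverse c c≢0))) (*-identityˡ x))

  -- Multiplication by x permutes the nonzero elements, hence fixes their product, which can be
  -- cancelled.
  x^|nonzero| : ∀ {x} → x ≢ 0# → x ^ length nonzero ≡ 1#
  x^|nonzero| {x} x≢0 = *-cancelˡ (∏≢0 nonzero ∈-nonzero⁻) (begin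
    ∏ nonzero * x ^ length nonzero   ≡⟨ *-comm _ _ ⟩
    x ^ length nonzero * ∏ nonzero   ≡⟨ ∏-scale x nonzero ⟨
    ∏ (map (x *_) nonzero)           ≡⟨ ∏-↭ (scale-nonzero x≢0) ⟩
    ∏ nonzero                        ≡⟨ *-identityʳ _ ⟨
    ∏ nonzero * 1#                   ∎)

  q≡1+|nonzero| : q ≡ suc (length nonzero)
  q≡1+|nonzero| = ↭-length elements↭

  x^q≡x : ∀ x → x ^ q ≡ x
  x^q≡x x = subst (λ k → x ^ k ≡ x) (sym q≡1+|nonzero|) (split (x ≟ 0#))
    where
    split : Dec (x ≡ 0#) → x ^ suc (length nonzero) ≡ x
    split (yes refl) = zeroˡ _
    split (no x≢0)   = trans (cong (x *_) (x^|nonzero| x≢0)) (*-identityʳ x)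

  -- Translation by 1 permutes the field, hence fixes the sum of all elements, while it adds 1 to
  -- each of the q summands.
  q⋆1≡0 : q ⋆ 1# ≡ 0#
  q⋆1≡0 = +-cancelˡ (∑ elements id) (q ⋆ 1#) 0# (begin
    ∑ elements id + q ⋆ 1#          ≡⟨ cong (∑ elements id +_) (const-sum elements) ⟨
    ∑ elements id + ∑ elements (λ _ → 1#) ≡⟨ ∑-+ elements id (λ _ → 1#) ⟨
    ∑ elements (_+ 1#)              ≡⟨ ∑-reindex _≟_ _≟_ unique unique (_+ 1#) (_- 1#) (λ _ → complete _) (λ _ → complete _)
                                         (λ {x} _ → solve 1 (λ x → x :+ con (ℤ.+ 1) :- con (ℤ.+ 1) := x) refl x)
                                         (λ {x} _ → solve 1 (λ x → x :- con (ℤ.+ 1) :+ con (ℤ.+ 1) := x) refl x) id ⟩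
    ∑ elements id                   ≡⟨ +-identityʳ _ ⟨
    ∑ elements id + 0#              ∎)
    where
    const-sum : ∀ (xs : List A) → ∑ xs (λ _ → 1#) ≡ length xs ⋆ 1#
    const-sum []       = refl
    const-sum (x ∷ xs) = cong (1# +_) (const-sum xs)

  exists-nonroot : ∀ f → length f < q → ∃ λ x → eval f x ≢ 0#
  exists-nonroot f lt with any? (λ x → ¬? (eval f x ≟ 0#)) elements
  ... | yes p = let x , _ , e = find p in x , e
  ... | no ¬p = contradiction lt (ℕ.≤⇒≯ (roots≤degree f elements unique
    (λ {x} x∈ → decidable-stable (eval f x ≟ 0#) (λ ne → ¬p (lose x∈ ne)))))

  nonroot : ∀ {d f} → LowDegree d f → d < q → ∃ λ x → f x + x ^ d ≢ 0#
  nonroot {d} {f} (p , |p| , e) lt = let x , ne = exists-nonroot p (subst (_< q) (sym |p|) lt) in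
    x , λ z → ne (trans (eval≡evalₚ p x) (trans (cong₂ (λ y k → y + x ^ k) (e x) |p|) z))

module ℤω where
  open CommutativeRing Eisenstein.commutativeRing public using (commutativeSemiring; semiring)
  open Eisenstein public
  open ListSum commutativeSemiring public
  open CommutativeSemiring commutativeSemiring public
    using (zeroˡ; zeroʳ; *-identityʳ; +-identityʳ)

module Sω = IntegerCoefficientSolver Eisenstein.commutativeRing

-- The trace and the additive character

module Ternary {A : Set} (K : DiscreteField A) (enum : Enumeration A)
               (M : ℕ) (0<M : 0 < M) (order : length (Enumeration.elements enum) ≡ 3 ℕ.^ M) where
  open FiniteFieldProperties K enum public
  open Algebra.Properties.Semiring.Mult semiring using (×1-homo-*)
  open ≡.≡-Reasoning
  private module S = IntegerCoefficientSolver commutativeRing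
  open S using (solve; con; _:+_; _:*_; _:=_; :-_; _:-_)

  3^k⋆1 : ∀ k → (3 ℕ.^ k) ⋆ 1# ≡ (3 ⋆ 1#) ^ k
  3^k⋆1 zero    = +-identityʳ 1#
  3^k⋆1 (suc k) = trans (×1-homo-* 3 (3 ℕ.^ k)) (cong (3 ⋆ 1# *_) (3^k⋆1 k))

  -- The order 3^M vanishes in the field, and a field has no nilpotent elements.
  1+1+1≡0 : 1# + 1# + 1# ≡ 0#
  1+1+1≡0 = trans (solve 0 (con (ℤ.+ 1) :+ con (ℤ.+ 1) :+ con (ℤ.+ 1) :=
                              con (ℤ.+ 1) :+ (con (ℤ.+ 1) :+ (con (ℤ.+ 1) :+ con (ℤ.+ 0)))) refl)
    (x^n≡0 M (trans (sym (3^k⋆1 M)) (trans (cong (_⋆ 1#) (sym order)) q⋆1≡0)))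

  cube-+ : ∀ x y → (x + y) ^ 3 ≡ x ^ 3 + y ^ 3
  cube-+ x y = begin
    (x + y) ^ 3
      ≡⟨ solve 2 (λ x y → (x :+ y) :* ((x :+ y) :* ((x :+ y) :* con (ℤ.+ 1))) :=
           x :* (x :* (x :* con (ℤ.+ 1))) :+ y :* (y :* (y :* con (ℤ.+ 1))) :+
           (con (ℤ.+ 1) :+ con (ℤ.+ 1) :+ con (ℤ.+ 1)) :* (x :* x :* y :+ x :* y :* y)) refl x y ⟩
    x ^ 3 + y ^ 3 + (1# + 1# + 1#) * (x * x * y + x * y * y)
      ≡⟨ cong (λ z → x ^ 3 + y ^ 3 + z * (x * x * y + x * y * y)) 1+1+1≡0 ⟩
    x ^ 3 + y ^ 3 + 0# * (x * x * y + x * y * y)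
      ≡⟨ trans (+-congˡ (zeroˡ _)) (+-identityʳ _) ⟩
    x ^ 3 + y ^ 3 ∎

  ^3^-suc : ∀ x j → x ^ (3 ℕ.^ suc j) ≡ (x ^ (3 ℕ.^ j)) ^ 3
  ^3^-suc x j = trans (cong (x ^_) (ℕ.*-comm 3 (3 ℕ.^ j))) (sym (^-assocʳ x (3 ℕ.^ j) 3))

  ^3^-+ : ∀ j x y → (x + y) ^ (3 ℕ.^ j) ≡ x ^ (3 ℕ.^ j) + y ^ (3 ℕ.^ j)
  ^3^-+ zero    x y = trans (*-identityʳ _) (sym (cong₂ _+_ (*-identityʳ x) (*-identityʳ y)))
  ^3^-+ (suc j) x y = begin
    (x + y) ^ (3 ℕ.^ suc j)                         ≡⟨ ^3^-suc (x + y) j ⟩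
    ((x + y) ^ (3 ℕ.^ j)) ^ 3                       ≡⟨ cong (_^ 3) (^3^-+ j x y) ⟩
    (x ^ (3 ℕ.^ j) + y ^ (3 ℕ.^ j)) ^ 3             ≡⟨ cube-+ _ _ ⟩
    (x ^ (3 ℕ.^ j)) ^ 3 + (y ^ (3 ℕ.^ j)) ^ 3       ≡⟨ cong₂ _+_ (^3^-suc x j) (^3^-suc y j) ⟨
    x ^ (3 ℕ.^ suc j) + y ^ (3 ℕ.^ suc j)           ∎

  0<3^ : ∀ j → 0 < 3 ℕ.^ j
  0<3^ j = ℕ.m^n>0 3 j

  ^3^-∑ : ∀ {B : Set} j (is : List B) (f : B → A) → (∑ is f) ^ (3 ℕ.^ j) ≡ ∑[ i ← is ] (f i ^ (3 ℕ.^ j))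
  ^3^-∑ j []       f = 0^n (0<3^ j)
  ^3^-∑ j (i ∷ is) f = trans (^3^-+ j _ _) (cong (_ +_) (^3^-∑ j is f))

  tr : A → A
  tr x = ∑[ j ← upTo M ] (x ^ (3 ℕ.^ j))

  tr-+ : ∀ x y → tr (x + y) ≡ tr x + tr y
  tr-+ x y = trans (∑-cong (upTo M) (λ j → ^3^-+ j x y)) (∑-+ (upTo M) _ _)

  tr-0 : tr 0# ≡ 0#
  tr-0 = trans (∑-cong (upTo M) (λ j → 0^n (0<3^ j))) (∑-0 (upTo M))

  tr-neg : ∀ x → tr (- x) ≡ - tr x
  tr-neg x = x∙y⁻¹≈ε⇒x≈y (tr (- x)) (- tr x) (begin
    tr (- x) - - tr x   ≡⟨ cong (tr (- x) +_) (-‿involutive (tr x)) ⟩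
    tr (- x) + tr x     ≡⟨ tr-+ (- x) x ⟨
    tr (- x + x)        ≡⟨ cong tr (-‿inverseˡ x) ⟩
    tr 0#               ≡⟨ tr-0 ⟩
    0#                  ∎)

  -- Cubing moves every index of the power sum up by one, and the two ends agree by x^q = x. The sum
  -- of M + 1 terms is split at both ends to express this.
  tr³ : ∀ x → tr x ^ 3 ≡ tr x
  tr³ x = +-cancelˡ (x ^ 1) _ _ (begin
    x ^ 1 + tr x ^ 3
      ≡⟨ cong (x ^ 1 +_) (trans (^3^-∑ 1 (upTo M) _) (∑-cong (upTo M) λ j → sym (^3^-suc x j))) ⟩
    x ^ 1 + ∑[ j ← upTo M ] (x ^ (3 ℕ.^ suc j))
      ≡⟨ ∑-upTo-suc M (λ j → x ^ (3 ℕ.^ j)) ⟨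
    ∑[ j ← upTo (suc M) ] (x ^ (3 ℕ.^ j))
      ≡⟨ ∑-upTo-last M (λ j → x ^ (3 ℕ.^ j)) ⟩
    tr x + x ^ (3 ℕ.^ M)
      ≡⟨ cong (tr x +_) (trans (cong (x ^_) (sym order)) (trans (x^q≡x x) (sym (*-identityʳ x)))) ⟩
    tr x + x ^ 1
      ≡⟨ +-comm _ _ ⟩
    x ^ 1 + tr x ∎)

  data Trit : A → Set where
    t0 : Trit 0#
    t1 : Trit 1#
    t2 : Trit (- 1#)

  -- From the factorization t (t - 1) (t + 1) of t³ - t.
  trit : ∀ t → t ^ 3 ≡ t → Trit t
  trit t e = Sum.[ (λ e → subst Trit (sym e) t0) ,
      (λ e → Sum.[ (λ e → subst Trit (sym (x∙y⁻¹≈ε⇒x≈y t 1# e)) t1)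
                 , (λ e → subst Trit (sym (x∙y⁻¹≈ε⇒x≈y t (- 1#) e)) t2) ]′ (x*y≡0 e)) ]′
    (x*y≡0 {t} {(t - 1#) * (t - - 1#)} (begin
      t * ((t - 1#) * (t - - 1#))
        ≡⟨ solve 1 (λ t → t :* ((t :- con (ℤ.+ 1)) :* (t :- :- con (ℤ.+ 1))) := t :* (t :* (t :* con (ℤ.+ 1))) :- t) refl t ⟩
      t ^ 3 - t   ≡⟨ cong (_- t) e ⟩
      t - t       ≡⟨ -‿inverseʳ t ⟩
      0#          ∎))

  trit-tr : ∀ x → Trit (tr x)
  trit-tr x = trit (tr x) (tr³ x)

  1+1≡-1 : 1# + 1# ≡ - 1#
  1+1≡-1 = x∙y⁻¹≈ε⇒x≈y (1# + 1#) (- 1#) (trans (cong (1# + 1# +_) (-‿involutive 1#)) 1+1+1≡0)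

  -1-1≡1 : - 1# + - 1# ≡ 1#
  -1-1≡1 = x∙y⁻¹≈ε⇒x≈y (- 1# + - 1#) 1# (trans (solve 0 (:- con (ℤ.+ 1) :+ :- con (ℤ.+ 1) :- con (ℤ.+ 1) :=
    :- (con (ℤ.+ 1) :+ con (ℤ.+ 1) :+ con (ℤ.+ 1))) refl)
    (trans (cong -_ 1+1+1≡0) (solve 0 (:- con (ℤ.+ 0) := con (ℤ.+ 0)) refl)))

  -1≢0 : - 1# ≢ 0#
  -1≢0 e = 1≢0 (trans (sym -1-1≡1) (trans (cong₂ _+_ e e) (+-identityˡ 0#)))

  -1≢1 : - 1# ≢ 1#
  -1≢1 e = 1≢0 (+-cancelˡ 1# 1# 0# (trans (trans 1+1≡-1 e) (sym (+-identityʳ 1#))))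

  -- Repeats the case distinction of `ω^_`, so that in the return to the given fields only the
  -- arguments have to be compared.
  ζ : A → ℤ[ω]
  ζ t = if does (t ≟ 0#) then ℤω.1# else if does (t ≟ 1#) then ℤω.ω else ℤω.ω ℤω.^ 2

  ζ-0 : ζ 0# ≡ ℤω.1#
  ζ-0 with 0# ≟ 0#
  ... | yes _ = refl
  ... | no ne = contradiction refl ne

  ζ-1 : ζ 1# ≡ ℤω.ω
  ζ-1 with 1# ≟ 0# | 1# ≟ 1#
  ... | yes e | _     = contradiction e 1≢0
  ... | no _  | yes _ = refl
  ... | no _  | no ne = contradiction refl ne

  ζ-2 : ζ (- 1#) ≡ ℤω.ω ℤω.^ 2
  ζ-2 with - 1# ≟ 0# | - 1# ≟ 1#
  ... | yes e | _     = contradiction e -1≢0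
  ... | no _  | yes e = contradiction e -1≢1
  ... | no _  | no _  = refl

  ζ-+ : ∀ {t u} → Trit t → Trit u → ζ (t + u) ≡ ζ t ℤω.* ζ u
  ζ-+ {u = u} t0 _ = trans (cong ζ (+-identityˡ u)) (sym (trans (cong (ℤω._* ζ u) ζ-0) (ℤω.*-identityˡ (ζ u))))
  ζ-+ {t = t} _ t0 = trans (cong ζ (+-identityʳ t)) (sym (trans (cong (ζ t ℤω.*_) ζ-0) (ℤω.*-identityʳ (ζ t))))
  ζ-+ t1 t1 = trans (trans (cong ζ 1+1≡-1) ζ-2) (sym (cong₂ ℤω._*_ ζ-1 ζ-1))
  ζ-+ t1 t2 = trans (trans (cong ζ (-‿inverseʳ 1#)) ζ-0) (sym (cong₂ ℤω._*_ ζ-1 ζ-2))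
  ζ-+ t2 t1 = trans (trans (cong ζ (-‿inverseˡ 1#)) ζ-0) (sym (cong₂ ℤω._*_ ζ-2 ζ-1))
  ζ-+ t2 t2 = trans (trans (cong ζ -1-1≡1) ζ-1) (sym (cong₂ ℤω._*_ ζ-2 ζ-2))

  ψ : A → ℤ[ω]
  ψ x = ζ (tr x)

  ψ-+ : ∀ x y → ψ (x + y) ≡ ψ x ℤω.* ψ y
  ψ-+ x y = trans (cong ζ (tr-+ x y)) (ζ-+ (trit-tr x) (trit-tr y))

  ψ-0 : ψ 0# ≡ ℤω.1#
  ψ-0 = trans (cong ζ tr-0) ζ-0

  ψ-⋆ : ∀ k x → ψ (k ⋆ x) ≡ ψ x ℤω.^ k
  ψ-⋆ zero    x = ψ-0
  ψ-⋆ (suc k) x = trans (ψ-+ x (k ⋆ x)) (cong (ψ x ℤω.*_) (ψ-⋆ k x))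

  M′ : ℕ
  M′ = pred M

  M≡ : M ≡ suc M′
  M≡ = sym (ℕ.suc-pred M ⦃ ℕ.>-nonZero 0<M ⦄)

  q≡3*3^M′ : q ≡ 3 ℕ.* 3 ℕ.^ M′
  q≡3*3^M′ = trans order (cong (3 ℕ.^_) M≡)

  3≤q : 3 ≤ q
  3≤q = subst (3 ≤_) (sym q≡3*3^M′) (ℕ.m≤m*n 3 (3 ℕ.^ M′) ⦃ ℕ.>-nonZero (0<3^ M′) ⦄)

  3^M′<q : 3 ℕ.^ M′ < q
  3^M′<q = subst (3 ℕ.^ M′ <_) (sym q≡3*3^M′)
    (ℕ.m<m+n (3 ℕ.^ M′) (ℕ.≤-trans (0<3^ M′) (ℕ.m≤m+n _ _)))

  tr-split : ∀ x → tr x ≡ ∑[ j ← upTo M′ ] (x ^ (3 ℕ.^ j)) + x ^ (3 ℕ.^ M′)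
  tr-split x = trans (cong (λ k → ∑[ j ← upTo k ] (x ^ (3 ℕ.^ j))) M≡) (∑-upTo-last M′ (λ j → x ^ (3 ℕ.^ j)))

  3^<3^M′ : ∀ {j} → j ∈ upTo M′ → 3 ℕ.^ j < 3 ℕ.^ M′
  3^<3^M′ j∈ = ℕ.^-monoʳ-< 3 (s≤s (s≤s z≤n)) (∈.∈-upTo⁻ j∈)

  -- The trace is a monic polynomial of degree 3^M′ = q/3, too small to vanish everywhere.
  tr-nonzero : ∃ λ u → tr u ≢ 0#
  tr-nonzero = let u , ne = nonroot (low-∑ (upTo M′) (λ j x → 1# * x ^ (3 ℕ.^ j)) (λ j∈ → low-monomial 1# (3^<3^M′ j∈))) 3^M′<q in
    u , λ e → ne (trans (+-congʳ (∑-cong (upTo M′) λ j → *-identityˡ _)) (trans (sym (tr-split u)) e))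

  infix 9 _⁻¹
  _⁻¹ : A → A
  x ⁻¹ = x ^ (q ∸ 2)

  x*x⁻¹ : ∀ {x} → x ≢ 0# → x * x ⁻¹ ≡ 1#
  x*x⁻¹ {x} x≢0 = trans (cong (x ^_) lemma) (x^|nonzero| x≢0)
    where
    lemma : suc (q ∸ 2) ≡ length nonzero
    lemma = trans (sym (ℕ.+-∸-assoc 1 (ℕ.≤-trans (ℕ.n≤1+n 2) 3≤q))) (cong (_∸ 1) q≡1+|nonzero|)

  0⁻¹ : 0# ⁻¹ ≡ 0#
  0⁻¹ = 0^n (ℕ.m<n⇒0<n∸m 3≤q)

  -- Multiplied by x^(3^M′+1), the trace becomes a monic polynomial of degree
  -- 2·3^M′+1 < q; this is where 2 ≤ M is needed.
  tr-kloosterman-nonzero : 2 ≤ M → ∀ a → ∃ λ x → tr (x + a * x ⁻¹) ≢ 0#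
  tr-kloosterman-nonzero 2≤M a = let x , ne = nonroot {suc (D ℕ.+ D)} low 2D+1<q in x , λ e → ne (lemma x e)
    where
    D = 3 ℕ.^ M′
    -- Since q = 3D, this says 1 < D, and M ≥ 2 gives D ≥ 3.
    2D+1<q : suc (D ℕ.+ D) < q
    2D+1<q = subst (suc (D ℕ.+ D) <_) (sym (trans q≡3*3^M′ (cong (λ z → D ℕ.+ z) (cong (D ℕ.+_) (ℕ.+-identityʳ D)))))
      (subst (_≤ D ℕ.+ (D ℕ.+ D)) (ℕ.+-comm (D ℕ.+ D) 2 ) (subst (D ℕ.+ D ℕ.+ 2 ≤_) (ℕ.+-comm (D ℕ.+ D) D)
        (ℕ.+-monoʳ-≤ (D ℕ.+ D) (ℕ.≤-trans (ℕ.n≤1+n 2)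
          (ℕ.^-monoʳ-≤ 3 {1} {M′} (ℕ.s≤s⁻¹ (subst (2 ≤_) M≡ 2≤M)))))))
    -- The multiplier is x^(D+1) and not x^D, which would already clear the denominators: the
    -- additional factor makes 0 a root, in accordance with the trace 0 at x = 0. Otherwise the
    -- nonroot found might be 0. The leading term x^(2D+1) comes from j = M′ in the trace of x.
    lower : A → A
    lower x = ∑[ j ← upTo M′ ] (1# * x ^ suc (3 ℕ.^ j ℕ.+ D)) + ∑[ j ← upTo M ] (a ^ (3 ℕ.^ j) * x ^ suc (D ∸ 3 ℕ.^ j))
    low : LowDegree (suc (D ℕ.+ D)) lower
    low = low-+ (low-∑ (upTo M′) (λ j x → 1# * x ^ suc (3 ℕ.^ j ℕ.+ D))
                   (λ j∈ → low-monomial 1# (s≤s (ℕ.+-monoˡ-< D (3^<3^M′ j∈)))))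
                (low-∑ (upTo M) (λ j x → a ^ (3 ℕ.^ j) * x ^ suc (D ∸ 3 ℕ.^ j))
                   (λ {j} _ → low-monomial _ (s≤s (ℕ.≤-<-trans (ℕ.m∸n≤m D (3 ℕ.^ j)) (ℕ.m<m+n D (0<3^ M′))))))
    lemma : ∀ x → tr (x + a * x ⁻¹) ≡ 0# → lower x + x ^ suc (D ℕ.+ D) ≡ 0#
    lemma x e with x ≟ 0#
    ... | yes refl = trans (cong₂ _+_ (cong₂ _+_
        (trans (∑-cong (upTo M′) (λ j → trans (*-identityˡ _) (zeroˡ _))) (∑-0 (upTo M′)))
        (trans (∑-cong (upTo M) (λ j → trans (*-congˡ (zeroˡ _)) (zeroʳ _))) (∑-0 (upTo M)))) (zeroˡ _))
        (trans (+-identityʳ _) (+-identityʳ _))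
    ... | no x≢0 = begin
      lower x + x ^ suc (D ℕ.+ D)
        ≡⟨ cong₂ _+_ (cong₂ _+_
             (trans (∑-cong (upTo M′) (λ j → trans (*-identityˡ _) (shift (3 ℕ.^ j)))) (∑-*ˡ (upTo M′) _ _))
             (trans (∑-cong∈ (upTo M) unshift) (∑-*ˡ (upTo M) _ _)))
             (shift D) ⟩
      x ^ suc D * ∑[ j ← upTo M′ ] (x ^ (3 ℕ.^ j)) + x ^ suc D * tr (a * x ⁻¹) + x ^ suc D * x ^ D
        ≡⟨ solve 4 (λ c u v w → c :* u :+ c :* v :+ c :* w := c :* ((u :+ w) :+ v)) refl
             (x ^ suc D) (∑[ j ← upTo M′ ] (x ^ (3 ℕ.^ j))) (tr (a * x ⁻¹)) (x ^ D) ⟩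
      x ^ suc D * (∑[ j ← upTo M′ ] (x ^ (3 ℕ.^ j)) + x ^ D + tr (a * x ⁻¹))
        ≡⟨ cong (λ z → x ^ suc D * (z + tr (a * x ⁻¹))) (tr-split x) ⟨
      x ^ suc D * (tr x + tr (a * x ⁻¹))
        ≡⟨ cong (x ^ suc D *_) (trans (sym (tr-+ x _)) e) ⟩
      x ^ suc D * 0#
        ≡⟨ zeroʳ _ ⟩
      0# ∎
      where
      shift : ∀ i → x ^ suc (i ℕ.+ D) ≡ x ^ suc D * x ^ i
      shift i = trans (cong (x ^_) (cong suc (ℕ.+-comm i D))) (^-homo-* x (suc D) i)
      x*x⁻¹^ : ∀ i → x ^ i * (x ⁻¹) ^ i ≡ 1#
      x*x⁻¹^ i = trans (sym (^-distrib-* x (x ⁻¹) i)) (trans (cong (_^ i) (x*x⁻¹ x≢0)) (1^n i))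
      unshift : ∀ {j} → j ∈ upTo M → a ^ (3 ℕ.^ j) * x ^ suc (D ∸ 3 ℕ.^ j) ≡ x ^ suc D * (a * x ⁻¹) ^ (3 ℕ.^ j)
      unshift {j} j∈ = sym (begin
        x ^ suc D * (a * x ⁻¹) ^ i
          ≡⟨ cong₂ _*_ (cong (x ^_) (cong suc (sym (ℕ.m∸n+n≡m i≤D)))) (^-distrib-* a (x ⁻¹) i) ⟩
        x ^ (suc (D ∸ i) ℕ.+ i) * (a ^ i * (x ⁻¹) ^ i)
          ≡⟨ cong (_* (a ^ i * (x ⁻¹) ^ i)) (^-homo-* x (suc (D ∸ i)) i) ⟩
        x ^ suc (D ∸ i) * x ^ i * (a ^ i * (x ⁻¹) ^ i)
          ≡⟨ solve 4 (λ u v w z → u :* v :* (w :* z) := w :* u :* (v :* z)) refl (x ^ suc (D ∸ i)) (x ^ i) (a ^ i) ((x ⁻¹) ^ i) ⟩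
        a ^ i * x ^ suc (D ∸ i) * (x ^ i * (x ⁻¹) ^ i)
          ≡⟨ trans (cong (a ^ i * x ^ suc (D ∸ i) *_) (x*x⁻¹^ i)) (*-identityʳ _) ⟩
        a ^ i * x ^ suc (D ∸ i) ∎)
        where
        i = 3 ℕ.^ j
        i≤D : i ≤ D
        i≤D = ℕ.^-monoʳ-≤ 3 (ℕ.s≤s⁻¹ (subst (suc j ≤_) M≡ (∈.∈-upTo⁻ j∈)))

-- The L-function of a Kloosterman sum

module KloostermanCharacter {A : Set} (K : DiscreteField A) (enum : Enumeration A)
    (M : ℕ) (0<M : 0 < M) (order : length (Enumeration.elements enum) ≡ 3 ℕ.^ M) where
  open Ternary K enum M 0<M order public
  open Polynomials K using (addMultiple; _·_; length-addMultiple; length-≤-·; length-·)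
  open Factorization K enum using (monics; ∈-monics⁻)
  open ≡.≡-Reasoning
  private module S = IntegerCoefficientSolver commutativeRing
  open S using (solve; con; _:+_; _:*_; _:=_; :-_; _:-_)

  -- Translation by u with nonzero trace gives w S = S for a cube root of unity w ≠ 1. Instead of
  -- cancelling w - 1, the relation 1 + w + w² = 0 turns this into 3S = 0.
  sum-ψ : ℤω.∑ elements ψ ≡ ℤω.0#
  sum-ψ = 3S≡0⇒S≡0 S (vanish (trit-tr u) (proj₂ tr-nonzero) (begin
      ψ u ℤω.* S                            ≡⟨ ℤω.∑-*ˡ elements (ψ u) ψ ⟨
      ℤω.∑ elements (λ x → ψ u ℤω.* ψ x)    ≡⟨ ℤω.∑-cong elements (λ x → sym (ψ-+ u x)) ⟩
      ℤω.∑ elements (λ x → ψ (u + x))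
        ≡⟨ ℤω.∑-reindex _≟_ _≟_ unique unique (u +_) (_- u) (λ _ → complete _) (λ _ → complete _)
             (λ {x} _ → solve 2 (λ u x → u :+ x :- u := x) refl u x) (λ {x} _ → solve 2 (λ u x → u :+ (x :- u) := x) refl u x) ψ ⟩
      S                                     ∎))
    where
    u = proj₁ tr-nonzero
    S = ℤω.∑ elements ψ
    unity : ∀ w → ℤω.1# ℤω.+ w ℤω.+ w ℤω.* w ≡ ℤω.0# → w ℤω.* S ≡ S → S ℤω.+ S ℤω.+ S ≡ ℤω.0#
    unity w 1+w+w²≡0 e = begin
      S ℤω.+ S ℤω.+ S
        ≡⟨ cong₂ (λ x y → S ℤω.+ x ℤω.+ y) (sym e) (trans (sym e) (cong (w ℤω.*_) (sym e))) ⟩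
      S ℤω.+ w ℤω.* S ℤω.+ w ℤω.* (w ℤω.* S)
        ≡⟨ Sω.solve 2 (λ w s → s Sω.:+ w Sω.:* s Sω.:+ w Sω.:* (w Sω.:* s)
             Sω.:= (Sω.con 1ℤ Sω.:+ w Sω.:+ w Sω.:* w) Sω.:* s) refl w S ⟩
      (ℤω.1# ℤω.+ w ℤω.+ w ℤω.* w) ℤω.* S
        ≡⟨ cong (ℤω._* S) 1+w+w²≡0 ⟩
      ℤω.0# ℤω.* S
        ≡⟨ ℤω.zeroˡ S ⟩
      ℤω.0# ∎
    vanish : ∀ {t} → Trit t → t ≢ 0# → ζ t ℤω.* S ≡ S → S ℤω.+ S ℤω.+ S ≡ ℤω.0#
    vanish t0 ne _ = contradiction refl ne
    vanish t1 _  e = unity ℤω.ω refl (trans (cong (ℤω._* S) (sym ζ-1)) e)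
    vanish t2 _  e = unity (ℤω.ω ℤω.^ 2) refl (trans (cong (ℤω._* S) (sym ζ-2)) e)
    3i≡0 : ∀ i → i ℤ.+ i ℤ.+ i ≡ 0ℤ → i ≡ 0ℤ
    3i≡0 i e = ℤ.*-cancelˡ-≡ (ℤ.+ 3) i 0ℤ (trans (triple i) e)
      where
      triple : ∀ i → ℤ.+ 3 ℤ.* i ≡ i ℤ.+ i ℤ.+ i
      triple = solve-∀
    3S≡0⇒S≡0 : ∀ S → S ℤω.+ S ℤω.+ S ≡ ℤω.0# → S ≡ ℤω.0#
    3S≡0⇒S≡0 (a +ω b) e = cong₂ _+ω_ (3i≡0 a (cong re e)) (3i≡0 b (cong im e))

  sum-ψ-scaled : ∀ {y} → y ≢ 0# → ℤω.∑ elements (λ x → ψ (x * y)) ≡ ℤω.0#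
  sum-ψ-scaled {y} y≢0 = trans (ℤω.∑-reindex _≟_ _≟_ unique unique (_* y) (_* y ⁻¹) (λ _ → complete _) (λ _ → complete _)
    (λ {x} _ → trans (*-assoc x y _) (trans (cong (x *_) (x*x⁻¹ y≢0)) (*-identityʳ x)))
    (λ {x} _ → trans (*-assoc x _ y) (trans (cong (x *_) (trans (*-comm _ y) (x*x⁻¹ y≢0))) (*-identityʳ x))) ψ) sum-ψ

  -- The coefficients of 1, X and X^(deg - 1), counting the implicit leading 1: thus `c₁ (c ∷ [])`
  -- is 1. The values at `[]` are those that make the product rules below hold.
  c₀ c₁ top : List A → A
  c₀ []      = 1#
  c₀ (c ∷ _) = c

  c₁ []      = 0#
  c₁ (c ∷ f) = c₀ f

  top []            = 0#
  top (c ∷ [])      = c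
  top (c ∷ d ∷ f)   = top (d ∷ f)

  top-∷ : ∀ c f → 0 < length f → top (c ∷ f) ≡ top f
  top-∷ c (_ ∷ _) _ = refl

  c₀-addMultiple : ∀ c g h → length g < length h → c₀ (addMultiple c g h) ≡ c₀ h + c * c₀ g
  c₀-addMultiple c []      (b ∷ h) _ = cong (b +_) (sym (*-identityʳ c))
  c₀-addMultiple c (a ∷ g) (b ∷ h) _ = refl

  c₁-addMultiple : ∀ c g h → length g < length h → c₁ (addMultiple c g h) ≡ c₁ h + c * c₁ g
  c₁-addMultiple c []      (b ∷ h) _        = sym (trans (cong (c₀ h +_) (zeroʳ c)) (+-identityʳ _))
  c₁-addMultiple c (a ∷ g) (b ∷ h) (s≤s lt) = c₀-addMultiple c g h lt

  top-addMultiple : ∀ c g h → length h ≡ suc (length g) → top (addMultiple c g h) ≡ top h + c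
  top-addMultiple c []      (b ∷ []) _ = refl
  top-addMultiple c (a ∷ g) (b ∷ h)  e = trans (top-∷ _ (addMultiple c g h) (subst (0 <_) (sym (length-addMultiple c g h)) 0<|h|))
    (trans (top-addMultiple c g h (ℕ.suc-injective e)) (cong (_+ c) (sym (top-∷ b h 0<|h|))))
    where
    0<|h| : 0 < length h
    0<|h| = subst (0 <_) (sym (ℕ.suc-injective e)) (s≤s z≤n)

  top-addMultiple-< : ∀ c g h → suc (length g) < length h → top (addMultiple c g h) ≡ top h
  top-addMultiple-< c []      (b ∷ [])     (s≤s ())
  top-addMultiple-< c []      (b ∷ b′ ∷ h) _ = refl
  top-addMultiple-< c (a ∷ g) (b ∷ h) (s≤s lt) = trans (top-∷ _ (addMultiple c g h) (subst (0 <_) (sym (length-addMultiple c g h)) 0<|h|))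
    (trans (top-addMultiple-< c g h lt) (sym (top-∷ b h 0<|h|)))
    where
    0<|h| : 0 < length h
    0<|h| = ℕ.≤-trans (s≤s z≤n) lt

  c₀-· : ∀ f g → c₀ (f · g) ≡ c₀ f * c₀ g
  c₀-· []      g = sym (*-identityˡ _)
  c₀-· (c ∷ f) g = trans (c₀-addMultiple c g (0# ∷ f · g) (s≤s (length-≤-· f g))) (+-identityˡ _)

  -- With `c₀-·` this makes c₁ / c₀, the logarithmic derivative at 0, additive on products; it is
  -- the sum of the reciprocals of the negated roots.
  c₁-· : ∀ f g → c₁ (f · g) ≡ c₁ f * c₀ g + c₀ f * c₁ g
  c₁-· []      g = solve 2 (λ x y → x := con (ℤ.+ 0) :* y :+ con (ℤ.+ 1) :* x) refl (c₁ g) (c₀ g)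
  c₁-· (c ∷ f) g = trans (c₁-addMultiple c g (0# ∷ f · g) (s≤s (length-≤-· f g))) (cong (_+ c * c₁ g) (c₀-· f g))

  -- In X (f g) + c g the summand c g reaches the subleading coefficient only for f = 1, whence the
  -- separate case of a linear first factor.
  top-· : ∀ f g → top (f · g) ≡ top f + top g
  top-· []      g = sym (+-identityˡ _)
  top-· (c ∷ []) g = trans (top-addMultiple c g (0# ∷ g) refl) (trans (+-comm _ c) (cong (c +_) (top-0∷ g)))
    where
    top-0∷ : ∀ g → top (0# ∷ g) ≡ top g
    top-0∷ []      = refl
    top-0∷ (_ ∷ _) = refl
  top-· (c ∷ f@(_ ∷ f′)) g = trans (top-addMultiple-< c g (0# ∷ f · g) (s≤s |g|<))
    (trans (top-∷ 0# (f · g) (ℕ.≤-trans (s≤s z≤n) |g|<)) (top-· f g))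
    where
    |g|< : suc (length g) ≤ length (f · g)
    |g|< = subst (suc (length g) ≤_) (sym (length-· f g)) (s≤s (ℕ.m≤n+m _ _))

  δ : A → ℤ[ω]
  δ x = ℤω.[ ¬? (x ≟ 0#) ]

  δ-0 : δ 0# ≡ ℤω.0#
  δ-0 = ℤω.[]-no (¬? (0# ≟ 0#)) (λ ne → ne refl)

  δ-≢0 : ∀ {x} → x ≢ 0# → δ x ≡ ℤω.1#
  δ-≢0 {x} = ℤω.[]-yes (¬? (x ≟ 0#))

  module _ (a : A) (a≢0 : a ≢ 0#) where

    -- The sum of x + a/x over the negatives x of the roots of f.
    φ : List A → A
    φ f = top f + a * (c₁ f * c₀ f ⁻¹)

    -- The factor `δ` removes the multiples of X, where a/x has its pole. The term x = 0 of a
    -- Kloosterman sum is therefore invisible to χ and reappears as an added 1.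
    χ : List A → ℤ[ω]
    χ f = δ (c₀ f) ℤω.* ψ (φ f)

    φ-· : ∀ f g → c₀ f ≢ 0# → c₀ g ≢ 0# → φ (f · g) ≡ φ f + φ g
    φ-· f g f≢0 g≢0 = begin
      top (f · g) + a * (c₁ (f · g) * c₀ (f · g) ⁻¹)
        ≡⟨ cong₂ _+_ (top-· f g) (cong (a *_) (cong₂ _*_ (c₁-· f g)
             (trans (cong _⁻¹ (c₀-· f g)) (^-distrib-* (c₀ f) (c₀ g) (q ∸ 2))))) ⟩
      top f + top g + a * ((c₁ f * c₀ g + c₀ f * c₁ g) * (c₀ f ⁻¹ * c₀ g ⁻¹))
        ≡⟨ solve 9 (λ t u a x₁ x₀ y₁ y₀ x′ y′ → t :+ u :+ a :* ((x₁ :* y₀ :+ x₀ :* y₁) :* (x′ :* y′)) :=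
             t :+ u :+ a :* (x₁ :* x′ :* (y₀ :* y′) :+ y₁ :* y′ :* (x₀ :* x′))) refl
             (top f) (top g) a (c₁ f) (c₀ f) (c₁ g) (c₀ g) (c₀ f ⁻¹) (c₀ g ⁻¹) ⟩
      top f + top g + a * (c₁ f * c₀ f ⁻¹ * (c₀ g * c₀ g ⁻¹) + c₁ g * c₀ g ⁻¹ * (c₀ f * c₀ f ⁻¹))
        ≡⟨ cong₂ (λ x y → top f + top g + a * (c₁ f * c₀ f ⁻¹ * y + c₁ g * c₀ g ⁻¹ * x)) (x*x⁻¹ f≢0) (x*x⁻¹ g≢0) ⟩
      top f + top g + a * (c₁ f * c₀ f ⁻¹ * 1# + c₁ g * c₀ g ⁻¹ * 1#)
        ≡⟨ solve 5 (λ t u a x y → t :+ u :+ a :* (x :* con (ℤ.+ 1) :+ y :* con (ℤ.+ 1)) := t :+ a :* x :+ (u :+ a :* y)) refl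
             (top f) (top g) a (c₁ f * c₀ f ⁻¹) (c₁ g * c₀ g ⁻¹) ⟩
      φ f + φ g ∎

    χ-zero : ∀ f → c₀ f ≡ 0# → χ f ≡ ℤω.0#
    χ-zero f e = trans (cong (ℤω._* ψ (φ f)) (trans (cong δ e) δ-0)) (ℤω.zeroˡ (ψ (φ f)))

    χ-nonzero : ∀ f → c₀ f ≢ 0# → χ f ≡ ψ (φ f)
    χ-nonzero f ne = trans (cong (ℤω._* ψ (φ f)) (δ-≢0 ne)) (ℤω.*-identityˡ (ψ (φ f)))

    χ-· : ∀ f g → χ (f · g) ≡ χ f ℤω.* χ g
    χ-· f g = cases (c₀ f ≟ 0#) (c₀ g ≟ 0#)
      where
      cases : Dec (c₀ f ≡ 0#) → Dec (c₀ g ≡ 0#) → χ (f · g) ≡ χ f ℤω.* χ g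
      cases (yes e) _ = trans (χ-zero (f · g) (trans (c₀-· f g) (trans (cong (_* c₀ g) e) (zeroˡ _))))
        (sym (trans (cong (ℤω._* χ g) (χ-zero f e)) (ℤω.zeroˡ (χ g))))
      cases (no _) (yes e) = trans (χ-zero (f · g) (trans (c₀-· f g) (trans (cong (c₀ f *_) e) (zeroʳ _))))
        (sym (trans (cong (χ f ℤω.*_) (χ-zero g e)) (ℤω.zeroʳ (χ f))))
      cases (no ne) (no ne′) = begin
        χ (f · g)                  ≡⟨ χ-nonzero (f · g) (λ e → x*y≢0 ne ne′ (trans (sym (c₀-· f g)) e)) ⟩
        ψ (φ (f · g))              ≡⟨ trans (cong ψ (φ-· f g ne ne′)) (ψ-+ (φ f) (φ g)) ⟩
        ψ (φ f) ℤω.* ψ (φ g)       ≡⟨ cong₂ ℤω._*_ (χ-nonzero f ne) (χ-nonzero g ne′) ⟨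
        χ f ℤω.* χ g               ∎

    χ-[] : χ [] ≡ ℤω.1#
    χ-[] = trans (χ-nonzero [] 1≢0) (trans (cong ψ (trans (cong (λ z → 0# + a * z) (zeroˡ _))
      (trans (+-identityˡ _) (zeroʳ a)))) ψ-0)

    open EulerProduct K enum ℤω.commutativeSemiring using (#_; coefficient; powerSum; newton; powerSum-0)

    Aₙ : ℕ → ℤ[ω]
    Aₙ = coefficient χ χ-[] χ-·

    kloosterman : ℤ[ω]
    kloosterman = ℤω.∑ elements (λ x → ψ (x + a * x ⁻¹))

    A₀ : Aₙ 0 ≡ ℤω.1#
    A₀ = trans (ℤω.+-identityʳ (χ [])) χ-[]

    A₁ : kloosterman ≡ Aₙ 1 ℤω.+ ℤω.1#
    A₁ = begin
      ℤω.∑ elements (λ x → ψ (x + a * x ⁻¹))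
        ≡⟨ ℤω.∑-cong elements split ⟩
      ℤω.∑ elements (λ x → (χ (x ∷ []) ℤω.+ ℤω.0#) ℤω.+ ℤω.[ x ≟ 0# ])
        ≡⟨ ℤω.∑-+ elements _ _ ⟩
      ℤω.∑ elements (λ x → ℤω.∑ (monics 0) (λ f → χ (x ∷ f))) ℤω.+ ℤω.∑ elements (λ x → ℤω.[ x ≟ 0# ])
        ≡⟨ cong₂ ℤω._+_ (sym (ℤω.∑-product _∷_ elements (monics 0) χ)) (ℤω.∑-δ1 _≟_ unique (complete 0#)) ⟩
      Aₙ 1 ℤω.+ ℤω.1# ∎
      where
      split : ∀ x → ψ (x + a * x ⁻¹) ≡ (χ (x ∷ []) ℤω.+ ℤω.0#) ℤω.+ ℤω.[ x ≟ 0# ]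
      split x = cases (x ≟ 0#)
        where
        cases : (d : Dec (x ≡ 0#)) → ψ (x + a * x ⁻¹) ≡ (χ (x ∷ []) ℤω.+ ℤω.0#) ℤω.+ ℤω.[ d ]
        cases (yes refl) = trans (trans (cong ψ (trans (+-identityˡ _) (trans (cong (a *_) 0⁻¹) (zeroʳ a)))) ψ-0)
          (sym (cong (λ z → z ℤω.+ ℤω.0# ℤω.+ ℤω.1#) (χ-zero (0# ∷ []) refl)))
        cases (no x≢0) = sym (trans (ℤω.+-identityʳ _) (trans (ℤω.+-identityʳ _) (trans (χ-nonzero (x ∷ []) x≢0)
          (cong (λ z → ψ (x + a * z)) (*-identityˡ _)))))

    const-sum : ∀ (xs : List A) → ℤω.∑ xs (λ _ → ℤω.1#) ≡ # length xs
    const-sum []       = refl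
    const-sum (x ∷ xs) = cong (ℤω.1# ℤω.+_) (const-sum xs)

    -- At X² + bX + c with c ≠ 0 the character is ψ(b (1 + a/c)). The sum over b is q if c = -a and
    -- zero otherwise.
    A₂ : Aₙ 2 ≡ # q
    A₂ = begin
      Aₙ 2
        ≡⟨ ℤω.∑-product _∷_ elements (monics 1) χ ⟩
      ℤω.∑ elements (λ c → ℤω.∑ (monics 1) (λ f → χ (c ∷ f)))
        ≡⟨ ℤω.∑-cong elements inner ⟩
      ℤω.∑ elements (λ c → ℤω.[ c ≟ - a ] ℤω.* # q)
        ≡⟨ ℤω.∑-δ _≟_ (λ _ → # q) unique (complete (- a)) ⟩
      # q ∎
      where
      -a≢0 : - a ≢ 0#
      -a≢0 e = a≢0 (trans (sym (-‿involutive a)) (trans (cong -_ e) (solve 0 (:- con (ℤ.+ 0) := con (ℤ.+ 0)) refl)))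
      φ₂ : ∀ c b → φ (c ∷ b ∷ []) ≡ b * (1# + a * c ⁻¹)
      φ₂ c b = solve 3 (λ a b d → b :+ a :* (b :* d) := b :* (con (ℤ.+ 1) :+ a :* d)) refl a b (c ⁻¹)
      inner : ∀ c → ℤω.∑ (monics 1) (λ f → χ (c ∷ f)) ≡ ℤω.[ c ≟ - a ] ℤω.* # q
      inner c = begin
        ℤω.∑ (monics 1) (λ f → χ (c ∷ f))
          ≡⟨ ℤω.∑-product _∷_ elements (monics 0) (λ f → χ (c ∷ f)) ⟩
        ℤω.∑ elements (λ b → χ (c ∷ b ∷ []) ℤω.+ ℤω.0#)
          ≡⟨ ℤω.∑-cong elements (λ b → ℤω.+-identityʳ _) ⟩
        ℤω.∑ elements (λ b → χ (c ∷ b ∷ []))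
          ≡⟨ cases (c ≟ 0#) (c ≟ - a) ⟩
        ℤω.[ c ≟ - a ] ℤω.* # q ∎
        where
        cases : Dec (c ≡ 0#) → (d : Dec (c ≡ - a)) → ℤω.∑ elements (λ b → χ (c ∷ b ∷ [])) ≡ ℤω.[ d ] ℤω.* # q
        cases (yes c≡0) (yes c≡-a) = contradiction (trans (sym c≡-a) c≡0) -a≢0
        cases (yes c≡0) (no _) = trans (ℤω.∑-cong elements (λ b → χ-zero (c ∷ b ∷ []) c≡0))
          (trans (ℤω.∑-0 elements) (sym (ℤω.zeroˡ (# q))))
        cases (no c≢0) (yes c≡-a) = trans (ℤω.∑-cong elements (λ b → trans (χ-nonzero (c ∷ b ∷ []) c≢0)
          (trans (cong ψ (trans (φ₂ c b) (trans (cong (b *_) vanishes) (zeroʳ b)))) ψ-0)))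
          (trans (const-sum elements) (sym (ℤω.*-identityˡ (# q))))
          where
          vanishes : 1# + a * c ⁻¹ ≡ 0#
          vanishes = trans (cong₂ _+_ (sym (x*x⁻¹ c≢0)) (cong (_* c ⁻¹) (trans (sym (-‿involutive a)) (cong -_ (sym c≡-a)))))
            (solve 2 (λ c d → c :* d :+ :- c :* d := con (ℤ.+ 0)) refl c (c ⁻¹))
        cases (no c≢0) (no c≢-a) = trans (ℤω.∑-cong elements (λ b → trans (χ-nonzero (c ∷ b ∷ []) c≢0)
          (cong ψ (φ₂ c b)))) (trans (sum-ψ-scaled nonvanishing) (sym (ℤω.zeroˡ (# q))))
          where
          nonvanishing : 1# + a * c ⁻¹ ≢ 0#
          nonvanishing e = c≢-a (x∙y⁻¹≈ε⇒x≈y c (- a) (begin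
            c - - a                  ≡⟨ cong (c +_) (-‿involutive a) ⟩
            c + a                    ≡⟨ cong (c +_) (trans (cong (a *_) (x*x⁻¹ c≢0)) (*-identityʳ a)) ⟨
            c + a * (c * c ⁻¹)       ≡⟨ solve 3 (λ a c d → c :+ a :* (c :* d) := c :* (con (ℤ.+ 1) :+ a :* d)) refl a c (c ⁻¹) ⟩
            c * (1# + a * c ⁻¹)      ≡⟨ trans (cong (c *_) e) (zeroʳ c) ⟩
            0#                       ∎))

    sum-top : ∀ k → ℤω.∑ (monics (suc k)) (λ f → ψ (top f)) ≡ ℤω.0#
    sum-top zero = trans (ℤω.∑-product _∷_ elements (monics 0) (λ f → ψ (top f)))
      (trans (ℤω.∑-cong elements (λ c → ℤω.+-identityʳ _)) sum-ψ)
    sum-top (suc k) = trans (ℤω.∑-product _∷_ elements (monics (suc k)) (λ f → ψ (top f)))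
      (trans (ℤω.∑-cong elements (λ c → trans (ℤω.∑-cong∈ (monics (suc k)) (λ {f} f∈ → cong ψ (top-∷ c f
          (subst (0 <_) (sym (∈-monics⁻ (suc k) f∈)) (s≤s z≤n))))) (sum-top k)))
        (ℤω.∑-0 elements))

    -- From degree 3 on, the subleading coefficient is independent of the two lowest ones, and it
    -- enters χ only through a factor ψ, whose sum over it is zero.
    A₃₊ : ∀ k → Aₙ (3 ℕ.+ k) ≡ ℤω.0#
    A₃₊ k = trans (ℤω.∑-product _∷_ elements (monics (2 ℕ.+ k)) χ)
      (trans (ℤω.∑-cong elements (λ c → trans (ℤω.∑-product _∷_ elements (monics (1 ℕ.+ k)) (λ f → χ (c ∷ f)))
        (trans (ℤω.∑-cong elements (λ b → inner c b)) (ℤω.∑-0 elements)))) (ℤω.∑-0 elements))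
      where
      inner : ∀ c b → ℤω.∑ (monics (1 ℕ.+ k)) (λ f → χ (c ∷ b ∷ f)) ≡ ℤω.0#
      inner c b = begin
        ℤω.∑ (monics (1 ℕ.+ k)) (λ f → χ (c ∷ b ∷ f))
          ≡⟨ ℤω.∑-cong∈ (monics (1 ℕ.+ k)) (λ {f} f∈ → begin
               δ c ℤω.* ψ (top (b ∷ f) + a * (b * c ⁻¹))
                 ≡⟨ cong (λ z → δ c ℤω.* ψ (z + a * (b * c ⁻¹))) (top-∷ b f (subst (0 <_) (sym (∈-monics⁻ (suc k) f∈)) (s≤s z≤n))) ⟩
               δ c ℤω.* ψ (top f + a * (b * c ⁻¹))
                 ≡⟨ cong (δ c ℤω.*_) (trans (cong ψ (+-comm _ _)) (ψ-+ _ (top f))) ⟩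
               δ c ℤω.* (ψ (a * (b * c ⁻¹)) ℤω.* ψ (top f))
                 ≡⟨ ℤω.*-assoc (δ c) (ψ (a * (b * c ⁻¹))) (ψ (top f)) ⟨
               δ c ℤω.* ψ (a * (b * c ⁻¹)) ℤω.* ψ (top f) ∎) ⟩
        ℤω.∑ (monics (1 ℕ.+ k)) (λ f → δ c ℤω.* ψ (a * (b * c ⁻¹)) ℤω.* ψ (top f))
          ≡⟨ ℤω.∑-*ˡ (monics (1 ℕ.+ k)) (δ c ℤω.* ψ (a * (b * c ⁻¹))) (λ f → ψ (top f)) ⟩
        δ c ℤω.* ψ (a * (b * c ⁻¹)) ℤω.* ℤω.∑ (monics (1 ℕ.+ k)) (λ f → ψ (top f))
          ≡⟨ cong (δ c ℤω.* ψ (a * (b * c ⁻¹)) ℤω.*_) (sum-top k) ⟩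
        δ c ℤω.* ψ (a * (b * c ⁻¹)) ℤω.* ℤω.0#
          ≡⟨ ℤω.zeroʳ (δ c ℤω.* ψ (a * (b * c ⁻¹))) ⟩
        ℤω.0# ∎

    S : ℕ → ℕ → ℤ[ω]
    S = powerSum χ χ-[] χ-·

    newton₁ : ∀ N → 1 ≤ N → Aₙ 1 ≡ S N 1
    newton₁ N 1≤N = begin
      Aₙ 1                                    ≡⟨ ℤω.*-identityˡ (Aₙ 1) ⟨
      # 1 ℤω.* Aₙ 1                           ≡⟨ newton χ χ-[] χ-· N 1 1≤N ⟩
      S N 0 ℤω.* Aₙ 1 ℤω.+ (S N 1 ℤω.* Aₙ 0 ℤω.+ ℤω.0#)
        ≡⟨ cong₂ (λ x y → x ℤω.* Aₙ 1 ℤω.+ (S N 1 ℤω.* y ℤω.+ ℤω.0#)) (powerSum-0 χ χ-[] χ-· N) A₀ ⟩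
      ℤω.0# ℤω.* Aₙ 1 ℤω.+ (S N 1 ℤω.* ℤω.1# ℤω.+ ℤω.0#)
        ≡⟨ Sω.solve 2 (λ a s → Sω.con 0ℤ Sω.:* a Sω.:+
             (s Sω.:* Sω.con 1ℤ Sω.:+ Sω.con 0ℤ) Sω.:= s) refl (Aₙ 1) (S N 1) ⟩
      S N 1 ∎

    newton₂ : ∀ N → 2 ≤ N → (ℤω.1# ℤω.+ ℤω.1#) ℤω.* # q ≡ S N 1 ℤω.* Aₙ 1 ℤω.+ S N 2
    newton₂ N 2≤N = begin
      (ℤω.1# ℤω.+ ℤω.1#) ℤω.* # q             ≡⟨ cong (# 2 ℤω.*_) A₂ ⟨
      # 2 ℤω.* Aₙ 2                           ≡⟨ newton χ χ-[] χ-· N 2 2≤N ⟩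
      S N 0 ℤω.* Aₙ 2 ℤω.+ (S N 1 ℤω.* Aₙ 1 ℤω.+ (S N 2 ℤω.* Aₙ 0 ℤω.+ ℤω.0#))
        ≡⟨ cong₂ (λ x y → x ℤω.* Aₙ 2 ℤω.+ (S N 1 ℤω.* Aₙ 1 ℤω.+ (S N 2 ℤω.* y ℤω.+ ℤω.0#))) (powerSum-0 χ χ-[] χ-· N) A₀ ⟩
      ℤω.0# ℤω.* Aₙ 2 ℤω.+ (S N 1 ℤω.* Aₙ 1 ℤω.+ (S N 2 ℤω.* ℤω.1# ℤω.+ ℤω.0#))
        ≡⟨ Sω.solve 3 (λ a u s → Sω.con 0ℤ Sω.:* a Sω.:+ (u Sω.:+
             (s Sω.:* Sω.con 1ℤ Sω.:+ Sω.con 0ℤ)) Sω.:= u Sω.:+ s)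
             refl (Aₙ 2) (S N 1 ℤω.* Aₙ 1) (S N 2) ⟩
      S N 1 ℤω.* Aₙ 1 ℤω.+ S N 2 ∎

    -- Only the three last indices meet a nonzero coefficient 1, `Aₙ 1` or q, and the coefficient on
    -- the left of Newton's identity is itself zero. This is the recurrence with characteristic
    -- polynomial X² + A₁ X + q.
    newton₃₊ : ∀ N k → 3 ℕ.+ k ≤ N →
               S N (1 ℕ.+ k) ℤω.* # q ℤω.+ S N (2 ℕ.+ k) ℤω.* Aₙ 1 ℤω.+ S N (3 ℕ.+ k) ≡ ℤω.0#
    newton₃₊ N k le = sym (begin
      ℤω.0#                             ≡⟨ ℤω.zeroʳ (# n) ⟨
      # n ℤω.* ℤω.0#                    ≡⟨ cong (# n ℤω.*_) (A₃₊ k) ⟨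
      # n ℤω.* Aₙ n                     ≡⟨ newton χ χ-[] χ-· N n le ⟩
      ℤω.∑ (upTo (4 ℕ.+ k)) term        ≡⟨ ℤω.∑-upTo-last (3 ℕ.+ k) term ⟩
      ℤω.∑ (upTo (3 ℕ.+ k)) term ℤω.+ term (3 ℕ.+ k)
        ≡⟨ cong (ℤω._+ term (3 ℕ.+ k)) (ℤω.∑-upTo-last (2 ℕ.+ k) term) ⟩
      ℤω.∑ (upTo (2 ℕ.+ k)) term ℤω.+ term (2 ℕ.+ k) ℤω.+ term (3 ℕ.+ k)
        ≡⟨ cong (λ z → z ℤω.+ term (2 ℕ.+ k) ℤω.+ term (3 ℕ.+ k)) (ℤω.∑-upTo-last (1 ℕ.+ k) term) ⟩
      ℤω.∑ (upTo (1 ℕ.+ k)) term ℤω.+ term (1 ℕ.+ k) ℤω.+ term (2 ℕ.+ k) ℤω.+ term (3 ℕ.+ k)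
        ≡⟨ cong₂ (λ x y → x ℤω.+ y ℤω.+ term (2 ℕ.+ k) ℤω.+ term (3 ℕ.+ k))
             (trans (ℤω.∑-cong∈ (upTo (1 ℕ.+ k)) early) (ℤω.∑-0 (upTo (1 ℕ.+ k))))
             (cong (S N (1 ℕ.+ k) ℤω.*_) (trans (cong Aₙ (ℕ.m+n∸n≡m 2 k)) A₂)) ⟩
      ℤω.0# ℤω.+ S N (1 ℕ.+ k) ℤω.* # q ℤω.+ term (2 ℕ.+ k) ℤω.+ term (3 ℕ.+ k)
        ≡⟨ cong₂ (λ x y → ℤω.0# ℤω.+ S N (1 ℕ.+ k) ℤω.* # q ℤω.+ S N (2 ℕ.+ k) ℤω.* Aₙ x ℤω.+ S N (3 ℕ.+ k) ℤω.* y)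
             (ℕ.m+n∸n≡m 1 k) (trans (cong Aₙ (ℕ.n∸n≡0 k)) A₀) ⟩
      ℤω.0# ℤω.+ S N (1 ℕ.+ k) ℤω.* # q ℤω.+ S N (2 ℕ.+ k) ℤω.* Aₙ 1 ℤω.+ S N (3 ℕ.+ k) ℤω.* ℤω.1#
        ≡⟨ Sω.solve 3 (λ u v w → Sω.con 0ℤ Sω.:+ u Sω.:+ v Sω.:+ w Sω.:* Sω.con 1ℤ
             Sω.:= u Sω.:+ v Sω.:+ w) refl (S N (1 ℕ.+ k) ℤω.* # q) (S N (2 ℕ.+ k) ℤω.* Aₙ 1) (S N (3 ℕ.+ k)) ⟩
      S N (1 ℕ.+ k) ℤω.* # q ℤω.+ S N (2 ℕ.+ k) ℤω.* Aₙ 1 ℤω.+ S N (3 ℕ.+ k) ∎)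
      where
      n = 3 ℕ.+ k
      term : ℕ → ℤ[ω]
      term i = S N i ℤω.* Aₙ (n ∸ i)
      early : ∀ {i} → i ∈ upTo (1 ℕ.+ k) → term i ≡ ℤω.0#
      early {i} i∈ = trans (cong (S N i ℤω.*_) (trans (cong Aₙ (ℕ.+-∸-assoc 3 (ℕ.s≤s⁻¹ (∈.∈-upTo⁻ i∈)))) (A₃₊ (k ∸ i))))
        (ℤω.zeroʳ (S N i))

-- Conjugates in an extension field

module Homomorphism {A B : Set} (K : DiscreteField A) (L : DiscreteField B) (h : A → B)
    (h-+ : ∀ x y → h (DiscreteField._+_ K x y) ≡ DiscreteField._+_ L (h x) (h y))
    (h-* : ∀ x y → h (DiscreteField._*_ K x y) ≡ DiscreteField._*_ L (h x) (h y))
    (h-1 : h (DiscreteField.1# K) ≡ DiscreteField.1# L) where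
  private
    module K where
      open FieldProperties K public
      open Polynomials K public using (_·_; addMultiple)
    module L where
      open FieldProperties L public
      open Polynomials L public using (_·_; addMultiple)
  open ≡.≡-Reasoning

  h-0 : h K.0# ≡ L.0#
  h-0 = L.+-cancelˡ (h K.0#) _ _ (trans (sym (h-+ K.0# K.0#)) (trans (cong h (K.+-identityˡ K.0#)) (sym (L.+-identityʳ _))))

  h-neg : ∀ x → h (K.- x) ≡ L.- h x
  h-neg x = L.+-cancelˡ (h x) _ _ (trans (sym (h-+ x (K.- x)))
    (trans (trans (cong h (K.-‿inverseʳ x)) h-0) (sym (L.-‿inverseʳ (h x)))))

  h-≢0 : ∀ {x} → x ≢ K.0# → h x ≢ L.0#
  h-≢0 {x} x≢0 hx≡0 = let x⁻¹ , e = K.inverse x x≢0 in L.1≢0 (begin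
    L.1#               ≡⟨ trans (cong h e) h-1 ⟨
    h (x K.* x⁻¹)      ≡⟨ h-* x x⁻¹ ⟩
    h x L.* h x⁻¹      ≡⟨ cong (L._* h x⁻¹) hx≡0 ⟩
    L.0# L.* h x⁻¹     ≡⟨ L.zeroˡ _ ⟩
    L.0#               ∎)

  h-injective : ∀ {x y} → h x ≡ h y → x ≡ y
  h-injective {x} {y} e = decidable-stable (x K.≟ y) λ x≢y →
    h-≢0 (x≢y ∘ K.x∙y⁻¹≈ε⇒x≈y x y) (trans (h-+ x (K.- y)) (trans (cong₂ L._+_ e (h-neg y)) (L.-‿inverseʳ (h y))))

  h-^ : ∀ x k → h (x K.^ k) ≡ h x L.^ k
  h-^ x zero    = h-1
  h-^ x (suc k) = trans (h-* x (x K.^ k)) (cong (h x L.*_) (h-^ x k))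

  h-⋆ : ∀ k x → h (k K.⋆ x) ≡ k L.⋆ h x
  h-⋆ zero    x = h-0
  h-⋆ (suc k) x = trans (h-+ x (k K.⋆ x)) (cong (h x L.+_) (h-⋆ k x))

  h-∑ : ∀ {C : Set} (xs : List C) f → h (K.∑ xs f) ≡ L.∑ xs (h ∘ f)
  h-∑ []       f = h-0
  h-∑ (x ∷ xs) f = trans (h-+ (f x) (K.∑ xs f)) (cong (h (f x) L.+_) (h-∑ xs f))

  map-addMultiple : ∀ c f g → map h (K.addMultiple c f g) ≡ L.addMultiple (h c) (map h f) (map h g)
  map-addMultiple c f       []      = refl
  map-addMultiple c []      (b ∷ g) = cong (_∷ map h g) (h-+ b c)
  map-addMultiple c (a ∷ f) (b ∷ g) = cong₂ _∷_ (trans (h-+ b _) (cong (h b L.+_) (h-* c a))) (map-addMultiple c f g)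

  map-· : ∀ f g → map h (f K.· g) ≡ map h f L.· map h g
  map-· []      g = refl
  map-· (c ∷ f) g = trans (map-addMultiple c g (K.0# ∷ f K.· g))
    (cong₂ (λ x y → L.addMultiple (h c) (map h g) (x ∷ y)) h-0 (map-· f g))

  h-eval : ∀ f x → h (K.eval f x) ≡ L.eval (map h f) (h x)
  h-eval []      x = h-1
  h-eval (c ∷ f) x = trans (h-+ c _) (cong (h c L.+_) (trans (h-* x _) (cong (h x L.*_) (h-eval f x))))

least : {P : ℕ → Set} → Unary.Decidable P → ∀ n → P n → ∃ λ d → P d × (∀ j → j < d → ¬ P j)
least P? n Pn with P? 0
... | yes P0 = 0 , P0 , λ _ ()
least P? zero    Pn | no ¬P0 = contradiction Pn ¬P0
least {P} P? (suc n) Pn | no ¬P0 = let d , Pd , min = least (λ k → P? (suc k)) n Pn in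
  suc d , Pd , λ { zero _ → ¬P0 ; (suc j) (s≤s lt) → min j lt }

module FieldExtension {A B : Set} (K : DiscreteField A) (enumK : Enumeration A) (L : DiscreteField B) (enumL : Enumeration B)
    (m n : ℕ) (0<m : 0 < m) (0<n : 0 < n)
    (orderK : length (Enumeration.elements enumK) ≡ 3 ℕ.^ m)
    (orderL : length (Enumeration.elements enumL) ≡ 3 ℕ.^ (m ℕ.* n))
    (ι : A → B)
    (ι-+ : ∀ x y → ι (DiscreteField._+_ K x y) ≡ DiscreteField._+_ L (ι x) (ι y))
    (ι-* : ∀ x y → ι (DiscreteField._*_ K x y) ≡ DiscreteField._*_ L (ι x) (ι y))
    (ι-1 : ι (DiscreteField.1# K) ≡ DiscreteField.1# L) where

  0<mn : 0 < m ℕ.* n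
  0<mn = ℕ.*-mono-≤ 0<m 0<n

  module F where
    open KloostermanCharacter K enumK m 0<m orderK public
    open Polynomials K public using (_·_; length-·; ·-identityʳ)
    open Factorization K enumK public

  module E where
    open KloostermanCharacter L enumL (m ℕ.* n) 0<mn orderL public
    open Polynomials L public using (_·_; length-·; ·-assoc; ·-comm; ·-cancelˡ; ·-identityʳ; length-≤-·)

  module Hι = Homomorphism K L ι ι-+ ι-* ι-1
  open ≡.≡-Reasoning

  Q : ℕ
  Q = 3 ℕ.^ m

  frob : B → B
  frob x = x E.^ Q

  frob-+ : ∀ x y → frob (x E.+ y) ≡ frob x E.+ frob y
  frob-+ = E.^3^-+ m

  frob-* : ∀ x y → frob (x E.* y) ≡ frob x E.* frob y
  frob-* x y = E.^-distrib-* x y Q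

  module Hφ = Homomorphism L L frob frob-+ frob-* (E.1^n Q)

  frob-ι : ∀ c → frob (ι c) ≡ ι c
  frob-ι c = trans (sym (Hι.h-^ c Q)) (cong ι (trans (cong (c F.^_) (sym orderK)) (F.x^q≡x c)))

  iterate : ℕ → B → B
  iterate zero    x = x
  iterate (suc j) x = iterate j (frob x)

  iterate-+ : ∀ i j x → iterate (i ℕ.+ j) x ≡ iterate j (iterate i x)
  iterate-+ zero    j x = refl
  iterate-+ (suc i) j x = iterate-+ i j (frob x)

  iterate≡^ : ∀ j x → iterate j x ≡ x E.^ (Q ℕ.^ j)
  iterate≡^ zero    x = sym (E.*-identityʳ x)
  iterate≡^ (suc j) x = trans (iterate≡^ j (frob x)) (E.^-assocʳ x Q (Q ℕ.^ j))

  iterate-n : ∀ x → iterate n x ≡ x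
  iterate-n x = trans (iterate≡^ n x) (trans (cong (x E.^_) (trans (ℕ.^-*-assoc 3 m n) (sym orderL))) (E.x^q≡x x))

  iterate-injective : ∀ j {x y} → iterate j x ≡ iterate j y → x ≡ y
  iterate-injective zero    e = e
  iterate-injective (suc j) e = Hφ.h-injective (iterate-injective j e)

  iterate-* : ∀ k d x → iterate d x ≡ x → iterate (k ℕ.* d) x ≡ x
  iterate-* zero    d x e = refl
  iterate-* (suc k) d x e = trans (iterate-+ d (k ℕ.* d) x) (trans (cong (iterate (k ℕ.* d)) e) (iterate-* k d x e))

  n≡ : suc (pred n) ≡ n
  n≡ = ℕ.suc-pred n ⦃ ℕ.>-nonZero 0<n ⦄

  abstract
    search : ∀ x → ∃ λ d → iterate (suc d) x ≡ x × (∀ j → j < d → iterate (suc j) x ≢ x)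
    search x = least (λ d → iterate (suc d) x E.≟ x) (pred n) (trans (cong (λ k → iterate k x) n≡) (iterate-n x))

  -- The length of the Frobenius orbit of x, that is, its degree over the subfield. `search` looks
  -- for the predecessor, which makes it positive.
  period : B → ℕ
  period x = suc (proj₁ (search x))

  iterate-period : ∀ x → iterate (period x) x ≡ x
  iterate-period x = proj₁ (proj₂ (search x))

  period-minimal : ∀ x j → 0 < j → j < period x → iterate j x ≢ x
  period-minimal x (suc j) _ (s≤s lt) = proj₂ (proj₂ (search x)) j lt

  -- Frobenius is injective, so a coincidence of two iterates can be pulled back to a return to x
  -- before the period.
  iterates-distinct : ∀ x {i j} → i < j → j < period x → iterate i x ≢ iterate j x
  iterates-distinct x {i} {j} i<j j<d e = period-minimal x (j ∸ i) (ℕ.m<n⇒0<n∸m i<j)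
    (ℕ.≤-<-trans (ℕ.m∸n≤m j i) j<d) (sym (iterate-injective i (trans e (begin
      iterate j x                           ≡⟨ cong (λ k → iterate k x) (ℕ.m∸n+n≡m (ℕ.<⇒≤ i<j)) ⟨
      iterate (j ∸ i ℕ.+ i) x               ≡⟨ iterate-+ (j ∸ i) i x ⟩
      iterate i (iterate (j ∸ i) x)         ∎))))

  -- The iterate of exponent n modulo the period fixes x, so minimality makes this remainder zero.
  -- The quotient has the form k + 1 because exponents in `powerSum` do.
  period-∣ : ∀ x → ∃ λ k → n ≡ suc k ℕ.* period x
  period-∣ x = split (n ℕ.% period x ℕ.≟ 0) (n ℕ./ period x) refl
    where
    d = period x
    n≡r+kd : n ≡ n ℕ.% d ℕ.+ n ℕ./ d ℕ.* d
    n≡r+kd = ℕ.m≡m%n+[m/n]*n n d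
    fixed : iterate (n ℕ.% d) x ≡ x
    fixed = begin
      iterate (n ℕ.% d) x                               ≡⟨ cong (iterate (n ℕ.% d)) (iterate-* (n ℕ./ d) d x (iterate-period x)) ⟨
      iterate (n ℕ.% d) (iterate (n ℕ./ d ℕ.* d) x)     ≡⟨ iterate-+ (n ℕ./ d ℕ.* d) (n ℕ.% d) x ⟨
      iterate (n ℕ./ d ℕ.* d ℕ.+ n ℕ.% d) x             ≡⟨ cong (λ k → iterate k x) (trans (ℕ.+-comm _ (n ℕ.% d)) (sym n≡r+kd)) ⟩
      iterate n x                                       ≡⟨ iterate-n x ⟩
      x                                                 ∎
    split : Dec (n ℕ.% d ≡ 0) → ∀ k → n ℕ./ d ≡ k → ∃ λ k → n ≡ suc k ℕ.* d
    split (no ne) _ _ = contradiction fixed (period-minimal x (n ℕ.% d) (ℕ.n≢0⇒n>0 ne) (ℕ.m%n<n n d))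
    split (yes r≡0) zero e = contradiction (trans n≡r+kd (cong₂ ℕ._+_ r≡0 (cong (ℕ._* d) e))) (ℕ.>⇒≢ 0<n)
    split (yes r≡0) (suc k) e = k , trans n≡r+kd (cong₂ ℕ._+_ r≡0 (cong (ℕ._* d) e))

  -- ∏_{j<d} (X + x^(Q^j)); the plus sign spares a sign in the trace.
  orbit : ℕ → B → List B
  orbit zero    x = []
  orbit (suc d) x = (x ∷ []) E.· orbit d (frob x)

  length-orbit : ∀ d x → length (orbit d x) ≡ d
  length-orbit zero    x = refl
  length-orbit (suc d) x = trans (E.length-· (x ∷ []) (orbit d (frob x))) (cong suc (length-orbit d (frob x)))

  map-frob-orbit : ∀ d x → map frob (orbit d x) ≡ orbit d (frob x)
  map-frob-orbit zero    x = refl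
  map-frob-orbit (suc d) x = trans (Hφ.map-· (x ∷ []) _) (cong ((frob x ∷ []) E.·_) (map-frob-orbit d (frob x)))

  orbit-last : ∀ d x → orbit (suc d) x ≡ orbit d x E.· (iterate d x ∷ [])
  orbit-last zero    x = E.·-identityʳ (x ∷ [])
  orbit-last (suc d) x = trans (cong ((x ∷ []) E.·_) (orbit-last d (frob x)))
    (sym (E.·-assoc (x ∷ []) (orbit d (frob x)) (iterate d (frob x) ∷ [])))

  -- Both sides times X + x equal `orbit (suc d) x`, whose last factor is X + x again; then X + x is
  -- cancelled.
  orbit-cyclic : ∀ d x → iterate d x ≡ x → orbit d (frob x) ≡ orbit d x
  orbit-cyclic d x e = E.·-cancelˡ (x ∷ []) _ _ (trans (orbit-last d x)
    (trans (cong (λ y → orbit d x E.· (y ∷ [])) e) (E.·-comm (orbit d x) (x ∷ []))))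

  eval-· : ∀ f g x → E.eval (f E.· g) x ≡ E.eval f x E.* E.eval g x
  eval-· []      g x = sym (E.*-identityˡ _)
  eval-· (c ∷ f) g x = begin
    E.eval ((c ∷ f) E.· g) x
      ≡⟨ E.eval-addMultiple c g (E.0# ∷ f E.· g) x (s≤s (E.length-≤-· f g)) ⟩
    E.0# E.+ x E.* E.eval (f E.· g) x E.+ c E.* E.eval g x
      ≡⟨ cong (λ z → E.0# E.+ x E.* z E.+ c E.* E.eval g x) (eval-· f g x) ⟩
    E.0# E.+ x E.* (E.eval f x E.* E.eval g x) E.+ c E.* E.eval g x
      ≡⟨ solve 4 (λ x u v c → con (ℤ.+ 0) :+ x :* (u :* v) :+ c :* v := (c :+ x :* u) :* v) refl x (E.eval f x) (E.eval g x) c ⟩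
    (c E.+ x E.* E.eval f x) E.* E.eval g x ∎
    where open IntegerCoefficientSolver E.commutativeRing using (solve; con; _:+_; _:*_; _:=_)

  -- The fixed elements are roots of X^Q - X. A fixed y outside the image of ι would be a root
  -- besides the Q elements of that image.
  fixed⇒ι : ∀ y → frob y ≡ y → ∃ λ c → ι c ≡ y
  fixed⇒ι y e with any? (λ c → ι c E.≟ y) F.elements
  ... | yes p = let c , _ , ιc≡y = find p in c , ιc≡y
  ... | no ¬p = contradiction tooManyRoots (ℕ.<⇒≱ (ℕ.≤-reflexive (cong suc (sym orderK))))
    where
    1<Q : 1 < Q
    1<Q = ℕ.≤-trans (ℕ.n≤1+n 2) (subst (3 ≤_) orderK F.3≤q)
    low : E.LowDegree Q (λ x → E.- E.1# E.* x E.^ 1)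
    low = E.low-monomial (E.- E.1#) 1<Q
    root : ∀ {x} → frob x ≡ x → E.eval (proj₁ low) x ≡ E.0#
    root {x} e = trans (E.eval≡evalₚ (proj₁ low) x)
      (trans (cong₂ E._+_ (proj₂ (proj₂ low) x) (trans (cong (x E.^_) (proj₁ (proj₂ low))) e))
        (solve 1 (λ x → :- con (ℤ.+ 1) :* (x :* con (ℤ.+ 1)) :+ x := con (ℤ.+ 0)) refl x))
      where open IntegerCoefficientSolver E.commutativeRing using (solve; con; _:+_; _:*_; _:=_; :-_)
    roots : ∀ {r} → r ∈ y ∷ map ι F.elements → E.eval (proj₁ low) r ≡ E.0#
    roots (here refl) = root e
    roots (there r∈) = let c , _ , r≡ιc = ∈.∈-map⁻ ι r∈ in trans (cong (E.eval (proj₁ low)) r≡ιc) (root (frob-ι c))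
    tooManyRoots : suc F.q ≤ Q
    tooManyRoots = subst (λ k → suc k ≤ Q) (length-map ι F.elements) (subst (suc (length (map ι F.elements)) ≤_) (proj₁ (proj₂ low))
      (E.roots≤degree (proj₁ low) (y ∷ map ι F.elements)
        (All.tabulate (λ r∈ y≡r → let c , c∈ , r≡ιc = ∈.∈-map⁻ ι r∈ in ¬p (lose c∈ (sym (trans y≡r r≡ιc))))
          ∷ Unique.map⁺ Hι.h-injective F.unique) roots))

  descend : ∀ f → map frob f ≡ f → ∃ λ g → map ι g ≡ f
  descend []      _ = [] , refl
  descend (y ∷ f) e = let c , ιc≡y = fixed⇒ι y (∷-injectiveˡ e) ; g , e′ = descend f (∷-injectiveʳ e) in c ∷ g , cong₂ _∷_ ιc≡y e′

  -- The minimal polynomial of - x over the subfield.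
  abstract
    descended : ∀ x → ∃ λ g → map ι g ≡ orbit (period x) x
    descended x = descend (orbit (period x) x)
      (trans (map-frob-orbit (period x) x) (orbit-cyclic (period x) x (iterate-period x)))

  minimal : B → List A
  minimal x = proj₁ (descended x)

  map-minimal : ∀ x → map ι (minimal x) ≡ orbit (period x) x
  map-minimal x = proj₂ (descended x)

  length-minimal : ∀ x → length (minimal x) ≡ period x
  length-minimal x = trans (sym (length-map ι (minimal x))) (trans (cong length (map-minimal x)) (length-orbit (period x) x))

  minimal-root : ∀ x → E.eval (map ι (minimal x)) (E.- x) ≡ E.0#
  minimal-root x = trans (cong (λ f → E.eval f (E.- x)) (map-minimal x)) (trans (eval-· (x ∷ []) (orbit (proj₁ (search x)) (frob x)) (E.- x))
    (trans (E.*-congʳ (trans (cong (x E.+_) (E.*-identityʳ (E.- x))) (E.-‿inverseʳ x))) (E.zeroˡ _)))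

  root-frob : ∀ g y → E.eval (map ι g) y ≡ E.0# → E.eval (map ι g) (frob y) ≡ E.0#
  root-frob g y e = begin
    E.eval (map ι g) (frob y)               ≡⟨ cong (λ f → E.eval f (frob y)) (trans (sym (map-∘ g)) (map-cong frob-ι g)) ⟨
    E.eval (map frob (map ι g)) (frob y)    ≡⟨ Hφ.h-eval (map ι g) y ⟨
    frob (E.eval (map ι g) y)               ≡⟨ trans (cong frob e) Hφ.h-0 ⟩
    E.0#                                    ∎

  conjugate-root : ∀ g x → E.eval (map ι g) (E.- x) ≡ E.0# → ∀ j → E.eval (map ι g) (E.- iterate j x) ≡ E.0#
  conjugate-root g x e zero    = e
  conjugate-root g x e (suc j) = conjugate-root g (frob x) (trans (cong (E.eval (map ι g)) (sym (Hφ.h-neg x))) (root-frob g (E.- x) e)) j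

  -- Frobenius fixes the coefficients of g, so together with -x all its conjugates are roots, and
  -- they are distinct within one period.
  period≤degree : ∀ g x → E.eval (map ι g) (E.- x) ≡ E.0# → period x ≤ length g
  period≤degree g x e = subst₂ _≤_ (length-applyUpTo conjugate (period x)) (length-map ι g)
    (E.roots≤degree (map ι g) (applyUpTo conjugate (period x))
      (Unique.applyUpTo⁺₁ conjugate (period x) λ i<j j<d e → iterates-distinct x i<j j<d
        (trans (sym (E.-‿involutive _)) (trans (cong E.-_ e) (E.-‿involutive _))))
      λ r∈ → let j , _ , r≡ = ∈.∈-applyUpTo⁻ conjugate r∈ in
        trans (cong (E.eval (map ι g)) r≡) (conjugate-root g x e j))
    where
    conjugate : ℕ → B
    conjugate j = E.- iterate j x

  -- One of two factors vanishes at -x and so has the full degree by `period≤degree`; the other one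
  -- is then constant.
  minimal-irreducible : ∀ x → F.Irreducible (minimal x)
  minimal-irreducible x = record
    { nontrivial = λ e → ℕ.1+n≢0 (trans (sym (length-minimal x)) (cong length e))
    ; atomic = λ g h e → Sum.map (λ z → F.length≡0 g (small h g (trans (cong length e) (trans (F.length-· g h) (ℕ.+-comm (length g) _))) z))
                                 (λ z → F.length≡0 h (small g h (trans (cong length e) (F.length-· g h)) z))
        (Sum.swap (E.x*y≡0 (trans (sym (eval-· (map ι g) (map ι h) (E.- x))) (trans (cong (λ f → E.eval f (E.- x))
          (trans (sym (Hι.map-· g h)) (cong (map ι) (sym e)))) (minimal-root x))))) }
    where
    small : ∀ g h → length (minimal x) ≡ length g ℕ.+ length h → E.eval (map ι g) (E.- x) ≡ E.0# → length h ≡ 0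
    small g h e z = ℕ.n≤0⇒n≡0 (ℕ.+-cancelˡ-≤ (length g) _ _ (subst₂ _≤_ (trans (sym (length-minimal x)) e)
      (sym (ℕ.+-identityʳ (length g))) (period≤degree g x z)))

  -- Counting elements by their minimal polynomials

  count : List A → ℕ
  count P = length (filter (λ x → P F.≟ₗ minimal x) E.elements)

  -- The elements counted have P as minimal polynomial, so their negatives are distinct roots of P.
  count≤length : ∀ P → count P ≤ length P
  count≤length P = subst₂ _≤_ (length-map E.-_ xs) (length-map ι P)
    (E.roots≤degree (map ι P) (map E.-_ xs)
      (Unique.map⁺ (λ e → trans (sym (E.-‿involutive _)) (trans (cong E.-_ e) (E.-‿involutive _)))
        (Unique.filter⁺ (λ x → P F.≟ₗ minimal x) E.unique))
      λ r∈ → let x , x∈ , r≡-x = ∈.∈-map⁻ E.-_ r∈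
                 _ , P≡ = ∈.∈-filter⁻ (λ x → P F.≟ₗ minimal x) {xs = E.elements} x∈
             in trans (cong₂ (λ f y → E.eval (map ι f) y) P≡ r≡-x) (minimal-root x))
    where xs = filter (λ x → P F.≟ₗ minimal x) E.elements

  multiple : B → ℕ
  multiple x = proj₁ (period-∣ x)

  n≡multiple : ∀ x → n ≡ suc (multiple x) ℕ.* length (minimal x)
  n≡multiple x = trans (proj₂ (period-∣ x)) (cong (suc (multiple x) ℕ.*_) (sym (length-minimal x)))

  multiple<n : ∀ x → multiple x < n
  multiple<n x = subst (suc (multiple x) ≤_) (sym (proj₂ (period-∣ x))) (ℕ.m≤m*n (suc (multiple x)) (period x))

  minimal∈primes : ∀ x → minimal x ∈ F.primes n
  minimal∈primes x = F.∈-primes (subst (length (minimal x) ≤_) (sym (n≡multiple x)) (ℕ.m≤n*m (length (minimal x)) (suc (multiple x))))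
    (minimal-irreducible x)

  module _ (R : CommutativeSemiring 0ℓ 0ℓ) where
    open CommutativeSemiring R using (_≈_; _*_; 1#; Carrier; *-congʳ; semiring)
      renaming (sym to ≈-sym; trans to ≈-trans; reflexive to ≈-reflexive)
    open ListSum R
    open Algebra.Properties.Semiring.Mult semiring using () renaming (_×_ to _⋆_)
    open Algebra.Properties.CommutativeSemigroup (CommutativeSemiring.*-commutativeSemigroup R) using (x∙yz≈y∙xz)
    open Relation.Binary.Reasoning.Setoid (CommutativeSemiring.setoid R) renaming (begin_ to begin′_; _∎ to _∎′)

    -- The bracket replaces `multiple x` by a free index k, so that the right side is `powerSum`
    -- with `count P` in place of deg P. The semiring is general because ℕ serves to show that these
    -- agree and ℤ[ω] for the Kloosterman sum.
    sum-by-minimal : ∀ (G : List A → ℕ → Carrier) →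
      ∑[ x ← E.elements ] G (minimal x) (multiple x) ≈
      ∑[ P ← F.primes n ] ∑[ k ← upTo n ] ([ n ℕ.≟ suc k ℕ.* length P ] * ((count P ⋆ 1#) * G P k))
    sum-by-minimal G = begin′
      ∑[ x ← E.elements ] G (minimal x) (multiple x)
        ≈⟨ ∑-cong E.elements (λ x → ≈-sym (pick x)) ⟩
      ∑[ x ← E.elements ] ∑[ P ← F.primes n ] ([ P F.≟ₗ minimal x ] * weight P)
        ≈⟨ ∑-swap E.elements (F.primes n) (λ x P → [ P F.≟ₗ minimal x ] * weight P) ⟩
      ∑[ P ← F.primes n ] ∑[ x ← E.elements ] ([ P F.≟ₗ minimal x ] * weight P)
        ≈⟨ ∑-cong (F.primes n) (λ P → ≈-trans (∑-*ʳ E.elements (weight P) _)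
             (≈-trans (*-congʳ (∑-[]-⋆ E.elements (λ x → P F.≟ₗ minimal x)))
               (≈-trans (≈-sym (∑-*ˡ (upTo n) _ _)) (∑-cong (upTo n) λ k → x∙yz≈y∙xz _ _ _)))) ⟩
      ∑[ P ← F.primes n ] ∑[ k ← upTo n ] ([ n ℕ.≟ suc k ℕ.* length P ] * ((count P ⋆ 1#) * G P k)) ∎′
      where
      weight : List A → Carrier
      weight P = ∑[ k ← upTo n ] ([ n ℕ.≟ suc k ℕ.* length P ] * G P k)
      pick : ∀ x → ∑[ P ← F.primes n ] ([ P F.≟ₗ minimal x ] * weight P) ≈ G (minimal x) (multiple x)
      pick x = begin′
        ∑[ P ← F.primes n ] ([ P F.≟ₗ minimal x ] * weight P)
          ≈⟨ ∑-δ F._≟ₗ_ weight (F.primes-unique n) (minimal∈primes x) ⟩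
        ∑[ k ← upTo n ] ([ n ℕ.≟ suc k ℕ.* length (minimal x) ] * G (minimal x) k)
          ≈⟨ ∑-cong (upTo n) (λ k → *-congʳ (≈-reflexive ([]-⇔ (n ℕ.≟ suc k ℕ.* length (minimal x)) (k ℕ.≟ multiple x)
               (λ e → ℕ.suc-injective (ℕ.*-cancelʳ-≡ (suc k) (suc (multiple x)) (length (minimal x)) ⦃ ℕ.≢-nonZero (λ e → ℕ.1+n≢0 (trans (sym (length-minimal x)) e)) ⦄
                  (trans (sym e) (n≡multiple x))))
               (λ { refl → n≡multiple x })))) ⟩
        ∑[ k ← upTo n ] ([ k ℕ.≟ multiple x ] * G (minimal x) k)
          ≈⟨ ∑-δ ℕ._≟_ (G (minimal x)) (Unique.upTo⁺ n) (∈.∈-upTo⁺ (multiple<n x)) ⟩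
        G (minimal x) (multiple x) ∎′

  module ℕΣ = ListSum ℕ.+-*-commutativeSemiring

  ∑-≤ : ∀ {C : Set} (xs : List C) {f g : C → ℕ} → (∀ {x} → x ∈ xs → f x ≤ g x) → ℕΣ.∑ xs f ≤ ℕΣ.∑ xs g
  ∑-≤ []       le = z≤n
  ∑-≤ (x ∷ xs) le = ℕ.+-mono-≤ (le (here refl)) (∑-≤ xs (le ∘ there))

  ∑-≤-≡ : ∀ {C : Set} (xs : List C) {f g : C → ℕ} → (∀ {x} → x ∈ xs → f x ≤ g x) → ℕΣ.∑ xs g ≤ ℕΣ.∑ xs f →
          ∀ {x} → x ∈ xs → f x ≡ g x
  ∑-≤-≡ (y ∷ xs) {f} {g} le ge (here refl) = ℕ.≤-antisym (le (here refl))
    (ℕ.+-cancelʳ-≤ (ℕΣ.∑ xs f) (g y) (f y) (ℕ.≤-trans (ℕ.+-monoʳ-≤ (g y) (∑-≤ xs (le ∘ there))) ge))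
  ∑-≤-≡ (y ∷ xs) {f} {g} le ge (there x∈) = ∑-≤-≡ xs (le ∘ there)
    (ℕ.+-cancelˡ-≤ (f y) _ _ (ℕ.≤-trans (ℕ.+-monoˡ-≤ (ℕΣ.∑ xs g) (le (here refl))) ge)) x∈

  private
    module Z where
      open EulerProduct K enumK ℕ.+-*-commutativeSemiring public
      open Algebra.Properties.Semiring.Mult ℕ.+-*-semiring public using () renaming (_×_ to _⋆_)
      open Algebra.Properties.Semiring.Exp ℕ.+-*-semiring public using (_^_)

  ⋆1 : ∀ k → k Z.⋆ 1 ≡ k
  ⋆1 zero    = refl
  ⋆1 (suc k) = cong suc (⋆1 k)

  1^k : ∀ k → 1 Z.^ k ≡ 1
  1^k zero    = refl
  1^k (suc k) = trans (ℕ.+-identityʳ _) (1^k k)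

  const-∑ : ∀ {C : Set} (xs : List C) c → ℕΣ.∑ xs (λ _ → c) ≡ length xs ℕ.* c
  const-∑ []       c = refl
  const-∑ (x ∷ xs) c = cong (c ℕ.+_) (const-∑ xs c)

  one : List A → ℕ
  one _ = 1

  totalDegree : ℕ → ℕ
  totalDegree = Z.powerSum one refl (λ _ _ → refl) n

  monicCount : ∀ i → Z.coefficient one refl (λ _ _ → refl) i ≡ F.q ℕ.^ i
  monicCount zero    = refl
  monicCount (suc i) = trans (ℕΣ.∑-product _∷_ F.elements (F.monics i) one)
    (trans (ℕΣ.∑-cong F.elements (λ c → monicCount i)) (const-∑ F.elements _))

  -- There are q^i monic polynomials of degree i. Comparing Newton's identity at n with q times the
  -- one at n - 1 leaves the single new term, n q^n - (n - 1) q^n.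
  totalDegree-n : totalDegree n ≡ F.q ℕ.^ n
  totalDegree-n = subst (λ k → totalDegree k ≡ F.q ℕ.^ k) n≡ (ℕ.+-cancelˡ-≡ (n′ ℕ.* F.q ℕ.^ suc n′) _ _ (begin
    n′ ℕ.* F.q ℕ.^ suc n′ ℕ.+ totalDegree (suc n′)
      ≡⟨ cong₂ ℕ._+_ (sym shifted) (sym (ℕ.*-identityʳ _)) ⟩
    ℕΣ.∑ (upTo (suc n′)) (λ i → totalDegree i ℕ.* F.q ℕ.^ (suc n′ ∸ i)) ℕ.+ totalDegree (suc n′) ℕ.* 1
      ≡⟨ cong (λ k → ℕΣ.∑ (upTo (suc n′)) (λ i → totalDegree i ℕ.* F.q ℕ.^ (suc n′ ∸ i)) ℕ.+ totalDegree (suc n′) ℕ.* F.q ℕ.^ k) (ℕ.n∸n≡0 n′) ⟨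
    ℕΣ.∑ (upTo (suc n′)) (λ i → totalDegree i ℕ.* F.q ℕ.^ (suc n′ ∸ i)) ℕ.+ totalDegree (suc n′) ℕ.* F.q ℕ.^ (n′ ∸ n′)
      ≡⟨ ℕΣ.∑-upTo-last (suc n′) (λ i → totalDegree i ℕ.* F.q ℕ.^ (suc n′ ∸ i)) ⟨
    ℕΣ.∑ (upTo (suc (suc n′))) (λ i → totalDegree i ℕ.* F.q ℕ.^ (suc n′ ∸ i))
      ≡⟨ newtonℕ (suc n′) (ℕ.≤-reflexive n≡) ⟨
    suc n′ ℕ.* F.q ℕ.^ suc n′
      ≡⟨ ℕ.+-comm (F.q ℕ.^ suc n′) _ ⟩
    n′ ℕ.* F.q ℕ.^ suc n′ ℕ.+ F.q ℕ.^ suc n′ ∎))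
    where
    n′ = pred n
    newtonℕ : ∀ i → i ≤ n → i ℕ.* F.q ℕ.^ i ≡ ℕΣ.∑ (upTo (suc i)) (λ j → totalDegree j ℕ.* F.q ℕ.^ (i ∸ j))
    newtonℕ i i≤n = trans (sym (cong₂ ℕ._*_ (⋆1 i) (monicCount i)))
      (trans (Z.newton one refl (λ _ _ → refl) n i i≤n) (ℕΣ.∑-cong (upTo (suc i)) λ j → cong (totalDegree j ℕ.*_) (monicCount (i ∸ j))))
    shifted : ℕΣ.∑ (upTo (suc n′)) (λ i → totalDegree i ℕ.* F.q ℕ.^ (suc n′ ∸ i)) ≡ n′ ℕ.* F.q ℕ.^ suc n′
    shifted = begin
      ℕΣ.∑ (upTo (suc n′)) (λ i → totalDegree i ℕ.* F.q ℕ.^ (suc n′ ∸ i))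
        ≡⟨ ℕΣ.∑-cong∈ (upTo (suc n′)) (λ {i} i∈ → trans (cong (λ k → totalDegree i ℕ.* F.q ℕ.^ k) (ℕ.+-∸-assoc 1 (ℕ.s≤s⁻¹ (∈.∈-upTo⁻ i∈))))
             (x∙yz≈y∙xz (totalDegree i) F.q (F.q ℕ.^ (n′ ∸ i)))) ⟩
      ℕΣ.∑ (upTo (suc n′)) (λ i → F.q ℕ.* (totalDegree i ℕ.* F.q ℕ.^ (n′ ∸ i)))
        ≡⟨ ℕΣ.∑-*ˡ (upTo (suc n′)) F.q _ ⟩
      F.q ℕ.* ℕΣ.∑ (upTo (suc n′)) (λ i → totalDegree i ℕ.* F.q ℕ.^ (n′ ∸ i))
        ≡⟨ cong (F.q ℕ.*_) (newtonℕ n′ (subst (n′ ≤_) n≡ (ℕ.n≤1+n n′))) ⟨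
      F.q ℕ.* (n′ ℕ.* F.q ℕ.^ n′)
        ≡⟨ x∙yz≈y∙xz F.q n′ (F.q ℕ.^ n′) ⟩
      n′ ℕ.* F.q ℕ.^ suc n′ ∎
      where open Algebra.Properties.CommutativeSemigroup ℕ.*-commutativeSemigroup using (x∙yz≈y∙xz)

  -- Each prime has at most as many roots as its degree allows, and the totals
  -- agree, both being the order of the field.
  count≡length : ∀ {P k} → P ∈ F.primes n → k < n → n ≡ suc k ℕ.* length P → count P ≡ length P
  count≡length {P} {k} P∈ k<n e = trans (sym (simplify (count P) refl))
    -- Equality of the totals is pushed down twice: to the inner sum belonging to P, and there to
    -- the index k.
    (trans (∑-≤-≡ (upTo n) (λ {k} _ → termwise P k)
      (ℕ.≤-reflexive (sym (∑-≤-≡ (F.primes n) (λ {P} _ → ∑-≤ (upTo n) (λ {k} _ → termwise P k)) (ℕ.≤-reflexive totals) P∈)))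
      (∈.∈-upTo⁺ k<n)) (simplify (length P) (1^k (suc k))))
    where
    termwise : ∀ P k → ℕΣ.[ n ℕ.≟ suc k ℕ.* length P ] ℕ.* ((count P Z.⋆ 1) ℕ.* 1) ≤
                       ℕΣ.[ n ℕ.≟ suc k ℕ.* length P ] ℕ.* ((length P Z.⋆ 1) ℕ.* 1 Z.^ suc k)
    termwise P k = ℕ.*-monoʳ-≤ ℕΣ.[ n ℕ.≟ suc k ℕ.* length P ]
      (ℕ.*-mono-≤ (subst₂ _≤_ (sym (⋆1 (count P))) (sym (⋆1 (length P))) (count≤length P)) (ℕ.≤-reflexive (sym (1^k (suc k)))))
    totals : totalDegree n ≡ ℕΣ.∑ (F.primes n) (λ P → ℕΣ.∑ (upTo n) (λ k → ℕΣ.[ n ℕ.≟ suc k ℕ.* length P ] ℕ.* ((count P Z.⋆ 1) ℕ.* 1)))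
    totals = begin
      totalDegree n                     ≡⟨ totalDegree-n ⟩
      F.q ℕ.^ n                         ≡⟨ trans (cong (ℕ._^ n) orderK) (trans (ℕ.^-*-assoc 3 m n) (sym orderL)) ⟩
      length E.elements                 ≡⟨ trans (const-∑ E.elements 1) (ℕ.*-identityʳ _) ⟨
      ℕΣ.∑ E.elements (λ _ → 1)         ≡⟨ sum-by-minimal ℕ.+-*-commutativeSemiring (λ _ _ → 1) ⟩
      ℕΣ.∑ (F.primes n) (λ P → ℕΣ.∑ (upTo n) (λ k → ℕΣ.[ n ℕ.≟ suc k ℕ.* length P ] ℕ.* ((count P Z.⋆ 1) ℕ.* 1))) ∎
    simplify : ∀ c {u} → u ≡ 1 → ℕΣ.[ n ℕ.≟ suc k ℕ.* length P ] ℕ.* ((c Z.⋆ 1) ℕ.* u) ≡ c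
    simplify c refl = trans (cong₂ ℕ._*_ (ℕΣ.[]-yes (n ℕ.≟ suc k ℕ.* length P) e) (trans (ℕ.*-identityʳ _) (⋆1 c))) (ℕ.+-identityʳ c)

  -- Traces and characters of conjugates

  -- Transitivity of the trace: the exponents l < m k are cut into blocks of length m, and each
  -- block is the power sum of one Frobenius iterate.
  E-tr : ∀ k x → E.∑ (upTo (m ℕ.* k)) (λ l → x E.^ (3 ℕ.^ l)) ≡
         E.∑ (upTo m) (λ i → E.∑ (upTo k) (λ j → iterate j x) E.^ (3 ℕ.^ i))
  E-tr zero x = trans (cong (λ z → E.∑ (upTo z) (λ l → x E.^ (3 ℕ.^ l))) (ℕ.*-zeroʳ m))
    (sym (trans (E.∑-cong (upTo m) (λ i → E.0^n (E.0<3^ i))) (E.∑-0 (upTo m))))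
  E-tr (suc k) x = begin
    E.∑ (upTo (m ℕ.* suc k)) (λ l → x E.^ (3 ℕ.^ l))
      ≡⟨ cong (λ z → E.∑ (upTo z) (λ l → x E.^ (3 ℕ.^ l))) (ℕ.*-suc m k) ⟩
    E.∑ (upTo (m ℕ.+ m ℕ.* k)) (λ l → x E.^ (3 ℕ.^ l))
      ≡⟨ E.∑-upTo-+ m (m ℕ.* k) (λ l → x E.^ (3 ℕ.^ l)) ⟩
    E.∑ (upTo m) (λ l → x E.^ (3 ℕ.^ l)) E.+ E.∑ (upTo (m ℕ.* k)) (λ l → x E.^ (3 ℕ.^ (m ℕ.+ l)))
      ≡⟨ cong (E.∑ (upTo m) (λ l → x E.^ (3 ℕ.^ l)) E.+_) (trans
           (E.∑-cong (upTo (m ℕ.* k)) λ l → trans (cong (x E.^_) (ℕ.^-distribˡ-+-* 3 m l)) (sym (E.^-assocʳ x Q (3 ℕ.^ l))))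
           (E-tr k (frob x))) ⟩
    E.∑ (upTo m) (λ i → x E.^ (3 ℕ.^ i)) E.+ E.∑ (upTo m) (λ i → E.∑ (upTo k) (λ j → iterate j (frob x)) E.^ (3 ℕ.^ i))
      ≡⟨ E.∑-+ (upTo m) (λ i → x E.^ (3 ℕ.^ i)) _ ⟨
    E.∑ (upTo m) (λ i → x E.^ (3 ℕ.^ i) E.+ E.∑ (upTo k) (λ j → iterate j (frob x)) E.^ (3 ℕ.^ i))
      ≡⟨ E.∑-cong (upTo m) (λ i → E.^3^-+ i x _) ⟨
    E.∑ (upTo m) (λ i → (x E.+ E.∑ (upTo k) (λ j → iterate j (frob x))) E.^ (3 ℕ.^ i))
      ≡⟨ E.∑-cong (upTo m) (λ i → cong (E._^ (3 ℕ.^ i)) (E.∑-upTo-suc k (λ j → iterate j x))) ⟨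
    E.∑ (upTo m) (λ i → E.∑ (upTo (suc k)) (λ j → iterate j x) E.^ (3 ℕ.^ i)) ∎

  orbitSum : ℕ → B → B
  orbitSum d x = E.∑ (upTo d) (λ j → iterate j x)

  orbitSum-suc : ∀ d x → orbitSum (suc d) x ≡ x E.+ orbitSum d (frob x)
  orbitSum-suc d x = E.∑-upTo-suc d (λ j → iterate j x)

  orbitSum-* : ∀ k d x → iterate d x ≡ x → orbitSum (k ℕ.* d) x ≡ k E.⋆ orbitSum d x
  orbitSum-* zero    d x e = refl
  orbitSum-* (suc k) d x e = begin
    orbitSum (d ℕ.+ k ℕ.* d) x
      ≡⟨ E.∑-upTo-+ d (k ℕ.* d) (λ j → iterate j x) ⟩
    orbitSum d x E.+ E.∑ (upTo (k ℕ.* d)) (λ j → iterate (d ℕ.+ j) x)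
      ≡⟨ cong (orbitSum d x E.+_) (E.∑-cong (upTo (k ℕ.* d)) λ j → trans (iterate-+ d j x) (cong (iterate j) e)) ⟩
    orbitSum d x E.+ orbitSum (k ℕ.* d) x
      ≡⟨ cong (orbitSum d x E.+_) (orbitSum-* k d x e) ⟩
    orbitSum d x E.+ k E.⋆ orbitSum d x ∎

  ζ-ι : ∀ t → E.ζ (ι t) ≡ F.ζ t
  ζ-ι t with ι t E.≟ E.0# | t F.≟ F.0# | ι t E.≟ E.1# | t F.≟ F.1#
  ... | yes _  | yes _  | _      | _      = refl
  ... | yes e  | no ne  | _      | _      = contradiction (Hι.h-injective (trans e (sym Hι.h-0))) ne
  ... | no ne  | yes e  | _      | _      = contradiction (trans (cong ι e) Hι.h-0) ne
  ... | no _   | no _   | yes _  | yes _  = refl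
  ... | no _   | no _   | yes e  | no ne  = contradiction (Hι.h-injective (trans e (sym ι-1))) ne
  ... | no _   | no _   | no ne  | yes e  = contradiction (trans (cong ι e) ι-1) ne
  ... | no _   | no _   | no _   | no _   = refl

  ψ-descends : ∀ c z → ι c ≡ orbitSum n z → E.ψ z ≡ F.ψ c
  ψ-descends c z e = trans (cong E.ζ (begin
    E.tr z                                                ≡⟨ E-tr n z ⟩
    E.∑ (upTo m) (λ i → orbitSum n z E.^ (3 ℕ.^ i))       ≡⟨ E.∑-cong (upTo m) (λ i → trans (Hι.h-^ c (3 ℕ.^ i)) (cong (E._^ (3 ℕ.^ i)) e)) ⟨
    E.∑ (upTo m) (λ i → ι (c F.^ (3 ℕ.^ i)))              ≡⟨ Hι.h-∑ (upTo m) (λ i → c F.^ (3 ℕ.^ i)) ⟨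
    ι (F.tr c)                                            ∎)) (ζ-ι (F.tr c))

  c₀-map : ∀ f → ι (F.c₀ f) ≡ E.c₀ (map ι f)
  c₀-map []      = ι-1
  c₀-map (_ ∷ _) = refl

  c₁-map : ∀ f → ι (F.c₁ f) ≡ E.c₁ (map ι f)
  c₁-map []      = Hι.h-0
  c₁-map (_ ∷ f) = c₀-map f

  top-map : ∀ f → ι (F.top f) ≡ E.top (map ι f)
  top-map []          = Hι.h-0
  top-map (_ ∷ [])    = refl
  top-map (_ ∷ d ∷ f) = top-map (d ∷ f)

  ι-⁻¹ : ∀ {c} → c ≢ F.0# → ι (c F.⁻¹) ≡ ι c E.⁻¹
  ι-⁻¹ {c} c≢0 = E.*-cancelˡ (Hι.h-≢0 c≢0) (begin
    ι c E.* ι (c F.⁻¹)     ≡⟨ ι-* c (c F.⁻¹) ⟨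
    ι (c F.* c F.⁻¹)       ≡⟨ trans (cong ι (F.x*x⁻¹ c≢0)) ι-1 ⟩
    E.1#                   ≡⟨ E.x*x⁻¹ (Hι.h-≢0 c≢0) ⟨
    ι c E.* ι c E.⁻¹       ∎)

  c₀-orbit-zero : ∀ d → E.c₀ (orbit (suc d) E.0#) ≡ E.0#
  c₀-orbit-zero d = trans (E.c₀-· (E.0# ∷ []) (orbit d (frob E.0#))) (E.zeroˡ (E.c₀ (orbit d (frob E.0#))))

  c₀-orbit-nonzero : ∀ d {x} → x ≢ E.0# → E.c₀ (orbit d x) ≢ E.0#
  c₀-orbit-nonzero zero    x≢0 = E.1≢0
  c₀-orbit-nonzero (suc d) {x} x≢0 e = E.x*y≢0 x≢0 (c₀-orbit-nonzero d (Hφ.h-≢0 x≢0))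
    (trans (sym (E.c₀-· (x ∷ []) (orbit d (frob x)))) e)

  module _ (a : A) (a≢0 : a ≢ F.0#) where
    ιa≢0 : ι a ≢ E.0#
    ιa≢0 = Hι.h-≢0 a≢0

    φF : List A → A
    φF = F.φ a a≢0

    φE : List B → B
    φE = E.φ (ι a) ιa≢0

    ι-φ : ∀ f → F.c₀ f ≢ F.0# → ι (φF f) ≡ φE (map ι f)
    ι-φ f ne = begin
      ι (F.top f F.+ a F.* (F.c₁ f F.* F.c₀ f F.⁻¹))
        ≡⟨ trans (ι-+ _ _) (cong (ι (F.top f) E.+_) (trans (ι-* a _) (cong (ι a E.*_) (ι-* (F.c₁ f) _)))) ⟩
      ι (F.top f) E.+ ι a E.* (ι (F.c₁ f) E.* ι (F.c₀ f F.⁻¹))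
        ≡⟨ cong₂ (λ t u → t E.+ ι a E.* u) (top-map f) (cong₂ E._*_ (c₁-map f) (trans (ι-⁻¹ ne) (cong E._⁻¹ (c₀-map f)))) ⟩
      φE (map ι f) ∎

    argument : B → B
    argument x = x E.+ ι a E.* x E.⁻¹

    frob-argument : ∀ x → frob (argument x) ≡ argument (frob x)
    frob-argument x = trans (frob-+ x _) (cong (frob x E.+_) (trans (frob-* (ι a) _)
      (cong₂ E._*_ (frob-ι a) (Hφ.h-^ x (E.q ∸ 2)))))

    -- On a factor X + x the function φ is x + a/x, and φ is additive on products. Frobenius
    -- commutes with `argument` as it fixes `ι a`.
    φE-orbit : ∀ d {x} → x ≢ E.0# → φE (orbit d x) ≡ orbitSum d (argument x)
    φE-orbit zero {x} x≢0 = trans (cong (λ z → E.0# E.+ ι a E.* z) (E.zeroˡ _))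
      (trans (E.+-identityˡ _) (E.zeroʳ (ι a)))
    φE-orbit (suc d) {x} x≢0 = begin
      φE ((x ∷ []) E.· orbit d (frob x))
        ≡⟨ E.φ-· (ι a) ιa≢0 (x ∷ []) (orbit d (frob x)) x≢0 (c₀-orbit-nonzero d (Hφ.h-≢0 x≢0)) ⟩
      x E.+ ι a E.* (E.1# E.* x E.⁻¹) E.+ φE (orbit d (frob x))
        ≡⟨ cong₂ (λ u v → x E.+ ι a E.* u E.+ v) (E.*-identityˡ (x E.⁻¹)) (φE-orbit d (Hφ.h-≢0 x≢0)) ⟩
      argument x E.+ orbitSum d (argument (frob x))
        ≡⟨ cong (λ z → argument x E.+ orbitSum d z) (frob-argument x) ⟨
      argument x E.+ orbitSum d (frob (argument x))
        ≡⟨ orbitSum-suc d (argument x) ⟨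
      orbitSum (suc d) (argument x) ∎

    iterate-argument : ∀ d x → iterate d (argument x) ≡ argument (iterate d x)
    iterate-argument zero    x = refl
    iterate-argument (suc d) x = trans (cong (iterate d) (frob-argument x)) (iterate-argument d (frob x))

    χF : List A → ℤ[ω]
    χF = F.χ a a≢0

    c₀-minimal : ∀ x → ι (F.c₀ (minimal x)) ≡ E.c₀ (orbit (period x) x)
    c₀-minimal x = trans (c₀-map (minimal x)) (cong E.c₀ (map-minimal x))

    c₀-minimal-nonzero : ∀ {x} → x ≢ E.0# → F.c₀ (minimal x) ≢ F.0#
    c₀-minimal-nonzero {x} x≢0 e = c₀-orbit-nonzero (period x) x≢0 (trans (sym (c₀-minimal x)) (trans (cong ι e) Hι.h-0))

    -- The relative trace of x + a/x runs through the Frobenius orbit n / `period x` times. This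
    -- repetition becomes the power of χ in `powerSum`.
    ι-φ-minimal : ∀ {x} → x ≢ E.0# → ι (suc (multiple x) F.⋆ φF (minimal x)) ≡ orbitSum n (argument x)
    ι-φ-minimal {x} x≢0 = begin
      ι (suc (multiple x) F.⋆ φF (minimal x))
        ≡⟨ Hι.h-⋆ (suc (multiple x)) (φF (minimal x)) ⟩
      suc (multiple x) E.⋆ ι (φF (minimal x))
        ≡⟨ cong (suc (multiple x) E.⋆_) (trans (ι-φ (minimal x) (c₀-minimal-nonzero x≢0))
             (trans (cong φE (map-minimal x)) (φE-orbit (period x) x≢0))) ⟩
      suc (multiple x) E.⋆ orbitSum (period x) (argument x)
        ≡⟨ orbitSum-* (suc (multiple x)) (period x) (argument x)
             (trans (iterate-argument (period x) x) (cong argument (iterate-period x))) ⟨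
      orbitSum (suc (multiple x) ℕ.* period x) (argument x)
        ≡⟨ cong (λ k → orbitSum k (argument x)) (proj₂ (period-∣ x)) ⟨
      orbitSum n (argument x) ∎

    ψ-argument : ∀ {x} → x ≢ E.0# → E.ψ (argument x) ≡ χF (minimal x) ℤω.^ suc (multiple x)
    ψ-argument {x} x≢0 = trans (ψ-descends (suc (multiple x) F.⋆ φF (minimal x)) (argument x) (ι-φ-minimal x≢0))
      (trans (F.ψ-⋆ (suc (multiple x)) (φF (minimal x)))
        (cong (ℤω._^ suc (multiple x)) (sym (F.χ-nonzero a a≢0 (minimal x) (c₀-minimal-nonzero x≢0)))))

    χ-minimal-0 : χF (minimal E.0#) ≡ ℤω.0#
    χ-minimal-0 = F.χ-zero a a≢0 (minimal E.0#) (Hι.h-injective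
      (trans (c₀-minimal E.0#) (trans (c₀-orbit-zero (pred (period E.0#))) (sym Hι.h-0))))

    -- Each term with x ≠ 0 is a power of χ at the minimal polynomial. At x = 0 that polynomial is
    -- X, where χ vanishes, while the Kloosterman sum has the term 1.
    kloosterman-extension : E.kloosterman (ι a) ιa≢0 ≡ F.S a a≢0 n n ℤω.+ ℤω.1#
    kloosterman-extension = begin
      ℤω.∑ E.elements (λ x → E.ψ (argument x))
        ≡⟨ ℤω.∑-cong E.elements (λ x → split x (x E.≟ E.0#)) ⟩
      ℤω.∑ E.elements (λ x → power (minimal x) (multiple x) ℤω.+ ℤω.[ x E.≟ E.0# ])
        ≡⟨ ℤω.∑-+ E.elements (λ x → power (minimal x) (multiple x)) (λ x → ℤω.[ x E.≟ E.0# ]) ⟩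
      ℤω.∑ E.elements (λ x → power (minimal x) (multiple x)) ℤω.+ ℤω.∑ E.elements (λ x → ℤω.[ x E.≟ E.0# ])
        ≡⟨ cong₂ ℤω._+_ (trans (sum-by-minimal ℤω.commutativeSemiring power)
             (ℤω.∑-cong∈ (F.primes n) (λ {P} P∈ → ℤω.∑-cong∈ (upTo n) (λ {k} k∈ → regroup P∈ k∈ (n ℕ.≟ suc k ℕ.* length P)))))
             (ℤω.∑-δ1 E._≟_ E.unique (E.complete E.0#)) ⟩
      F.S a a≢0 n n ℤω.+ ℤω.1# ∎
      where
      open EulerProduct K enumK ℤω.commutativeSemiring using (#_)
      power : List A → ℕ → ℤ[ω]
      power P k = χF P ℤω.^ suc k
      split : ∀ x (d : Dec (x ≡ E.0#)) → E.ψ (argument x) ≡ power (minimal x) (multiple x) ℤω.+ ℤω.[ d ]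
      split x (yes refl) = trans (trans (cong E.ψ (trans (E.+-identityˡ _) (trans (cong (ι a E.*_) E.0⁻¹) (E.zeroʳ (ι a))))) E.ψ-0)
        (sym (cong (ℤω._+ ℤω.1#) (trans (cong (ℤω._* (χF (minimal E.0#) ℤω.^ multiple E.0#)) χ-minimal-0)
          (ℤω.zeroˡ (χF (minimal E.0#) ℤω.^ multiple E.0#)))))
      split x (no x≢0) = trans (ψ-argument x≢0) (sym (ℤω.+-identityʳ _))
      regroup : ∀ {P k} → P ∈ F.primes n → k ∈ upTo n → (d : Dec (n ≡ suc k ℕ.* length P)) →
        ℤω.[ d ] ℤω.* (# count P ℤω.* power P k) ≡ ℤω.[ d ] ℤω.* (# length P ℤω.* power P k)
      regroup {P} {k} P∈ k∈ (yes e) = cong (λ c → ℤω.1# ℤω.* (# c ℤω.* power P k)) (count≡length P∈ (∈.∈-upTo⁻ k∈) e)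
      regroup {P} {k} P∈ k∈ (no _)  = trans (ℤω.zeroˡ (# count P ℤω.* power P k)) (sym (ℤω.zeroˡ (# length P ℤω.* power P k)))

-- 3-adic valuations

module ThreeAdic where
  open import Data.Integer.Base using (_+_; _*_; _-_; -_; +_; _^_)

  3ℤ : ℤ
  3ℤ = + 3

  3∣ : ℤ → Set
  3∣ i = 3ℤ ℤ∣.∣ i

  ∣-+ : ∀ {i j} → 3∣ i → 3∣ j → 3∣ (i + j)
  ∣-+ = ℤ∣.∣m∣n⇒∣m+n

  ∣-*ʳ : ∀ {i} j → 3∣ i → 3∣ (i * j)
  ∣-*ʳ j = ℤ∣.∣m⇒∣m*n j

  ∣-neg : ∀ {i} → 3∣ i → 3∣ (- i)
  ∣-neg = ℤ∣.∣m⇒∣-m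

  3∤1 : ¬ 3∣ 1ℤ
  3∤1 d with ℕ∣.∣⇒≤ (ℤ∣.∣⇒∣ᵤ d)
  ... | s≤s ()

  3∤-cong : ∀ {i j} → 3∣ (i - j) → ¬ 3∣ j → ¬ 3∣ i
  3∤-cong {i} {j} d ¬3∣j 3∣i = ¬3∣j (subst 3∣ (lemma i j) (∣-+ 3∣i (∣-neg d)))
    where
    lemma : ∀ i j → i + - (i - j) ≡ j
    lemma = solve-∀

  3∤* : ∀ {i j} → ¬ 3∣ i → ¬ 3∣ j → ¬ 3∣ (i * j)
  3∤* {i} {j} ¬i ¬j d = Sum.[ ¬i ∘ ℤ∣.∣ᵤ⇒∣ , ¬j ∘ ℤ∣.∣ᵤ⇒∣ ]′
    (euclidsLemma ∣ i ∣ ∣ j ∣ (from-yes (prime? 3)) (subst (3 ℕ∣.∣_) (ℤ.abs-* i j) (ℤ∣.∣⇒∣ᵤ d)))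

  3^ℤ : ℕ → ℤ
  3^ℤ e = + (3 ℕ.^ e)

  3^-suc : ∀ e → 3^ℤ (suc e) ≡ 3ℤ * 3^ℤ e
  3^-suc e = ℤ.pos-* 3 (3 ℕ.^ e)

  3^-+ : ∀ d e → 3^ℤ (d ℕ.+ e) ≡ 3^ℤ d * 3^ℤ e
  3^-+ d e = trans (cong +_ (ℕ.^-distribˡ-+-* 3 d e)) (ℤ.pos-* (3 ℕ.^ d) (3 ℕ.^ e))

  3∣3^ : ∀ {e} → 0 < e → 3∣ (3^ℤ e)
  3∣3^ {suc e} _ = divides (3^ℤ e) (trans (3^-suc e) (ℤ.*-comm 3ℤ (3^ℤ e)))

  record ExactPower (e : ℕ) (i : ℤ) : Set where
    field
      unit  : ℤ
      eq    : i ≡ 3^ℤ e * unit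
      prime : ¬ 3∣ unit

  exact-* : ∀ {d e i j} → ExactPower d i → ExactPower e j → ExactPower (d ℕ.+ e) (i * j)
  exact-* {d} {e} p q = record
    { unit = P.unit * Q.unit
    ; eq = trans (cong₂ _*_ P.eq Q.eq) (trans (lemma (3^ℤ d) P.unit (3^ℤ e) Q.unit) (cong (_* (P.unit * Q.unit)) (sym (3^-+ d e))))
    ; prime = 3∤* P.prime Q.prime }
    where
    module P = ExactPower p
    module Q = ExactPower q
    lemma : ∀ a u b v → a * u * (b * v) ≡ a * b * (u * v)
    lemma = solve-∀

  exact-≤ : ∀ d e {u v} → 3^ℤ d * u ≡ 3^ℤ e * v → ¬ 3∣ u → e ≤ d
  exact-≤ d       zero    _  _  = z≤n
  exact-≤ zero    (suc e) {u} {v} eq ¬u = contradiction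
    (subst 3∣ (trans (sym eq) (ℤ.*-identityˡ u)) (∣-*ʳ v (3∣3^ {suc e} (s≤s z≤n)))) ¬u
  exact-≤ (suc d) (suc e) {u} {v} eq ¬u = s≤s (exact-≤ d e (ℤ.*-cancelˡ-≡ 3ℤ (3^ℤ d * u) (3^ℤ e * v)
    (trans (sym (shift d u)) (trans eq (shift e v)))) ¬u)
    where
    shift : ∀ d u → 3^ℤ (suc d) * u ≡ 3ℤ * (3^ℤ d * u)
    shift d u = trans (cong (_* u) (3^-suc d)) (ℤ.*-assoc 3ℤ (3^ℤ d) u)

  exact-unique : ∀ {d e i} → ExactPower d i → ExactPower e i → d ≡ e
  exact-unique {d} {e} p q = ℕ.≤-antisym
    (exact-≤ e d (trans (sym Q.eq) P.eq) Q.prime) (exact-≤ d e (trans (sym P.eq) Q.eq) P.prime)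
    where
    module P = ExactPower p
    module Q = ExactPower q

  -- Adding 3^M makes the convention for a vanishing sum uniform.
  exponentOr-exact : ∀ M k → ∣ k ∣ < 3 ℕ.^ M → ExactPower (exponentOr M (Eisenstein.fromℤ k)) (3^ℤ M + k)
  exponentOr-exact M k |k|< with Eisenstein.fromℤ k Eisenstein.≟ Eisenstein.0#
  ... | yes k≡0 = record { unit = 1ℤ ; eq = trans (cong (λ z → 3^ℤ M + re z) k≡0)
                           (trans (ℤ.+-identityʳ (3^ℤ M)) (sym (ℤ.*-identityʳ (3^ℤ M)))) ; prime = 3∤1 }
  ... | no k≢0 with largestPower (Eisenstein.fromℤ k) k≢0
  ...   | e , record { holds = (x +ω y) Eisenstein., eq ; greatest = greatest } = record
    { unit = 3^ℤ (M ∸ e) + x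
    ; eq = trans (cong₂ _+_ (trans (cong 3^ℤ (sym (ℕ.m+[n∸m]≡n (ℕ.<⇒≤ e<M)))) (3^-+ e (M ∸ e))) k≡) (sym (ℤ.*-distribˡ-+ (3^ℤ e) (3^ℤ (M ∸ e)) x))
    ; prime = 3∤-cong (subst 3∣ (sym (add-sub (3^ℤ (M ∸ e)) x)) (3∣3^ (ℕ.m<n⇒0<n∸m e<M))) 3∤x }
    where
    add-sub : ∀ i j → i + j - j ≡ i
    add-sub = solve-∀
    drop : ∀ x y z → x * z - y * 0ℤ ≡ z * x
    drop = solve-∀
    k≡ : k ≡ 3^ℤ e * x
    k≡ = trans (sym (cong re eq)) (drop x y (3^ℤ e))
    3∤x : ¬ 3∣ x
    3∤x (divides w x≡) = ℕ.<-irrefl refl (greatest (suc e) (Eisenstein.fromℤ w Eisenstein., cong₂ _+ω_ real (imaginary w (3^ℤ (suc e)))))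
      where
      imaginary : ∀ w z → w * 0ℤ + 0ℤ * z - 0ℤ * 0ℤ ≡ 0ℤ
      imaginary = solve-∀
      rearrange : ∀ w z → w * (3ℤ * z) - 0ℤ * 0ℤ ≡ z * (w * 3ℤ)
      rearrange = solve-∀
      real : w * 3^ℤ (suc e) - 0ℤ * 0ℤ ≡ k
      real = trans (cong (λ z → w * z - 0ℤ * 0ℤ) (3^-suc e)) (trans (rearrange w (3^ℤ e))
        (trans (cong (3^ℤ e *_) (sym x≡)) (sym k≡)))
    x≢0 : ∣ x ∣ ≢ 0
    x≢0 e = 3∤x (subst 3∣ (sym (ℤ.∣i∣≡0⇒i≡0 e)) (divides 0ℤ refl))
    -- As x ≠ 0, 3^e ≤ |k| < 3^M. Hence 3^(M - e) is a multiple of 3, and adding it to x keeps the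
    -- cofactor prime to 3.
    e<M : e < M
    e<M = ℕ.≰⇒> λ M≤e → ℕ.<-irrefl refl (ℕ.<-≤-trans |k|< (ℕ.≤-trans (ℕ.^-monoʳ-≤ 3 M≤e)
      (subst (3 ℕ.^ e ≤_) (sym (trans (cong ∣_∣ k≡) (ℤ.abs-* (3^ℤ e) x))) (ℕ.m≤m*n (3 ℕ.^ e) ∣ x ∣ ⦃ ℕ.≢-nonZero x≢0 ⦄))))

  -- t j = α^j + β^j and N j = (1 - α^j)(1 - β^j), for α + β = 1 - k and αβ = Q.
  module Lucas (Q k : ℤ) where

    t : ℕ → ℤ
    t 0             = + 2
    t 1             = 1ℤ - k
    t (suc (suc j)) = (1ℤ - k) * t (suc j) - Q * t j

    N : ℕ → ℤ
    N j = 1ℤ + Q ^ j - t j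

    -- The quotients N_j / N_1. The sequence N satisfies the recurrence of t up to the inhomogeneous
    -- term (Q + k)(1 + Q^(j+1)), and N_1 = Q + k is divided out of it.
    U : ℕ → ℤ
    U 0             = 0ℤ
    U 1             = 1ℤ
    U (suc (suc j)) = (1ℤ - k) * U (suc j) - Q * U j + (1ℤ + Q * Q ^ j)

    N≡N₁*U : ∀ j → N j ≡ (Q + k) * U j
    N≡N₁*U 0 = sym (ℤ.*-zeroʳ (Q + k))
    N≡N₁*U 1 = lemma Q k
      where
      lemma : ∀ Q k → 1ℤ + Q * 1ℤ - (1ℤ - k) ≡ (Q + k) * 1ℤ
      lemma = solve-∀
    N≡N₁*U (suc (suc j)) = trans (split Q k (Q ^ j) (t (suc j)) (t j))
      (trans (cong₂ (λ x y → (1ℤ - k) * x - Q * y + (Q + k) * (1ℤ + Q * Q ^ j)) (N≡N₁*U (suc j)) (N≡N₁*U j))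
        (merge Q k (Q ^ j) (U (suc j)) (U j)))
      where
      split : ∀ Q k P x y → 1ℤ + Q * (Q * P) - ((1ℤ - k) * x - Q * y) ≡
        (1ℤ - k) * (1ℤ + Q * P - x) - Q * (1ℤ + P - y) + (Q + k) * (1ℤ + Q * P)
      split = solve-∀
      merge : ∀ Q k P u v → (1ℤ - k) * ((Q + k) * u) - Q * ((Q + k) * v) + (Q + k) * (1ℤ + Q * P) ≡
        (Q + k) * ((1ℤ - k) * u - Q * v + (1ℤ + Q * P))
      merge = solve-∀

    -- The product of two sums of powers of α and β, multiplied out. Indices i and i + j avoid
    -- subtraction, and the recurrence in i replaces α and β, which are not integers in general.
    addition : ∀ i j → t i * t (i ℕ.+ j) ≡ t (i ℕ.+ (i ℕ.+ j)) + Q ^ i * t j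
    addition 0 j = lemma (t j)
      where
      lemma : ∀ x → + 2 * x ≡ x + 1ℤ * x
      lemma = solve-∀
    addition 1 j = lemma (1ℤ - k) Q (t (suc j)) (t j)
      where
      lemma : ∀ s Q x y → s * x ≡ s * x - Q * y + Q * 1ℤ * y
      lemma = solve-∀
    addition (suc (suc i)) j = begin
      (s * t (suc i) - Q * t i) * t (2 ℕ.+ (i ℕ.+ j))
        ≡⟨ expand s Q (t (suc i)) (t i) (t (2 ℕ.+ (i ℕ.+ j))) ⟩
      s * (t (suc i) * t (2 ℕ.+ (i ℕ.+ j))) - Q * (t i * t (2 ℕ.+ (i ℕ.+ j)))
        ≡⟨ cong₂ (λ x y → s * x - Q * y)
             (trans (cong (λ x → t (suc i) * t (suc x)) (sym (ℕ.+-suc i j))) (addition (suc i) (suc j)))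
             (trans (cong (λ x → t i * t x) i+2+j) (addition i (2 ℕ.+ j))) ⟩
      s * (t (suc i ℕ.+ (suc i ℕ.+ suc j)) + Q * Q ^ i * t (suc j)) - Q * (t (i ℕ.+ (i ℕ.+ (2 ℕ.+ j))) + Q ^ i * t (2 ℕ.+ j))
        ≡⟨ cong₂ (λ x y → s * (t x + Q * Q ^ i * t (suc j)) - Q * (t y + Q ^ i * t (2 ℕ.+ j))) idx₁ idx₂ ⟩
      s * (t (3 ℕ.+ l) + Q * Q ^ i * t (suc j)) - Q * (t (2 ℕ.+ l) + Q ^ i * t (2 ℕ.+ j))
        ≡⟨ collect s Q (Q ^ i) (t (3 ℕ.+ l)) (t (2 ℕ.+ l)) (t (suc j)) (t j) ⟩
      t (4 ℕ.+ l) + Q * (Q * Q ^ i) * t j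
        ≡⟨ cong (λ x → t x + Q * (Q * Q ^ i) * t j) idx₃ ⟨
      t (2 ℕ.+ i ℕ.+ (2 ℕ.+ i ℕ.+ j)) + Q * (Q * Q ^ i) * t j ∎
      where
      open ≡.≡-Reasoning
      s = 1ℤ - k
      l = i ℕ.+ (i ℕ.+ j)
      i+2+j : 2 ℕ.+ (i ℕ.+ j) ≡ i ℕ.+ (2 ℕ.+ j)
      i+2+j = sym (trans (ℕ.+-suc i (suc j)) (cong suc (ℕ.+-suc i j)))
      idx₂ : i ℕ.+ (i ℕ.+ (2 ℕ.+ j)) ≡ 2 ℕ.+ l
      idx₂ = trans (cong (i ℕ.+_) (sym i+2+j)) (trans (ℕ.+-suc i _) (cong suc (ℕ.+-suc i _)))
      idx₁ : suc i ℕ.+ (suc i ℕ.+ suc j) ≡ 3 ℕ.+ l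
      idx₁ = cong suc (trans (cong (λ x → i ℕ.+ suc x) (ℕ.+-suc i j)) (trans (ℕ.+-suc i _) (cong suc (ℕ.+-suc i _))))
      idx₃ : 2 ℕ.+ i ℕ.+ (2 ℕ.+ i ℕ.+ j) ≡ 4 ℕ.+ l
      idx₃ = cong (2 ℕ.+_) (trans (ℕ.+-suc i _) (cong suc (ℕ.+-suc i _)))
      expand : ∀ s Q x y z → (s * x - Q * y) * z ≡ s * (x * z) - Q * (y * z)
      expand = solve-∀
      collect : ∀ s Q P x y z w → s * (x + Q * P * z) - Q * (y + P * (s * z - Q * w)) ≡
                s * x - Q * y + Q * (Q * P) * w
      collect = solve-∀

    -- The cofactor is (1 + x + x²)(1 + y + y²) at x = α^i and y = β^i, written in x + y = `t i` and
    -- xy = Q^i: it comes from the factorization of 1 - x³.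
    triple : ∀ i → N (3 ℕ.* i) ≡ N i * (1ℤ + t i + t i * t i - Q ^ i + Q ^ i * t i + Q ^ i * Q ^ i)
    triple i = begin
      1ℤ + Q ^ (3 ℕ.* i) - t (3 ℕ.* i)
        ≡⟨ cong₂ (λ x y → 1ℤ + x - y) Q³ t³ ⟩
      1ℤ + Q ^ i * (Q ^ i * Q ^ i) - (t i * (t i * t i - Q ^ i * + 2) - Q ^ i * t i)
        ≡⟨ factor (t i) (Q ^ i) ⟩
      N i * (1ℤ + t i + t i * t i - Q ^ i + Q ^ i * t i + Q ^ i * Q ^ i) ∎
      where
      open ≡.≡-Reasoning
      factor : ∀ T P → 1ℤ + P * (P * P) - (T * (T * T - P * + 2) - P * T) ≡
               (1ℤ + P - T) * (1ℤ + T + T * T - P + P * T + P * P)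
      factor = solve-∀
      solve-for : ∀ x y z → x ≡ y + z → y ≡ x - z
      solve-for x y z refl = sym (lemma y z)
        where
        lemma : ∀ y z → y + z - z ≡ y
        lemma = solve-∀
      i+i : i ℕ.+ (i ℕ.+ 0) ≡ i ℕ.+ i
      i+i = cong (i ℕ.+_) (ℕ.+-identityʳ i)
      t² : t (i ℕ.+ i) ≡ t i * t i - Q ^ i * + 2
      t² = trans (cong t (sym i+i)) (trans (solve-for _ _ _ (addition i 0)) (cong (λ x → t i * t x - Q ^ i * + 2) (ℕ.+-identityʳ i)))
      t³ : t (3 ℕ.* i) ≡ t i * (t i * t i - Q ^ i * + 2) - Q ^ i * t i
      t³ = trans (cong (λ x → t (i ℕ.+ x)) i+i) (trans (solve-for _ _ _ (addition i i)) (cong (λ x → t i * x - Q ^ i * t i) t²))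
      Q³ : Q ^ (3 ℕ.* i) ≡ Q ^ i * (Q ^ i * Q ^ i)
      Q³ = trans (cong (λ x → Q ^ (i ℕ.+ x)) i+i) (trans (ℤ.^-distribˡ-+-* Q i (i ℕ.+ i)) (cong (Q ^ i *_) (ℤ.^-distribˡ-+-* Q i i)))

    module _ (3∣k : 3∣ k) (9∣Q : + 9 ℤ∣.∣ Q) where

      3∣Q : 3∣ Q
      3∣Q = ℤ∣.∣-trans (divides 3ℤ refl) 9∣Q

      -- Modulo 3 both k and Q vanish, and the recurrence becomes U_{j+2} = U_{j+1} + 1.
      U≡ : ∀ j → 3∣ (U j - + j)
      U≡ 0 = divides 0ℤ refl
      U≡ 1 = divides 0ℤ refl
      U≡ (suc (suc j)) = subst 3∣ (lemma k Q (U (suc j)) (U j) (Q ^ j) (+ suc j))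
        (∣-+ (∣-+ (U≡ (suc j)) (∣-neg (∣-*ʳ (U (suc j)) 3∣k))) (∣-*ʳ (Q ^ j - U j) 3∣Q))
        where
        lemma : ∀ k Q u v P j → u - j + - (k * u) + Q * (P - v) ≡
          (1ℤ - k) * u - Q * v + (1ℤ + Q * P) - (1ℤ + j)
        lemma = solve-∀

      exact-multiple : ∀ {e} s → ¬ 3∣ (+ s) → ExactPower e (Q + k) → ExactPower e (N s)
      exact-multiple {e} s 3∤s p = record
        { unit = unit * U s
        ; eq = trans (N≡N₁*U s) (trans (cong (_* U s) eq) (ℤ.*-assoc (3^ℤ e) unit (U s)))
        ; prime = 3∤* prime (3∤-cong (U≡ s) 3∤s) }
        where open ExactPower p

      -- The cofactor in `triple` contains exactly one factor 3: for t_i = 1 + 3v and Q^i = 9p it is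
      -- 3 (1 + 3w). Positivity of i gives 9 ∣ Q^i.
      exact-triple : ∀ {e i} → 0 < i → ExactPower e (N i) → ExactPower (suc e) (N (3 ℕ.* i))
      exact-triple {e} {i@(suc j)} _ p = subst₂ ExactPower (ℕ.+-comm e 1) (sym (triple i)) (exact-* p cofactor)
        where
        open ExactPower p
        P = Q ^ i
        9∣P : + 9 ℤ∣.∣ P
        9∣P = ℤ∣.∣m⇒∣m*n (Q ^ j) 9∣Q
        -- N_i is a multiple of Q + k, hence of 3, and t_i - 1 = Q^i - N_i.
        3∣t-1 : 3∣ (t i - 1ℤ)
        3∣t-1 = subst 3∣ (trans (cong (λ x → P + - x) (sym (N≡N₁*U i))) (lemma P (t i)))
          (∣-+ (∣-*ʳ (Q ^ j) 3∣Q) (∣-neg (∣-*ʳ (U i) (∣-+ 3∣Q 3∣k))))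
          where
          lemma : ∀ P T → P + - (1ℤ + P - T) ≡ T - 1ℤ
          lemma = solve-∀
        cofactor : ExactPower 1 (1ℤ + t i + t i * t i - P + P * t i + P * P)
        cofactor with 9∣P | 3∣t-1
        ... | divides p P≡ | divides v t≡ = record
          { unit = 1ℤ + 3ℤ * w
          ; eq = trans (cong₂ (λ T P → 1ℤ + T + T * T - P + P * T + P * P) T≡ P≡) (lemma v p)
          ; prime = 3∤-cong (subst 3∣ (sym (sub w)) (∣-*ʳ w (divides 1ℤ refl))) 3∤1 }
          where
          w = v + v * v + p * (v * 3ℤ + p * + 9)
          T≡ : t i ≡ 1ℤ + v * 3ℤ
          T≡ = trans (sym (add (t i))) (cong (λ x → 1ℤ + x) t≡)
            where
            add : ∀ T → 1ℤ + (T - 1ℤ) ≡ T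
            add = solve-∀
          sub : ∀ w → 1ℤ + 3ℤ * w - 1ℤ ≡ 3ℤ * w
          sub = solve-∀
          lemma : ∀ v p → let T = 1ℤ + v * 3ℤ ; P = p * + 9 in
            1ℤ + T + T * T - P + P * T + P * P ≡
            3ℤ * (1ℤ + 3ℤ * (v + v * v + p * (v * 3ℤ + p * + 9)))
          lemma = solve-∀

      exact-N : ∀ {e} h s → ¬ 3∣ (+ s) → 0 < s → ExactPower e (Q + k) → ExactPower (e ℕ.+ h) (N (3 ℕ.^ h ℕ.* s))
      exact-N {e} zero    s 3∤s 0<s p = subst₂ ExactPower (sym (ℕ.+-identityʳ e)) (cong N (sym (ℕ.+-identityʳ s))) (exact-multiple s 3∤s p)
      exact-N {e} (suc h) s 3∤s 0<s p = subst₂ ExactPower (sym (ℕ.+-suc e h)) (cong N (sym (ℕ.*-assoc 3 (3 ℕ.^ h) s)))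
        (exact-triple (ℕ.*-mono-≤ (ℕ.m^n>0 3 h) 0<s) (exact-N h s 3∤s 0<s p))

-- Integrality, residue and size of Kloosterman sums

open ThreeAdic

-- Complex conjugation, which sends ω to ω² = -1 - ω.
conj : ℤ[ω] → ℤ[ω]
conj (a +ω b) = (a ℤ.- b) +ω (ℤ.- b)

conj-+ : ∀ x y → conj (x ℤω.+ y) ≡ conj x ℤω.+ conj y
conj-+ (a +ω b) (c +ω d) = cong₂ _+ω_ (lemma a b c d) (ℤ.neg-distrib-+ b d)
  where
  lemma : ∀ a b c d → a ℤ.+ c ℤ.- (b ℤ.+ d) ≡ a ℤ.- b ℤ.+ (c ℤ.- d)
  lemma = solve-∀

conj-∑ : ∀ {C : Set} (xs : List C) f → conj (ℤω.∑ xs f) ≡ ℤω.∑ xs (conj ∘ f)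
conj-∑ []       f = refl
conj-∑ (x ∷ xs) f = trans (conj-+ (f x) (ℤω.∑ xs f)) (cong (conj (f x) ℤω.+_) (conj-∑ xs f))

conj-real : ∀ z → conj z ≡ z → z ≡ ℤω.fromℤ (re z)
conj-real (a +ω b) e = cong (a +ω_) (trans (sym (lemma a b)) (trans (cong (λ c → a ℤ.- c) (cong re e)) (ℤ.+-inverseʳ a)))
  where
  lemma : ∀ a b → a ℤ.- (a ℤ.- b) ≡ b
  lemma = solve-∀

data CubeRoot : ℤ[ω] → Set where
  one  : CubeRoot ℤω.1#
  root : CubeRoot ℤω.ω
  square : CubeRoot (ℤω.ω ℤω.^ 2)

-- Here `re` is the coefficient of 1 and not the real part: it is 1, 0, -1 at 1, ω, ω². On a sum
-- already known to be an integer it is the value.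
re≤1 : ∀ {z} → CubeRoot z → re z ℤ.≤ 1ℤ
re≤1 one    = ℤ.≤-refl
re≤1 root   = ℤ.+≤+ z≤n
re≤1 square = ℤ.-≤+

-re≤1 : ∀ {z} → CubeRoot z → ℤ.- re z ℤ.≤ 1ℤ
-re≤1 one    = ℤ.-≤+
-re≤1 root   = ℤ.+≤+ z≤n
-re≤1 square = ℤ.≤-refl

re≤0 : ∀ {z} → CubeRoot z → z ≢ ℤω.1# → re z ℤ.≤ 0ℤ
re≤0 one    ne = contradiction refl ne
re≤0 root   _  = ℤ.+≤+ z≤n
re≤0 square _  = ℤ.-≤+

-- The reduction modulo 1 - ω.
re+im : ∀ {z} → CubeRoot z → 3∣ (re z ℤ.+ im z ℤ.- 1ℤ)
re+im one    = divides 0ℤ refl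
re+im root   = divides 0ℤ refl
re+im square = divides (ℤ.- 1ℤ) refl

-- An arbitrary additive g covers `re` and its negative, for the upper and the lower bound.
additive-∑-≤ : ∀ {C : Set} (g : ℤ[ω] → ℤ) → (∀ x y → g (x ℤω.+ y) ≡ g x ℤ.+ g y) → g ℤω.0# ≡ 0ℤ →
         ∀ (xs : List C) f → (∀ x → g (f x) ℤ.≤ 1ℤ) → g (ℤω.∑ xs f) ℤ.≤ ℤ.+ length xs
additive-∑-≤ g g-+ g-0 []       f le = ℤ.≤-reflexive g-0
additive-∑-≤ g g-+ g-0 (x ∷ xs) f le = ℤ.≤-trans (ℤ.≤-reflexive (g-+ (f x) (ℤω.∑ xs f)))
  (ℤ.+-mono-≤ (le x) (additive-∑-≤ g g-+ g-0 xs f le))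

additive-∑-< : ∀ {C : Set} (g : ℤ[ω] → ℤ) → (∀ x y → g (x ℤω.+ y) ≡ g x ℤ.+ g y) → g ℤω.0# ≡ 0ℤ →
         ∀ {xs : List C} {y} f → (∀ x → g (f x) ℤ.≤ 1ℤ) → y ∈ xs → g (f y) ℤ.≤ 0ℤ → g (ℤω.∑ xs f) ℤ.< ℤ.+ length xs
additive-∑-< g g-+ g-0 {x ∷ xs} f le (here refl) le0 = ℤ.≤-<-trans (ℤ.≤-reflexive (g-+ (f x) (ℤω.∑ xs f)))
  (ℤ.≤-<-trans (ℤ.+-mono-≤ le0 (additive-∑-≤ g g-+ g-0 xs f le))
    (ℤ.≤-<-trans (ℤ.≤-reflexive (ℤ.+-identityˡ _)) (ℤ.+<+ ℕ.≤-refl)))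
additive-∑-< g g-+ g-0 {x ∷ xs} f le (there y∈) le0 = ℤ.≤-<-trans (ℤ.≤-reflexive (g-+ (f x) (ℤω.∑ xs f)))
  (ℤ.+-mono-≤-< (le x) (additive-∑-< g g-+ g-0 f le y∈ le0))

re+im-∑ : ∀ {C : Set} (xs : List C) f → (∀ x → CubeRoot (f x)) →
          3∣ (re (ℤω.∑ xs f) ℤ.+ im (ℤω.∑ xs f) ℤ.- ℤ.+ length xs)
re+im-∑ []       f _ = divides 0ℤ refl
re+im-∑ (x ∷ xs) f r = subst 3∣ (lemma (re (f x)) (re (ℤω.∑ xs f)) (im (f x)) (im (ℤω.∑ xs f)) (ℤ.+ length xs))
  (∣-+ (re+im (r x)) (re+im-∑ xs f r))
  where
  lemma : ∀ a b c d n → a ℤ.+ c ℤ.- 1ℤ ℤ.+ (b ℤ.+ d ℤ.- n) ≡ a ℤ.+ b ℤ.+ (c ℤ.+ d) ℤ.- (1ℤ ℤ.+ n)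
  lemma = solve-∀

∣∣< : ∀ i n → i ℤ.< ℤ.+ n → ℤ.- i ℤ.< ℤ.+ n → ∣ i ∣ < n
∣∣< (ℤ.+ i)      n i<n _     = ℤ.drop‿+<+ i<n
∣∣< ℤ.-[1+ i ] n _   -i<n  = ℤ.drop‿+<+ -i<n

module KloostermanValue {A : Set} (K : DiscreteField A) (enum : Enumeration A)
    (M : ℕ) (0<M : 0 < M) (order : length (Enumeration.elements enum) ≡ 3 ℕ.^ M)
    (a : A) (a≢0 : a ≢ DiscreteField.0# K) where
  open KloostermanCharacter K enum M 0<M order
  open ≡.≡-Reasoning
  private module S = IntegerCoefficientSolver commutativeRing
  open S using (solve; con; _:+_; _:*_; _:=_; :-_; _:-_)

  conj-ζ : ∀ {t} → Trit t → conj (ζ t) ≡ ζ (- t)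
  conj-ζ t0 = trans (cong conj ζ-0) (sym (trans (cong ζ (solve 0 (:- con 0ℤ := con 0ℤ) refl)) ζ-0))
  conj-ζ t1 = trans (cong conj ζ-1) (sym ζ-2)
  conj-ζ t2 = trans (cong conj ζ-2) (sym (trans (cong ζ (-‿involutive 1#)) ζ-1))

  conj-ψ : ∀ x → conj (ψ x) ≡ ψ (- x)
  conj-ψ x = trans (conj-ζ (trit-tr x)) (cong ζ (sym (tr-neg x)))

  -0≡0 : - 0# ≡ 0#
  -0≡0 = solve 0 (:- con 0ℤ := con 0ℤ) refl

  neg-⁻¹ : ∀ x → (- x) ⁻¹ ≡ - x ⁻¹
  neg-⁻¹ x = cases (x ≟ 0#)
    where
    cases : Dec (x ≡ 0#) → (- x) ⁻¹ ≡ - x ⁻¹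
    cases (yes refl) = trans (cong _⁻¹ -0≡0) (trans 0⁻¹ (sym (trans (cong -_ 0⁻¹) -0≡0)))
    cases (no x≢0) = *-cancelˡ -x≢0 (trans (x*x⁻¹ -x≢0) (sym (trans (solve 2 (λ x y → :- x :* :- y := x :* y) refl x (x ⁻¹)) (x*x⁻¹ x≢0))))
      where
      -x≢0 : - x ≢ 0#
      -x≢0 e = x≢0 (trans (sym (-‿involutive x)) (trans (cong -_ e) -0≡0))

  value : ℤ
  value = re (kloosterman a a≢0)

  -- Conjugation sends the term at x to the term at -x, because x + a/x is odd; so it only permutes
  -- the terms.
  kloosterman-real : kloosterman a a≢0 ≡ ℤω.fromℤ value
  kloosterman-real = conj-real _ (begin
    conj (ℤω.∑ elements (λ x → ψ (x + a * x ⁻¹)))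
      ≡⟨ conj-∑ elements _ ⟩
    ℤω.∑ elements (λ x → conj (ψ (x + a * x ⁻¹)))
      ≡⟨ ℤω.∑-cong elements (λ x → trans (conj-ψ _) (cong ψ (trans
           (solve 3 (λ x a y → :- (x :+ a :* y) := :- x :+ a :* :- y) refl x a (x ⁻¹))
           (cong (λ z → - x + a * z) (sym (neg-⁻¹ x)))))) ⟩
    ℤω.∑ elements (λ x → ψ (- x + a * (- x) ⁻¹))
      ≡⟨ ℤω.∑-reindex _≟_ _≟_ unique unique -_ -_ (λ _ → complete _) (λ _ → complete _)
           (λ _ → -‿involutive _) (λ _ → -‿involutive _) (λ x → ψ (x + a * x ⁻¹)) ⟩
    ℤω.∑ elements (λ x → ψ (x + a * x ⁻¹)) ∎)

  ζ-cubeRoot : ∀ {t} → Trit t → CubeRoot (ζ t)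
  ζ-cubeRoot t0 = subst CubeRoot (sym ζ-0) one
  ζ-cubeRoot t1 = subst CubeRoot (sym ζ-1) root
  ζ-cubeRoot t2 = subst CubeRoot (sym ζ-2) square

  ψ-cubeRoot : ∀ x → CubeRoot (ψ x)
  ψ-cubeRoot x = ζ-cubeRoot (trit-tr x)

  ζ≢1 : ∀ {t} → Trit t → t ≢ 0# → ζ t ≢ ℤω.1#
  ζ≢1 t0 ne _ = ne refl
  ζ≢1 t1 _  e with () ← trans (sym ζ-1) e
  ζ≢1 t2 _  e with () ← trans (sym ζ-2) e

  -- Every cube root of unity is 1 modulo 1 - ω, so the sum of q of them reduces to q, a multiple of
  -- 3.
  3∣value : 3∣ value
  3∣value = subst 3∣ (lemma value (ℤ.+ q)) (∣-+ (subst (λ z → 3∣ (z ℤ.- ℤ.+ q)) (trans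
      (cong (λ z → value ℤ.+ im z) kloosterman-real) (ℤ.+-identityʳ value)) (re+im-∑ elements _ (λ x → ψ-cubeRoot _)))
    (subst (λ z → 3∣ (ℤ.+ z)) (sym order) (3∣3^ 0<M)))
    where
    lemma : ∀ i j → i ℤ.- j ℤ.+ j ≡ i
    lemma = solve-∀

  ∣value∣<q : 2 ≤ M → ∣ value ∣ < 3 ℕ.^ M
  ∣value∣<q 2≤M = subst (∣ value ∣ <_) order (∣∣< value q
    (additive-∑-< re (λ _ _ → refl) refl (λ x → ψ (x + a * x ⁻¹)) (λ x → re≤1 (ψ-cubeRoot (x + a * x ⁻¹))) (complete (proj₁ nonzeroTrace))
      (re≤0 (ψ-cubeRoot _) (ζ≢1 (trit-tr _) (proj₂ nonzeroTrace))))
    -- For the lower bound the term that makes the inequality strict is the one at x = 0, where the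
    -- negated coefficient is -1.
    (additive-∑-< (λ z → ℤ.- re z) (λ x y → ℤ.neg-distrib-+ (re x) (re y)) refl (λ x → ψ (x + a * x ⁻¹))
      (λ x → -re≤1 (ψ-cubeRoot (x + a * x ⁻¹))) (complete 0#)
      (subst (λ z → ℤ.- re z ℤ.≤ 0ℤ) (sym ψ-at-0) ℤ.-≤+)))
    where
    nonzeroTrace = tr-kloosterman-nonzero 2≤M a
    ψ-at-0 : ψ (0# + a * 0# ⁻¹) ≡ ℤω.1#
    ψ-at-0 = trans (cong ψ (trans (+-identityˡ _) (trans (cong (a *_) 0⁻¹) (zeroʳ a)))) ψ-0

-- Kloosterman sums of the extension as a Lucas sequence

module KloostermanExtension {A B : Set} (K : DiscreteField A) (enumK : Enumeration A) (L : DiscreteField B) (enumL : Enumeration B)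
    (m n : ℕ) (2≤m : 2 ≤ m) (0<n : 0 < n)
    (orderK : length (Enumeration.elements enumK) ≡ 3 ℕ.^ m)
    (orderL : length (Enumeration.elements enumL) ≡ 3 ℕ.^ (m ℕ.* n))
    (ι : A → B)
    (ι-+ : ∀ x y → ι (DiscreteField._+_ K x y) ≡ DiscreteField._+_ L (ι x) (ι y))
    (ι-* : ∀ x y → ι (DiscreteField._*_ K x y) ≡ DiscreteField._*_ L (ι x) (ι y))
    (ι-1 : ι (DiscreteField.1# K) ≡ DiscreteField.1# L) where

  0<m : 0 < m
  0<m = ℕ.<⇒≤ 2≤m

  open FieldExtension K enumK L enumL m n 0<m 0<n orderK orderL ι ι-+ ι-* ι-1 public

  module _ (a : A) (a≢0 : a ≢ F.0#) where
    private
      module VF = KloostermanValue K enumK m 0<m orderK a a≢0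
      module VE = KloostermanValue L enumL (m ℕ.* n) 0<mn orderL (ι a) (ιa≢0 a a≢0)
      open EulerProduct K enumK ℤω.commutativeSemiring using (#_)
      open Sω using (solve; con; _:+_; _:*_; _:=_; :-_; _:-_)
    open Lucas (3^ℤ m) VF.value
    open import Data.Integer.Base using (_+_; _*_; _-_; -_; +_; _^_)
    open ≡.≡-Reasoning

    Sₙ : ℕ → ℤ[ω]
    Sₙ = F.S a a≢0 n

    A₁ : ℤ[ω]
    A₁ = F.Aₙ a a≢0 1

    #≡fromℤ : ∀ k → # k ≡ ℤω.fromℤ (+ k)
    #≡fromℤ zero    = refl
    #≡fromℤ (suc k) = cong (ℤω.1# ℤω.+_) (#≡fromℤ k)

    #q : # F.q ≡ ℤω.fromℤ (3^ℤ m)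
    #q = trans (#≡fromℤ F.q) (cong (λ k → ℤω.fromℤ (+ k)) orderK)

    A₁≡ : A₁ ≡ ℤω.fromℤ (- t 1)
    A₁≡ = begin
      A₁                                          ≡⟨ solve 1 (λ x → x := x :+ con 1ℤ :- con 1ℤ) refl A₁ ⟩
      A₁ ℤω.+ ℤω.1# ℤω.+ ℤω.- ℤω.1#               ≡⟨ cong (ℤω._+ ℤω.- ℤω.1#) (trans (sym (F.A₁ a a≢0)) VF.kloosterman-real) ⟩
      ℤω.fromℤ (VF.value + - 1ℤ)              ≡⟨ cong ℤω.fromℤ (lemma VF.value) ⟩
      ℤω.fromℤ (- t 1)                          ∎
      where
      lemma : ∀ k → k + - 1ℤ ≡ - (1ℤ - k)
      lemma = solve-∀

    S₁≡ : Sₙ 1 ≡ ℤω.fromℤ (- t 1)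
    S₁≡ = trans (sym (F.newton₁ a a≢0 n 0<n)) A₁≡

    S₂≡ : 2 ≤ n → Sₙ 2 ≡ ℤω.fromℤ (- t 2)
    S₂≡ 2≤n = begin
      Sₙ 2
        ≡⟨ solve 2 (λ x y → y := x :+ y :- x) refl (Sₙ 1 ℤω.* A₁) (Sₙ 2) ⟩
      Sₙ 1 ℤω.* A₁ ℤω.+ Sₙ 2 ℤω.+ ℤω.- (Sₙ 1 ℤω.* A₁)
        ≡⟨ cong₂ (λ x y → x ℤω.+ ℤω.- y) (trans (sym (F.newton₂ a a≢0 n 2≤n)) (cong ((ℤω.1# ℤω.+ ℤω.1#) ℤω.*_) #q)) (cong₂ ℤω._*_ S₁≡ A₁≡) ⟩
      (ℤω.1# ℤω.+ ℤω.1#) ℤω.* ℤω.fromℤ (3^ℤ m) ℤω.+ ℤω.- (ℤω.fromℤ (- t 1) ℤω.* ℤω.fromℤ (- t 1))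
        ≡⟨ cong₂ _+ω_ (real (3^ℤ m) (t 1)) (imaginary (3^ℤ m) (t 1)) ⟩
      ℤω.fromℤ (- t 2) ∎
      where
      real : ∀ q s → + 2 * q - 0ℤ * 0ℤ + - (- s * - s - 0ℤ * 0ℤ) ≡ - (s * s - q * + 2)
      real = solve-∀
      imaginary : ∀ q s → + 2 * 0ℤ + 0ℤ * q - 0ℤ * 0ℤ + - (- s * 0ℤ + 0ℤ * - s - 0ℤ * 0ℤ) ≡ 0ℤ
      imaginary = solve-∀

    S₃₊≡ : ∀ j → 3 ℕ.+ j ≤ n → Sₙ (1 ℕ.+ j) ≡ ℤω.fromℤ (- t (1 ℕ.+ j)) → Sₙ (2 ℕ.+ j) ≡ ℤω.fromℤ (- t (2 ℕ.+ j)) →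
           Sₙ (3 ℕ.+ j) ≡ ℤω.fromℤ (- t (3 ℕ.+ j))
    S₃₊≡ j le e e′ = begin
      Sₙ (3 ℕ.+ j)
        ≡⟨ solve 2 (λ x y → y := x :+ y :- x) refl (Sₙ (1 ℕ.+ j) ℤω.* # F.q ℤω.+ Sₙ (2 ℕ.+ j) ℤω.* A₁) (Sₙ (3 ℕ.+ j)) ⟩
      Sₙ (1 ℕ.+ j) ℤω.* # F.q ℤω.+ Sₙ (2 ℕ.+ j) ℤω.* A₁ ℤω.+ Sₙ (3 ℕ.+ j) ℤω.+ ℤω.- (Sₙ (1 ℕ.+ j) ℤω.* # F.q ℤω.+ Sₙ (2 ℕ.+ j) ℤω.* A₁)
        ≡⟨ cong₂ (λ x y → x ℤω.+ ℤω.- y) (F.newton₃₊ a a≢0 n j le) (cong₂ ℤω._+_ (cong₂ ℤω._*_ e #q) (cong₂ ℤω._*_ e′ A₁≡)) ⟩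
      ℤω.0# ℤω.+ ℤω.- (ℤω.fromℤ (- t (1 ℕ.+ j)) ℤω.* ℤω.fromℤ (3^ℤ m) ℤω.+ ℤω.fromℤ (- t (2 ℕ.+ j)) ℤω.* ℤω.fromℤ (- t 1))
        ≡⟨ cong₂ _+ω_ (real (3^ℤ m) (t 1) (t (1 ℕ.+ j)) (t (2 ℕ.+ j))) (imaginary (3^ℤ m) (t 1) (t (1 ℕ.+ j)) (t (2 ℕ.+ j))) ⟩
      ℤω.fromℤ (- t (3 ℕ.+ j)) ∎
      where
      real : ∀ q s x y → 0ℤ + - (- x * q - 0ℤ * 0ℤ + (- y * - s - 0ℤ * 0ℤ)) ≡ - (s * y - q * x)
      real = solve-∀
      imaginary : ∀ q s x y → 0ℤ + - (- x * 0ℤ + 0ℤ * q - 0ℤ * 0ℤ + (- y * 0ℤ + 0ℤ * - s - 0ℤ * 0ℤ)) ≡ 0ℤ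
      imaginary = solve-∀

    -- The minus sign is that of the logarithmic derivative of (1 - αT)(1 - βT). Newton's identities
    -- provide the two initial values and then the recurrence of `t`.
    powerSum≡ : ∀ j → suc j ≤ n → Sₙ (suc j) ≡ ℤω.fromℤ (- t (suc j))
    powerSum≡ 0 le = S₁≡
    powerSum≡ 1 le = S₂≡ le
    powerSum≡ (suc (suc j)) le = S₃₊≡ j le (powerSum≡ j (ℕ.≤-trans (ℕ.n≤1+n _) (ℕ.≤-trans (ℕ.n≤1+n _) le)))
      (powerSum≡ (suc j) (ℕ.≤-trans (ℕ.n≤1+n _) le))

    valueE≡ : VE.value ≡ 1ℤ - t n
    valueE≡ = begin
      VE.value                                 ≡⟨ cong re (kloosterman-extension a a≢0) ⟩
      re (Sₙ n) + 1ℤ                         ≡⟨ cong (λ k → re (Sₙ k) + 1ℤ) n≡ ⟨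
      re (Sₙ (suc (pred n))) + 1ℤ            ≡⟨ cong (λ z → re z + 1ℤ) (powerSum≡ (pred n) (ℕ.≤-reflexive n≡)) ⟩
      - t (suc (pred n)) + 1ℤ              ≡⟨ cong (λ k → - t k + 1ℤ) n≡ ⟩
      - t n + 1ℤ                           ≡⟨ ℤ.+-comm (- t n) 1ℤ ⟩
      1ℤ - t n                               ∎

    pos-^ : ∀ i k → (+ i) ^ k ≡ + (i ℕ.^ k)
    pos-^ i zero    = refl
    pos-^ i (suc k) = trans (cong ((+ i) ℤ.*_) (pos-^ i k)) (sym (ℤ.pos-* i (i ℕ.^ k)))

    N≡ : N n ≡ 3^ℤ (m ℕ.* n) + VE.value
    N≡ = begin
      1ℤ + (3^ℤ m) ^ n - t n             ≡⟨ cong (λ z → 1ℤ + z - t n) (trans (pos-^ (3 ℕ.^ m) n) (cong ℤ.+_ (ℕ.^-*-assoc 3 m n))) ⟩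
      1ℤ + 3^ℤ (m ℕ.* n) - t n             ≡⟨ lemma (3^ℤ (m ℕ.* n)) (t n) ⟩
      3^ℤ (m ℕ.* n) + (1ℤ - t n)           ≡⟨ cong (λ z → 3^ℤ (m ℕ.* n) + z) valueE≡ ⟨
      3^ℤ (m ℕ.* n) + VE.value               ∎
      where
      lemma : ∀ x y → 1ℤ + x - y ≡ x + (1ℤ - y)
      lemma = solve-∀

    9∣3^m : + 9 ℤ∣.∣ 3^ℤ m
    9∣3^m = divides (3^ℤ (m ∸ 2)) (trans (cong 3^ℤ (sym (ℕ.m∸n+n≡m 2≤m))) (3^-+ (m ∸ 2) 2))

    -- Both sides are the exponent of 3 in N_n: the left one because N_n = q^n + K_n(a), the right
    -- one by lifting from N_1 = q + K(a).
    exponent-extension : ∀ h s → ¬ 3∣ (+ s) → 0 < s → n ≡ 3 ℕ.^ h ℕ.* s →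
      exponentOr (m ℕ.* n) (E.kloosterman (ι a) (ιa≢0 a a≢0)) ≡ exponentOr m (F.kloosterman a a≢0) ℕ.+ h
    exponent-extension h s 3∤s 0<s n≡3^hs = trans (cong (exponentOr (m ℕ.* n)) VE.kloosterman-real)
      (trans (exact-unique
        (exponentOr-exact (m ℕ.* n) VE.value (VE.∣value∣<q (ℕ.≤-trans 2≤m (ℕ.m≤m*n m n ⦃ ℕ.>-nonZero 0<n ⦄))))
        (subst (ExactPower _) (trans (cong N (sym n≡3^hs)) N≡)
          (exact-N VF.3∣value 9∣3^m h s 3∤s 0<s (exponentOr-exact m VF.value (VF.∣value∣<q 2≤m)))))
        (cong (λ z → exponentOr m z ℕ.+ h) (sym VF.kloosterman-real)))

-- A finite field is replaced by its copy on Fin order, where equality is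
-- propositional.
module Transport {c ℓ₁ ℓ₂} {order : ℕ} (F : FiniteField c ℓ₁ ℓ₂ order) (1<order : 1 < order) where
  private
    module F where
      open FiniteField F public
      open CommutativeRing commutativeRing public using () renaming (refl to ≈-refl; sym to ≈-sym; trans to ≈-trans)
  open F using (_≈_; Carrier; element)

  from : Carrier → Fin order
  from = Inverse.from F.enumeration

  element-from : ∀ x → element (from x) ≈ x
  element-from = Inverse.strictlyInverseˡ F.enumeration

  element-injective : ∀ {i j} → element i ≈ element j → i ≡ j
  element-injective = Injection.injective (Inverse⇒Injection F.enumeration)

  from-cong : ∀ {x y} → x ≈ y → from x ≡ from y
  from-cong = Inverse.from-cong F.enumeration

  from-element : ∀ i → from (element i) ≡ i
  from-element i = element-injective (element-from (element i))

  rawRing : RawRing 0ℓ 0ℓ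
  rawRing = record
    { Carrier = Fin order ; _≈_ = _≡_
    ; _+_ = λ i j → from (element i F.+ element j)
    ; _*_ = λ i j → from (element i F.* element j)
    ; -_ = λ i → from (F.- element i)
    ; 0# = from F.0# ; 1# = from F.1# }

  isRingMonomorphism : IsRingMonomorphism rawRing F.rawRing element
  isRingMonomorphism = record
    { isRingHomomorphism = record
      { isSemiringHomomorphism = record
        { isNearSemiringHomomorphism = record
          { +-isMonoidHomomorphism = record
            { isMagmaHomomorphism = record
              { isRelHomomorphism = record { cong = λ { refl → F.≈-refl } }
              ; homo = λ i j → element-from _ }
            ; ε-homo = element-from _ }
          ; *-homo = λ i j → element-from _ }
        ; 1#-homo = element-from _ }
      ; -‿homo = λ i → element-from _ }
    ; injective = element-injective }

  private
    module R = RawRing rawRing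

  1≢0 : R.1# ≢ R.0#
  -- If 1 = 0 then all elements coincide, but `Fin order` has the distinct elements 0 and 1.
  1≢0 e = Fin.<⇒≢ {i = Fin.fromℕ< (ℕ.<⇒≤ 1<order)} {j = Fin.fromℕ< 1<order}
    (subst₂ _<_ (sym (Fin.toℕ-fromℕ< (ℕ.<⇒≤ 1<order))) (sym (Fin.toℕ-fromℕ< 1<order)) (s≤s z≤n))
    (element-injective (F.≈-trans (vanish _) (F.≈-sym (vanish _))))
    where
    1≈0 : F.1# ≈ F.0#
    1≈0 = F.≈-trans (F.≈-sym (element-from F.1#)) (F.≈-trans (F.reflexive (cong element e)) (element-from F.0#))
    vanish : ∀ x → x ≈ F.0#
    vanish x = F.≈-trans (F.≈-sym (F.*-identityˡ x)) (F.≈-trans (F.*-congʳ 1≈0) (F.zeroˡ x))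

  -- A Heyting field inverts only what is apart from 0. The search over `Fin` makes the existence of
  -- an inverse stable, and an x without inverse is not apart from 0, hence equal to 0 by tightness.
  inverse : ∀ x → x ≢ R.0# → ∃ λ y → x R.* y ≡ R.1#
  inverse x x≢0 = decidable-stable (Fin.any? (λ y → (x R.* y) Fin.≟ R.1#)) λ ¬inv →
    x≢0 (trans (sym (from-element x)) (from-cong (proj₁ (HF.tight _ _) λ x#0 → ¬inv (fromInvertible (HF.#⇒invertible x#0)))))
    where
    module HF = HeytingField F.heytingField
    open import Algebra.Definitions HF._≈_ using (Invertible)
    fromInvertible : Invertible HF.1# HF._*_ (element x HF.- F.0#) → ∃ λ y → x R.* y ≡ R.1#
    fromInvertible (y , _ , x-0*y≈1) = from y , from-cong
      (F.≈-trans (F.*-congˡ (element-from y)) (F.≈-trans (F.*-congʳ (F.≈-sym x-0≈x)) x-0*y≈1))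
      where
      open import Algebra.Properties.Ring F.ring using (-0#≈0#)
      x-0≈x : element x F.+ F.- F.0# ≈ element x
      x-0≈x = F.≈-trans (F.+-congˡ -0#≈0#) (F.+-identityʳ _)

  discreteField : DiscreteField (Fin order)
  discreteField = record
    { _+_ = R._+_ ; _*_ = R._*_ ; -_ = R.-_ ; 0# = R.0# ; 1# = R.1#
    ; isCommutativeRing = Algebra.Morphism.RingMonomorphism.isCommutativeRing isRingMonomorphism F.isCommutativeRing
    ; 1≢0 = 1≢0 ; inverse = inverse ; _≟_ = Fin._≟_ }

  enumeration : Enumeration (Fin order)
  enumeration = record { elements = allFin order ; unique = Unique.allFin⁺ order ; complete = ∈.∈-allFin }

  |elements| : length (Enumeration.elements enumeration) ≡ order
  |elements| = length-tabulate id

  private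
    module D = FieldProperties discreteField
  open Algebra.Properties.Semiring.Exp F.semiring using (^-congˡ)

  element-+ : ∀ i j → element (i D.+ j) ≈ element i F.+ element j
  element-+ i j = element-from _

  element-* : ∀ i j → element (i D.* j) ≈ element i F.* element j
  element-* i j = element-from _

  element-^ : ∀ i k → element (i D.^ k) ≈ element i F.^ k
  element-^ i zero    = element-from F.1#
  element-^ i (suc k) = F.≈-trans (element-* i (i D.^ k)) (F.*-congˡ (element-^ i k))

  element-∑ : ∀ n (f : ℕ → Fin order) (g : ℕ → Carrier) → (∀ j → element (f j) ≈ g j) →
              element (D.∑ (upTo n) f) ≈ F.sum {n} (λ j → g (toℕ j))
  element-∑ zero    f g e = element-from F.0#
  element-∑ (suc n) f g e = F.≈-trans (F.reflexive (cong element (D.∑-upTo-suc n f)))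
    (F.≈-trans (element-+ (f 0) _) (F.+-cong (e 0) (element-∑ n (f ∘ suc) (g ∘ suc) (e ∘ suc))))

  element-tr : ∀ m i → element (D.∑ (upTo m) (λ j → i D.^ (3 ℕ.^ j))) ≈ absoluteTrace F m (element i)
  element-tr m i = element-∑ m (λ j → i D.^ (3 ℕ.^ j)) (λ j → element i F.^ (3 ℕ.^ j)) (λ j → element-^ i (3 ℕ.^ j))

  sum-tabulate : ∀ n (f : Fin order → ℤ[ω]) (g : Fin n → Fin order) → ℤω.∑ (tabulate g) f ≡ Eisenstein.sum (λ i → f (g i))
  sum-tabulate zero    f g = refl
  sum-tabulate (suc n) f g = cong (f (g Fin.zero) ℤω.+_) (sum-tabulate n f (g ∘ Fin.suc))

  sum-elements : ∀ f → ℤω.∑ (Enumeration.elements enumeration) f ≡ Eisenstein.sum f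
  sum-elements f = sum-tabulate order f id

  module _ (M : ℕ) (0<M : 0 < M) (order≡ : order ≡ 3 ℕ.^ M) where
    |elements|≡ : length (Enumeration.elements enumeration) ≡ 3 ℕ.^ M
    |elements|≡ = trans |elements| order≡

    private
      module T = Ternary discreteField enumeration M 0<M |elements|≡

    element-argument : ∀ a i → element (i T.+ a T.* i T.⁻¹) ≈ element i F.+ element a F.* element i F.^ (order ∸ 2)
    element-argument a i = F.≈-trans (element-+ i _) (F.+-congˡ (F.≈-trans (element-* a _)
      (F.*-congˡ (F.≈-trans (F.reflexive (cong (λ k → element (i D.^ (k ∸ 2))) |elements|)) (element-^ i (order ∸ 2))))))

    -- For F itself θ is the absolute trace; for an extension field it is the
    -- absolute trace of the relative trace.
    kloostermanSum≡ : ∀ (θ : Carrier → Carrier) → (∀ {x y} → x ≈ y → θ x ≈ θ y) → (∀ i → element (T.tr i) ≈ θ (element i)) →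
      ∀ a b → element b ≈ a → ℤω.∑ T.elements (λ i → T.ψ (i T.+ b T.* i T.⁻¹)) ≡ kloostermanSum F (λ x → ω^_ F (θ x)) a
    kloostermanSum≡ θ θ-cong element-θ a b b≈a = trans (sum-elements _) (sum-cong order (λ i → cong T.ζ (trans
      (sym (from-element _)) (from-cong (F.≈-trans (element-θ _)
        (θ-cong (F.≈-trans (element-argument b i) (F.+-congˡ (F.*-congʳ b≈a)))))))))
      where
      sum-cong : ∀ n {f g : Fin n → ℤ[ω]} → (∀ i → f i ≡ g i) → Eisenstein.sum f ≡ Eisenstein.sum g
      sum-cong zero    e = refl
      sum-cong (suc n) e = cong₂ ℤω._+_ (e Fin.zero) (sum-cong n (λ i → e (Fin.suc i)))

  sum-cong-≈ : ∀ n {f g : Fin n → Carrier} → (∀ i → f i ≈ g i) → F.sum f ≈ F.sum g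
  sum-cong-≈ zero    e = F.≈-refl
  sum-cong-≈ (suc n) e = F.+-cong (e Fin.zero) (sum-cong-≈ n (λ i → e (Fin.suc i)))

  absoluteTrace-cong : ∀ m {x y} → x ≈ y → absoluteTrace F m x ≈ absoluteTrace F m y
  absoluteTrace-cong m e = sum-cong-≈ m (λ j → ^-congˡ (3 ℕ.^ toℕ j) e)

  relativeTrace-cong : ∀ q n {x y} → x ≈ y → relativeTrace F q n x ≈ relativeTrace F q n y
  relativeTrace-cong q n e = sum-cong-≈ n (λ j → ^-congˡ (q ℕ.^ toℕ j) e)

-- Return to the given fields

open import Data.Nat.Base using (_+_; _*_; _^_)

1<3^ : ∀ {m} → 0 < m → 1 < 3 ^ m
1<3^ {m} 0<m = ℕ.≤-trans (s≤s (s≤s z≤n)) (ℕ.^-monoʳ-≤ 3 0<m)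

gcd≡1⇒3∤ : ∀ s → gcd s 3 ≡ 1 → ¬ 3∣ (ℤ.+ s)
gcd≡1⇒3∤ s e 3∣s = contradiction (ℕ∣.∣⇒≤ (subst (3 ℕ∣.∣_) e (gcd-greatest (ℤ∣.∣⇒∣ᵤ 3∣s) ℕ∣.∣-refl))) λ { (s≤s ()) }

module _ {c ℓ₁ ℓ₂ c′ ℓ₁′ ℓ₂′ : Level} (m n : ℕ) (2≤m : 2 ≤ m) (0<n : 0 < n)
    (𝔽 : FiniteField c ℓ₁ ℓ₂ (3 ^ m)) (𝔼 : FiniteField c′ ℓ₁′ ℓ₂′ ((3 ^ m) ^ n)) (𝔽⊂𝔼 : Extension 𝔽 𝔼) where
  private
    module 𝔽 = FiniteField 𝔽
    module 𝔼 where
      open FiniteField 𝔼 public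
      open CommutativeRing commutativeRing public using () renaming (refl to ≈-refl; sym to ≈-sym; trans to ≈-trans)
    module ι where
      open Extension 𝔽⊂𝔼 public
      open IsRingMonomorphism isRingMonomorphism public
    order-𝔼 : (3 ^ m) ^ n ≡ 3 ^ (m * n)
    order-𝔼 = ℕ.^-*-assoc 3 m n
    0<mn : 0 < m * n
    0<mn = ℕ.*-mono-≤ (ℕ.<⇒≤ 2≤m) 0<n
    module TF = Transport 𝔽 (1<3^ (ℕ.<⇒≤ 2≤m))
    module TE = Transport 𝔼 (subst (1 <_) (sym order-𝔼) (1<3^ 0<mn))

  embedFin : Fin (3 ^ m) → Fin ((3 ^ m) ^ n)
  embedFin i = TE.from (ι.embed (𝔽.element i))

  embedFin-from : ∀ x → embedFin (TF.from x) ≡ TE.from (ι.embed x)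
  embedFin-from x = TE.from-cong (ι.⟦⟧-cong (TF.element-from x))

  embedFin-+ : ∀ i j → embedFin (DiscreteField._+_ TF.discreteField i j) ≡ DiscreteField._+_ TE.discreteField (embedFin i) (embedFin j)
  embedFin-+ i j = trans (embedFin-from (𝔽.element i 𝔽.+ 𝔽.element j)) (TE.from-cong
    (𝔼.≈-trans (ι.+-homo (𝔽.element i) (𝔽.element j)) (𝔼.+-cong
      (𝔼.≈-sym (TE.element-from (ι.embed (𝔽.element i)))) (𝔼.≈-sym (TE.element-from (ι.embed (𝔽.element j)))))))

  embedFin-* : ∀ i j → embedFin (DiscreteField._*_ TF.discreteField i j) ≡ DiscreteField._*_ TE.discreteField (embedFin i) (embedFin j)
  embedFin-* i j = trans (embedFin-from (𝔽.element i 𝔽.* 𝔽.element j)) (TE.from-cong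
    (𝔼.≈-trans (ι.*-homo (𝔽.element i) (𝔽.element j)) (𝔼.*-cong
      (𝔼.≈-sym (TE.element-from (ι.embed (𝔽.element i)))) (𝔼.≈-sym (TE.element-from (ι.embed (𝔽.element j)))))))

  embedFin-1 : embedFin (DiscreteField.1# TF.discreteField) ≡ DiscreteField.1# TE.discreteField
  embedFin-1 = trans (embedFin-from 𝔽.1#) (TE.from-cong ι.1#-homo)

  order-𝔽′ : length (Enumeration.elements TF.enumeration) ≡ 3 ^ m
  order-𝔽′ = TF.|elements|≡ m (ℕ.<⇒≤ 2≤m) refl

  order-𝔼′ : length (Enumeration.elements TE.enumeration) ≡ 3 ^ (m * n)
  order-𝔼′ = TE.|elements|≡ (m * n) 0<mn order-𝔼

  open KloostermanExtension TF.discreteField TF.enumeration TE.discreteField TE.enumeration m n 2≤m 0<n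
    order-𝔽′ order-𝔼′ embedFin embedFin-+ embedFin-* embedFin-1
    using (E-tr; iterate; iterate≡^; exponent-extension; ιa≢0; module E; module F)

  -- The character on the copy of 𝔼 uses one power sum of length m n, and the statement uses nested
  -- traces; `E-tr` identifies them.
  element-tr-E : ∀ i → 𝔼.element (E.tr i) 𝔼.≈ absoluteTrace 𝔼 m (relativeTrace 𝔼 (3 ^ m) n (𝔼.element i))
  element-tr-E i = 𝔼.≈-trans (𝔼.reflexive (cong 𝔼.element (E-tr n i)))
    (TE.element-∑ m (λ j → E.∑ (upTo n) (λ k → iterate k i) E.^ (3 ^ j)) (λ j → relativeTrace 𝔼 (3 ^ m) n (𝔼.element i) 𝔼.^ (3 ^ j))
      λ j → 𝔼.≈-trans (TE.element-^ _ (3 ^ j)) (^-congˡ (3 ^ j)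
        (TE.element-∑ n (λ k → iterate k i) (λ k → 𝔼.element i 𝔼.^ ((3 ^ m) ^ k))
          λ k → 𝔼.≈-trans (𝔼.reflexive (cong 𝔼.element (iterate≡^ k i))) (TE.element-^ i ((3 ^ m) ^ k)))))
    where open Algebra.Properties.Semiring.Exp 𝔼.semiring using (^-congˡ)

  module _ (a : 𝔽.Carrier) (a≉0 : ¬ a 𝔽.≈ 𝔽.0#) where

    from-a≢0 : TF.from a ≢ F.0#
    from-a≢0 e = a≉0 (𝔽F.trans (𝔽F.sym (TF.element-from a)) (𝔽F.trans (𝔽.reflexive (cong 𝔽.element e)) (TF.element-from 𝔽.0#)))
      where module 𝔽F = CommutativeRing 𝔽.commutativeRing

    K≡ : F.kloosterman (TF.from a) from-a≢0 ≡ K m 𝔽 a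
    K≡ = TF.kloostermanSum≡ m (ℕ.<⇒≤ 2≤m) refl (absoluteTrace 𝔽 m) (TF.absoluteTrace-cong m) (TF.element-tr m)
      a (TF.from a) (TF.element-from a)

    Kₙ≡ : E.kloosterman (embedFin (TF.from a)) (ιa≢0 (TF.from a) from-a≢0) ≡ Kₙ m n 𝔼 (ι.embed a)
    Kₙ≡ = TE.kloostermanSum≡ (m * n) 0<mn order-𝔼 (λ x → absoluteTrace 𝔼 m (relativeTrace 𝔼 (3 ^ m) n x))
      (λ e → TE.absoluteTrace-cong m (TE.relativeTrace-cong (3 ^ m) n e)) element-tr-E
      (ι.embed a) (embedFin (TF.from a)) (𝔼.≈-trans (𝔼.reflexive (cong 𝔼.element (embedFin-from a))) (TE.element-from (ι.embed a)))

    Hₙ≡H+h : ∀ h s → n ≡ 3 ^ h * s → gcd s 3 ≡ 1 → Hₙ m n 𝔼 (ι.embed a) ≡ H m 𝔽 a + h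
    Hₙ≡H+h h s n≡ gcd≡1 = trans (cong (exponentOr (m * n)) (sym Kₙ≡))
      (trans (exponent-extension (TF.from a) from-a≢0 h s (gcd≡1⇒3∤ s gcd≡1) 0<s n≡)
        (cong (λ z → exponentOr m z + h) K≡))
      where
      0<s : 0 < s
      0<s = ℕ.n≢0⇒n>0 λ { refl → ℕ.<⇒≢ 0<n (sym (trans n≡ (ℕ.*-zeroʳ (3 ^ h)))) }

theorem2 : ∀ {c ℓ₁ ℓ₂ c′ ℓ₁′ ℓ₂′ : Level} (m n h s : ℕ) → 2 ≤ m → 2 ≤ n →
    n ≡ 3 ^ h * s → gcd s 3 ≡ 1 →
    (F : FiniteField c ℓ₁ ℓ₂ (3 ^ m)) (E : FiniteField c′ ℓ₁′ ℓ₂′ ((3 ^ m) ^ n)) →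
    (F⊂E : Extension F E) →
    (a : FiniteField.Carrier F) → ¬ (FiniteField._≈_ F a (FiniteField.0# F)) →
    Hₙ m n E (Extension.embed F⊂E a) ≡ H m F a + h
theorem2 m n h s 2≤m 2≤n n≡ gcd≡1 F E F⊂E a a≉0 = Hₙ≡H+h m n 2≤m (ℕ.<⇒≤ 2≤n) F E F⊂E a a≉0 h s n≡ gcd≡1
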